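{- Let $\mathfrak{d}=\bigoplus_{n\ge0}\mathfrak{d}_n:\mathsf{cf}(\mathrm{UT}_\bullet)\to\mathsf{cf}(\mathrm{UT}_\bullet)$ with $\mathfrak{d}_n(\psi)=\psi\circ\dagger$. Then $\mathfrak{d}$ is a graded antiautomorphism of the Hopf algebra $\mathsf{cf}(\mathrm{UT}_\bullet)$, i.e. $\mu\circ(\mathfrak{d}\otimes\mathfrak{d})=\mathfrak{d}\circ\mu\circ\beta$ and $\Delta\circ\mathfrak{d}=\beta\circ(\mathfrak{d}\otimes\mathfrak{d})\circ\Delta$, where $\beta$ swaps the two tensor factors. Moreover $\mathrm{Ind}^{\mathrm{GL}}_{\mathrm{UT}}\circ\mathfrak{d}=\mathrm{Ind}^{\mathrm{GL}}_{\mathrm{UT}}$, where $\mathrm{Ind}^{\mathrm{GL}}_{\mathrm{UT}}=\bigoplus_n\mathrm{Ind}^{\mathrm{GL}_n}_{\mathrm{UT}_n}$.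
   Context: Fix the finite field $\mathbb{F}_q$; $[n]=\{1,\dots,n\}$. $\mathrm{GL}_n$ is the group of invertible $n\times n$ matrices over $\mathbb{F}_q$, $\mathrm{UT}_n$ the unipotent upper triangular subgroup, $\mathsf{cf}(G)$ complex class functions, $\mathrm{Ind}$ induction. Let $\tilde w(i)=n+1-i$ and for an $n\times n$ matrix $x$ define $x^\dagger$ by $(x^\dagger)_{r,s}=x_{\tilde w(s),\tilde w(r)}$; $\dagger$ is an anti-automorphism of $\mathrm{GL}_n$ preserving $\mathrm{UT}_n$. Hopf algebra $\mathsf{cf}(\mathrm{UT}_\bullet)=\bigoplus_n\mathsf{cf}(\mathrm{UT}_n)$: for $I\subseteq[n]$, $I^c=[n]\setminus I$, let $\mathrm{UL}_I=\{g\in\mathrm{UT}_n:(g-1_n)_{i,j}\ne0\text{ only if }(i,j)\in I\times I\cup I^c\times I^c\}$, $\mathrm{UR}_I=\{g\in\mathrm{UT}_n:(g-1_n)_{i,j}\ne0\text{ only if }(i,j)\in I\times I^c\}$, $\mathrm{UP}_I=\{g\in\mathrm{UT}_n:(g-1_n)_{i,j}=0\text{ for }(i,j)\in I^c\times I\}=\mathrm{UL}_I\ltimes\mathrm{UR}_I$ (and $\mathrm{UP}_{[i]}=\mathrm{UT}_n$). With $\mathrm{cano}_I:I\to[|I|]$ order-preserving, $\mathrm{UL}_I\cong\mathrm{UT}_{|I|}\times\mathrm{UT}_{|I^c|}$ by relabelling the $I\times I$ and $I^c\times I^c$ blocks via $\mathrm{cano}_I,\mathrm{cano}_{I^c}$,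 inducing $\mathrm{st}_{(I,I^c)}:\mathsf{cf}(\mathrm{UL}_I)\to\mathsf{cf}(\mathrm{UT}_{|I|})\otimes\mathsf{cf}(\mathrm{UT}_{|I^c|})$. Product $\mu=\bigoplus_{n\ge i\ge0}\mathrm{Inf}^{\mathrm{UT}_n}_{\mathrm{UL}_{[i]}}\circ\mathrm{st}^{ -1}_{([i],[i]^c)}$ where $\mathrm{Inf}\psi(lr)=\psi(l)$; coproduct $\Delta=\bigoplus_n\sum_{I\subseteq[n]}\mathrm{st}_{(I,I^c)}\circ\mathrm{Def}^{\mathrm{UP}_I}_{\mathrm{UL}_I}\circ\mathrm{Res}^{\mathrm{UT}_n}_{\mathrm{UP}_I}$ where $\mathrm{Def}^{\mathrm{UP}_I}_{\mathrm{UL}_I}\psi(g)=\frac1{|\mathrm{UR}_I|}\sum_{x\in\mathrm{UR}_I}\psi(gx)$. -}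

module Defs where

open import Algebra.Apartness.Bundles using (HeytingField; HeytingCommutativeRing)
open import Algebra.Bundles using (Monoid; CommutativeMonoid; Group; CommutativeRing)
import Algebra.Construct.DirectProduct as DirectProduct
import Algebra.Definitions as AlgDefs
import Algebra.Definitions.RawMonoid as RawMonoidDefs
open import Algebra.Module.Bundles using (LeftModule)
open import Algebra.Module.Morphism.Structures using (module LeftModuleMorphisms)
open import Algebra.Module.Structures using (IsLeftModule)
import Algebra.Properties.CommutativeMonoid.Sum as CMSum
import Algebra.Properties.CommutativeSemigroup as CommSemigroup
open import Data.Bool.Base using (if_then_else_)
open import Data.Bool.Properties using (T-≡)
open import Data.Fin.Base as Fin using (Fin; zero; suc; toℕ; opposite)
import Data.Fin.Induction as FinInd
open import Data.Fin.Permutation using (reverse)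
import Data.Fin.Properties as Finₚ
open import Data.Fin.Subset using (Subset; inside; outside; ∣_∣; ∁; _∈_; _∉_)
open import Data.Fin.Subset.Properties
  using (_∈?_; x∈p⇒x∉∁p; x∉p⇒x∈∁p; x∈∁p⇒x∉p; drop-there; ∣∁p∣≡n∸∣p∣; ∣p∣≤n)
open import Data.List.Base as List using (List; []; _∷_; _++_)
import Data.List.Properties as Listₚ
open import Data.Nat.Base as ℕ using (ℕ; zero; suc; NonZero)
import Data.Nat.Properties as ℕₚ
open import Data.Product.Base using (Σ; ∃; _×_; _,_; proj₁; proj₂)
open import Data.Sum.Base using (_⊎_; inj₁; inj₂; [_,_])
open import Data.Vec.Base as Vec using ([]; _∷_; here; there)
import Data.Vec.Properties as Vecₚ
open import Function.Base using (_∘_; id; flip)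
open import Function.Bundles using (Inverse; Equivalence)
import Function.Construct.Composition as Comp
import Function.Construct.Symmetry as Symm
open import Induction.WellFounded using (Acc; acc)
open import Level using (Level; _⊔_) renaming (suc to lsuc)
open import Relation.Binary.Bundles using (Setoid)
import Relation.Binary.Construct.On as On
open import Relation.Binary.PropositionalEquality as ≡ using (_≡_; _≢_)
import Relation.Binary.Reasoning.Setoid as SetoidReasoning
open import Relation.Nullary using (¬_; Dec; yes; no; does; contradiction)
open import Relation.Nullary.Decidable using (map′; _×-dec_; _⊎-dec_; ¬?; _→-dec_)

private
  variable
    a b c p ℓ ℓ′ ℓ″ : Level

record Finite (S : Setoid a ℓ) : Set (a ⊔ ℓ) where
  field
    size        : ℕ
    enumeration : Inverse S (≡.setoid (Fin size))

  open Setoid S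
  open Inverse enumeration public
    renaming (to to index; from to elem; to-cong to index-cong)
    using ()

  elem-index : ∀ x → elem (index x) ≈ x
  elem-index = Inverse.strictlyInverseʳ enumeration

  index-elem : ∀ i → index (elem i) ≡ i
  index-elem = Inverse.strictlyInverseˡ enumeration

  infix 4 _≟_
  _≟_ : ∀ x y → Dec (x ≈ y)
  x ≟ y = map′ (λ e → trans (sym (elem-index x)) (trans (reflexive (≡.cong elem e)) (elem-index y)))
               index-cong (index x Finₚ.≟ index y)

  nonEmpty : Carrier → NonZero size
  nonEmpty x = Finₚ.nonZeroIndex (index x)

  any? : {P : Carrier → Set p} → (∀ {x y} → x ≈ y → P x → P y) → (∀ x → Dec (P x)) → Dec (∃ P)
  any? resp P? = map′ (λ (i , q) → elem i , q)
                      (λ (x , q) → index x , resp (sym (elem-index x)) q)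
                      (Finₚ.any? (P? ∘ elem))

vectorSetoid : Setoid a ℓ → ℕ → Setoid a ℓ
vectorSetoid S n = record
  { Carrier       = Fin n → S.Carrier
  ; _≈_           = λ f g → ∀ i → f i S.≈ g i
  ; isEquivalence = record
    { refl = λ _ → S.refl ; sym = λ e i → S.sym (e i) ; trans = λ e e′ i → S.trans (e i) (e′ i) }
  } where module S = Setoid S

funToFin-cong : ∀ {m n} {f g : Fin m → Fin n} → (∀ i → f i ≡ g i) → Fin.funToFin f ≡ Fin.funToFin g
funToFin-cong {zero}  e = ≡.refl
funToFin-cong {suc m} e = ≡.cong₂ Fin.combine (e zero) (funToFin-cong (e ∘ suc))

abstract
  vector-finite : {S : Setoid a ℓ} → Finite S → ∀ n → Finite (vectorSetoid S n)
  vector-finite {S = S} fin n = record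
    { size        = F.size ℕ.^ n
    ; enumeration = record
      { to        = λ f → Fin.funToFin (F.index ∘ f)
      ; from      = λ k → F.elem ∘ Fin.finToFun k
      ; to-cong   = λ e → funToFin-cong (λ i → F.index-cong (e i))
      ; from-cong = λ { ≡.refl i → S.refl }
      ; inverse   = (λ {k} e → ≡.trans
                       (funToFin-cong (λ i → ≡.trans (F.index-cong (e i)) (F.index-elem _)))
                       (Finₚ.funToFin-finToFin {n} {F.size} k))
                  , λ {f} e i → S.trans
                       (S.reflexive (≡.cong F.elem (≡.trans
                         (≡.cong (λ k → Fin.finToFun {F.size} {n} k i) e)
                         (Finₚ.finToFun-funToFin (F.index ∘ f) i))))
                       (F.elem-index (f i))
      }
    } where
      module S = Setoid S
      module F = Finite fin

private
  record Selection {N} (P : Fin N → Set p) : Set p where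
    field
      count   : ℕ
      to      : ∀ i → P i → Fin count
      from    : Fin count → Fin N
      from-P  : ∀ j → P (from j)
      from-to : ∀ i q → from (to i q) ≡ i
      from-injective : ∀ {j k} → from j ≡ from k → j ≡ k

  select : ∀ {N} {P : Fin N → Set p} → (∀ i → Dec (P i)) → Selection P
  select {N = zero}  P? = record
    { count = 0 ; to = λ () ; from = λ () ; from-P = λ () ; from-to = λ () ; from-injective = λ { {()} } }
  select {N = suc N} P? with select (P? ∘ suc) | P? zero
  ... | s | no ¬p = record
    { count = s.count
    ; to = λ { zero q → contradiction q ¬p ; (suc i) q → s.to i q }
    ; from = suc ∘ s.from
    ; from-P = s.from-P
    ; from-to = λ { zero q → contradiction q ¬p ; (suc i) q → ≡.cong suc (s.from-to i q) }
    ; from-injective = s.from-injective ∘ Finₚ.suc-injective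
    } where module s = Selection s
  ... | s | yes p = record
    { count = suc s.count
    ; to = λ { zero q → zero ; (suc i) q → suc (s.to i q) }
    ; from = λ { zero → zero ; (suc j) → suc (s.from j) }
    ; from-P = λ { zero → p ; (suc j) → s.from-P j }
    ; from-to = λ { zero q → ≡.refl ; (suc i) q → ≡.cong suc (s.from-to i q) }
    ; from-injective = λ
      { {zero} {zero} e → ≡.refl
      ; {suc j} {suc k} e → ≡.cong suc (s.from-injective (Finₚ.suc-injective e)) }
    } where module s = Selection s

subsetSetoid : (S : Setoid a ℓ) (P : Setoid.Carrier S → Set p) → Setoid (a ⊔ p) ℓ
subsetSetoid S P = On.setoid {B = Σ (Setoid.Carrier S) P} S proj₁

abstract
  subset-finite : {S : Setoid a ℓ} (let open Setoid S) {P : Carrier → Set p} →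
                  (∀ {x y} → x ≈ y → P x → P y) → (∀ x → Dec (P x)) →
                  Finite S → Finite (subsetSetoid S P)
  subset-finite {S = S} {P} resp P? fin = record
    { size        = s.count
    ; enumeration = record
      { to        = λ (x , q) → s.to (F.index x) (index-P x q)
      ; from      = λ j → F.elem (s.from j) , s.from-P j
      ; to-cong   = λ {x} {y} e → s.from-injective (≡.trans (s.from-to _ _)
                      (≡.trans (F.index-cong e) (≡.sym (s.from-to _ _))))
      ; from-cong = λ { ≡.refl → S.refl }
      ; inverse   = (λ {j} e → s.from-injective (≡.trans (s.from-to _ _)
                      (≡.trans (F.index-cong e) (F.index-elem _))))
                  , λ {(x , q)} e → S.trans
                      (S.reflexive (≡.cong F.elem (≡.trans (≡.cong s.from e) (s.from-to _ _))))
                      (F.elem-index x)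
      }
    } where
      module S = Setoid S
      module F = Finite fin
      module s = Selection (select (P? ∘ F.elem))
      index-P : ∀ x → P x → P (F.elem (F.index x))
      index-P x q = resp (S.sym (F.elem-index x)) q

module FiniteSum (M : CommutativeMonoid b ℓ′) where
  open CommutativeMonoid M
    renaming (_∙_ to _+_; ∙-cong to +-cong; identityˡ to +-identityˡ; identityʳ to +-identityʳ; ε to 0#)
  open CMSum M public using (sum; sum-cong-≋; sum-replicate; sum-replicate-zero; ∑-distrib-+; ∑-comm)
  open CMSum M using (sum-permute)
  open import Algebra.Properties.Monoid.Mult monoid public using () renaming (_×_ to _·_)

  module _ {S : Setoid a ℓ} (fin : Finite S) where
    open Finite fin
    private module S = Setoid S

    ∑ : (S.Carrier → Carrier) → Carrier
    ∑ f = sum (f ∘ elem)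

    ∑-cong : {f g : S.Carrier → Carrier} → (∀ x → f x ≈ g x) → ∑ f ≈ ∑ g
    ∑-cong e = sum-cong-≋ (e ∘ elem)

    ∑-reindex : (f : S.Carrier → Carrier) → (∀ {x y} → x S.≈ y → f x ≈ f y) →
                (φ : Inverse S S) → ∑ (f ∘ Inverse.to φ) ≈ ∑ f
    ∑-reindex f f-cong φ = sym (trans
      (sum-permute (f ∘ elem) π)
      (sum-cong-≋ {size} (λ i → f-cong (elem-index (Inverse.to φ (elem i))))))
      where
        π : Inverse (≡.setoid (Fin size)) (≡.setoid (Fin size))
        π = Comp.inverse (Symm.inverse enumeration) (Comp.inverse φ enumeration)

    ∑-single : (f : S.Carrier → Carrier) → (∀ {x y} → x S.≈ y → f x ≈ f y) →
               ∀ x → (∀ y → ¬ (y S.≈ x) → f y ≈ 0#) → ∑ f ≈ f x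
    ∑-single f f-cong x f≈0 = trans
      (single (f ∘ elem) (index x) λ j j≢ → f≈0 (elem j) λ e →
        j≢ (≡.trans (≡.sym (index-elem j)) (index-cong e)))
      (f-cong (elem-index x))
      where
        single : ∀ {n} (g : Fin n → Carrier) i → (∀ j → j ≢ i → g j ≈ 0#) → sum g ≈ g i
        single {suc n} g zero    e = trans
          (+-cong refl (trans (sum-cong-≋ (λ j → e (suc j) λ ())) (sum-replicate-zero n)))
          (+-identityʳ _)
        single {suc n} g (suc i) e = trans
          (+-cong (e zero λ ()) (single (g ∘ suc) i (λ j j≢ → e (suc j) (j≢ ∘ Finₚ.suc-injective))))
          (+-identityˡ _)

record Hom {a b ℓ ℓ′} (G : Group a ℓ) (H : Group b ℓ′) : Set (a ⊔ b ⊔ ℓ ⊔ ℓ′) where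
  private
    module G = Group G
    module H = Group H
  field
    ⟦_⟧    : G.Carrier → H.Carrier
    ⟦⟧-cong : ∀ {x y} → x G.≈ y → ⟦ x ⟧ H.≈ ⟦ y ⟧
    homo   : ∀ x y → ⟦ x G.∙ y ⟧ H.≈ ⟦ x ⟧ H.∙ ⟦ y ⟧

  ⁻¹-homo : ∀ x → ⟦ x G.⁻¹ ⟧ H.≈ ⟦ x ⟧ H.⁻¹
  ⁻¹-homo x = inverseˡ-unique _ _ (H.trans (H.sym (homo _ _)) (H.trans (⟦⟧-cong (G.inverseˡ x)) ε-homo))
    where
      open import Algebra.Properties.Group H using (inverseˡ-unique; identityˡ-unique)
      ε-homo : ⟦ G.ε ⟧ H.≈ H.ε
      ε-homo = identityˡ-unique _ _ (H.trans (H.sym (homo _ _)) (⟦⟧-cong (G.identityˡ G.ε)))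

  conj-homo : ∀ h g → ⟦ h G.∙ g G.∙ h G.⁻¹ ⟧ H.≈ ⟦ h ⟧ H.∙ ⟦ g ⟧ H.∙ ⟦ h ⟧ H.⁻¹
  conj-homo h g = H.trans (homo _ _) (H.∙-cong (homo _ _) (⁻¹-homo h))

infixr 9 _∘ₕ_
_∘ₕ_ : {G : Group a ℓ} {H : Group b ℓ′} {K : Group c ℓ″} → Hom H K → Hom G H → Hom G K
_∘ₕ_ {K = K} f g = record
  { ⟦_⟧     = f.⟦_⟧ ∘ g.⟦_⟧
  ; ⟦⟧-cong = f.⟦⟧-cong ∘ g.⟦⟧-cong
  ; homo    = λ x y → Group.trans K (f.⟦⟧-cong (g.homo x y)) (f.homo _ _)
  } where
    module f = Hom f
    module g = Hom g

-- The inverse is part of the data of a unit but is ignored by the equality.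
units : Monoid a ℓ → Group (a ⊔ ℓ) ℓ
units M = record
  { Carrier = Unit
  ; _≈_     = _≈ᵁ_
  ; _∙_     = _∙ᵁ_
  ; ε       = εᵁ
  ; _⁻¹     = _⁻¹ᵁ
  ; isGroup = record
    { isMonoid = record
      { isSemigroup = record
        { isMagma = record
          { isEquivalence = On.isEquivalence proj₁ isEquivalence
          ; ∙-cong = λ {x} {y} {u} {v} → ∙ᵁ-cong {x} {y} {u} {v} }
        ; assoc = ∙ᵁ-assoc }
      ; identity = ∙ᵁ-identity }
    ; inverse = ∙ᵁ-inverse
    ; ⁻¹-cong = λ {x} {y} → ⁻¹ᵁ-cong {x} {y}
    }
  }
  where
    open Monoid M
    open AlgDefs _≈_ using (Invertible)
    open SetoidReasoning setoid

    abstract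
      cancel : ∀ {x x′ y y′} → x′ ∙ x ≈ ε → y′ ∙ y ≈ ε → (y′ ∙ x′) ∙ (x ∙ y) ≈ ε
      cancel {x} {x′} {y} {y′} l l′ = begin
        (y′ ∙ x′) ∙ (x ∙ y)  ≈⟨ assoc y′ x′ (x ∙ y) ⟩
        y′ ∙ (x′ ∙ (x ∙ y))  ≈⟨ ∙-congˡ (assoc x′ x y) ⟨
        y′ ∙ ((x′ ∙ x) ∙ y)  ≈⟨ ∙-congˡ (∙-congʳ l) ⟩
        y′ ∙ (ε ∙ y)         ≈⟨ ∙-congˡ (identityˡ y) ⟩
        y′ ∙ y               ≈⟨ l′ ⟩
        ε                    ∎

    Unit : Set _
    Unit = Σ Carrier (Invertible ε _∙_)

    _≈ᵁ_ : Unit → Unit → Set _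
    x ≈ᵁ y = proj₁ x ≈ proj₁ y

    _∙ᵁ_ : Unit → Unit → Unit
    (x , x′ , l , r) ∙ᵁ (y , y′ , l′ , r′) = x ∙ y , y′ ∙ x′ , cancel l l′ , cancel r′ r

    _⁻¹ᵁ : Unit → Unit
    (x , x′ , l , r) ⁻¹ᵁ = x′ , x , r , l

    εᵁ : Unit
    εᵁ = ε , ε , identityˡ ε , identityˡ ε

    abstract
      ∙ᵁ-cong : AlgDefs.Congruent₂ _≈ᵁ_ _∙ᵁ_
      ∙ᵁ-cong = ∙-cong

      ∙ᵁ-assoc : AlgDefs.Associative _≈ᵁ_ _∙ᵁ_
      ∙ᵁ-assoc x y z = assoc (proj₁ x) (proj₁ y) (proj₁ z)

      ∙ᵁ-identity : AlgDefs.Identity _≈ᵁ_ εᵁ _∙ᵁ_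
      ∙ᵁ-identity = identityˡ ∘ proj₁ , identityʳ ∘ proj₁

      ∙ᵁ-inverse : AlgDefs.Inverse _≈ᵁ_ εᵁ _⁻¹ᵁ _∙ᵁ_
      ∙ᵁ-inverse = (λ (x , x′ , l , r) → l) , (λ (x , x′ , l , r) → r)

      ⁻¹ᵁ-cong : ∀ {x y} → x ≈ᵁ y → (x ⁻¹ᵁ) ≈ᵁ (y ⁻¹ᵁ)
      ⁻¹ᵁ-cong {x , x′ , l , r} {y , y′ , l′ , r′} e = begin
        x′             ≈⟨ identityʳ x′ ⟨
        x′ ∙ ε         ≈⟨ ∙-congˡ r′ ⟨
        x′ ∙ (y ∙ y′)  ≈⟨ ∙-congˡ (∙-congʳ e) ⟨
        x′ ∙ (x ∙ y′)  ≈⟨ assoc x′ x y′ ⟨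
        (x′ ∙ x) ∙ y′  ≈⟨ ∙-congʳ l ⟩
        ε ∙ y′         ≈⟨ identityˡ y′ ⟩
        y′             ∎

abstract
  units-finite : (M : Monoid a ℓ) → Finite (Monoid.setoid M) → Finite (Group.setoid (units M))
  units-finite M fin = subset-finite
    (λ { e (y , l , r) → y , trans (∙-congˡ (sym e)) l , trans (∙-congʳ (sym e)) r })
    (λ x → Finite.any? fin
       (λ e (l , r) → trans (∙-congʳ (sym e)) l , trans (∙-congˡ (sym e)) r)
       (λ y → (y ∙ x ≟ ε) ×-dec (x ∙ y ≟ ε)))
    fin
    where
      open Monoid M
      open Finite fin using (_≟_)
  
record DecSubgroup (G : Group a ℓ) p : Set (a ⊔ ℓ ⊔ lsuc p) where
  open Group G
  infix 4 _∈? _∈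
  field
    _∈       : Carrier → Set p
    _∈?      : ∀ x → Dec (x ∈)
    ∈-resp-≈ : ∀ {x y} → x ≈ y → x ∈ → y ∈
    ∙-closed : ∀ {x y} → x ∈ → y ∈ → x ∙ y ∈
    ε-closed : ε ∈
    ⁻¹-closed : ∀ {x} → x ∈ → x ⁻¹ ∈

  private
    Member : Set (a ⊔ p)
    Member = Σ Carrier _∈

    _≈ᴴ_ : Member → Member → Set ℓ
    x ≈ᴴ y = proj₁ x ≈ proj₁ y

    _∙ᴴ_ : Member → Member → Member
    (x , p) ∙ᴴ (y , q) = x ∙ y , ∙-closed p q

    _⁻¹ᴴ : Member → Member
    (x , p) ⁻¹ᴴ = x ⁻¹ , ⁻¹-closed p

    εᴴ : Member
    εᴴ = ε , ε-closed

    abstract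
      ∙ᴴ-cong : AlgDefs.Congruent₂ _≈ᴴ_ _∙ᴴ_
      ∙ᴴ-cong = ∙-cong

      ∙ᴴ-assoc : AlgDefs.Associative _≈ᴴ_ _∙ᴴ_
      ∙ᴴ-assoc x y z = assoc (proj₁ x) (proj₁ y) (proj₁ z)

      ∙ᴴ-identity : AlgDefs.Identity _≈ᴴ_ εᴴ _∙ᴴ_
      ∙ᴴ-identity = identityˡ ∘ proj₁ , identityʳ ∘ proj₁

      ∙ᴴ-inverse : AlgDefs.Inverse _≈ᴴ_ εᴴ _⁻¹ᴴ _∙ᴴ_
      ∙ᴴ-inverse = inverseˡ ∘ proj₁ , inverseʳ ∘ proj₁

      ⁻¹ᴴ-cong : ∀ {x y} → x ≈ᴴ y → (x ⁻¹ᴴ) ≈ᴴ (y ⁻¹ᴴ)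
      ⁻¹ᴴ-cong = ⁻¹-cong

  group : Group (a ⊔ p) ℓ
  group = record
    { Carrier = Member
    ; _≈_     = _≈ᴴ_
    ; _∙_     = _∙ᴴ_
    ; ε       = εᴴ
    ; _⁻¹     = _⁻¹ᴴ
    ; isGroup = record
      { isMonoid = record
        { isSemigroup = record
          { isMagma = record
            { isEquivalence = On.isEquivalence proj₁ isEquivalence
            ; ∙-cong = λ {x} {y} {u} {v} → ∙ᴴ-cong {x} {y} {u} {v} }
          ; assoc = ∙ᴴ-assoc }
        ; identity = ∙ᴴ-identity }
      ; inverse = ∙ᴴ-inverse
      ; ⁻¹-cong = λ {x} {y} → ⁻¹ᴴ-cong {x} {y}
      }
    }

  finite : Finite setoid → Finite (Group.setoid group)
  finite = subset-finite ∈-resp-≈ _∈?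

record FiniteField c ℓ₁ ℓ₂ : Set (lsuc (c ⊔ ℓ₁ ⊔ ℓ₂)) where
  field
    heytingField : HeytingField c ℓ₁ ℓ₂
  open HeytingCommutativeRing (HeytingField.heytingCommutativeRing heytingField) public
    using (commutativeRing)
  field
    finite : Finite (CommutativeRing.setoid commutativeRing)

CharacteristicZero : ∀ {c ℓ₁ ℓ₂} → HeytingField c ℓ₁ ℓ₂ → Set ℓ₂
CharacteristicZero K = ∀ n → .{{NonZero n}} → (n · 1#) # 0#
  where
    open HeytingField K using (_#_; 0#; 1#; heytingCommutativeRing)
    open CommutativeRing (HeytingCommutativeRing.commutativeRing heytingCommutativeRing) using (+-rawMonoid)
    open RawMonoidDefs +-rawMonoid using () renaming (_×_ to _·_)

-- The field of values of class functions.  The standard library has no complex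
-- numbers; of ℂ only these properties are used.
record CharacteristicZeroField c ℓ₁ ℓ₂ : Set (lsuc (c ⊔ ℓ₁ ⊔ ℓ₂)) where
  field
    heytingField       : HeytingField c ℓ₁ ℓ₂
    characteristicZero : CharacteristicZero heytingField

  open HeytingField heytingField using (#⇒invertible)
  open HeytingCommutativeRing (HeytingField.heytingCommutativeRing heytingField) public
    using (commutativeRing)
  open CommutativeRing commutativeRing public using (ring)
  open CommutativeRing commutativeRing
  open RawMonoidDefs +-rawMonoid using () renaming (_×_ to _·_)
  open import Algebra.Properties.Group +-group using (ε⁻¹≈ε)

  recip : ∀ n → .{{NonZero n}} → Carrier
  recip n = proj₁ (#⇒invertible (characteristicZero n))

  recip-inverse : ∀ n → .{{_ : NonZero n}} → recip n * (n · 1#) ≈ 1#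
  recip-inverse n = trans
    (*-congˡ (sym (trans (+-congˡ ε⁻¹≈ε) (+-identityʳ _))))
    (proj₁ (proj₂ (#⇒invertible (characteristicZero n))))

module _ (G : Group a ℓ) where
  open Group G
  open SetoidReasoning setoid

  conj-∙ : ∀ h k g → h ∙ (k ∙ g ∙ k ⁻¹) ∙ h ⁻¹ ≈ (h ∙ k) ∙ g ∙ (h ∙ k) ⁻¹
  conj-∙ h k g = begin
    h ∙ (k ∙ g ∙ k ⁻¹) ∙ h ⁻¹    ≈⟨ ∙-congʳ (assoc h (k ∙ g) (k ⁻¹)) ⟨
    h ∙ (k ∙ g) ∙ k ⁻¹ ∙ h ⁻¹    ≈⟨ ∙-congʳ (∙-congʳ (assoc h k g)) ⟨
    h ∙ k ∙ g ∙ k ⁻¹ ∙ h ⁻¹      ≈⟨ assoc (h ∙ k ∙ g) (k ⁻¹) (h ⁻¹) ⟩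
    h ∙ k ∙ g ∙ (k ⁻¹ ∙ h ⁻¹)    ≈⟨ ∙-congˡ (⁻¹-anti-homo-∙ h k) ⟨
    (h ∙ k) ∙ g ∙ (h ∙ k) ⁻¹     ∎
    where open import Algebra.Properties.Group G using (⁻¹-anti-homo-∙)

  conj-ε : ∀ h → h ∙ ε ∙ h ⁻¹ ≈ ε
  conj-ε h = trans (∙-congʳ (identityʳ h)) (inverseʳ h)

  conj-homo-∙ : ∀ h x y → h ∙ (x ∙ y) ∙ h ⁻¹ ≈ (h ∙ x ∙ h ⁻¹) ∙ (h ∙ y ∙ h ⁻¹)
  conj-homo-∙ h x y = sym (begin
    (h ∙ x ∙ h ⁻¹) ∙ (h ∙ y ∙ h ⁻¹)    ≈⟨ ∙-congˡ (assoc h y (h ⁻¹)) ⟩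
    (h ∙ x ∙ h ⁻¹) ∙ (h ∙ (y ∙ h ⁻¹))  ≈⟨ assoc (h ∙ x ∙ h ⁻¹) h (y ∙ h ⁻¹) ⟨
    (h ∙ x ∙ h ⁻¹) ∙ h ∙ (y ∙ h ⁻¹)    ≈⟨ ∙-congʳ (//-rightDividesˡ h (h ∙ x)) ⟩
    h ∙ x ∙ (y ∙ h ⁻¹)                 ≈⟨ assoc (h ∙ x) y (h ⁻¹) ⟨
    h ∙ x ∙ y ∙ h ⁻¹                   ≈⟨ ∙-congʳ (assoc h x y) ⟩
    h ∙ (x ∙ y) ∙ h ⁻¹                 ∎)
    where open import Algebra.Properties.Group G using (//-rightDividesˡ)

  conj-cancel : ∀ h g → h ⁻¹ ∙ (h ∙ g ∙ h ⁻¹) ∙ h ⁻¹ ⁻¹ ≈ g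
  conj-cancel h g = begin
    h ⁻¹ ∙ (h ∙ g ∙ h ⁻¹) ∙ h ⁻¹ ⁻¹    ≈⟨ conj-∙ (h ⁻¹) h g ⟩
    (h ⁻¹ ∙ h) ∙ g ∙ (h ⁻¹ ∙ h) ⁻¹     ≈⟨ ∙-cong (∙-congʳ (inverseˡ h)) (⁻¹-cong (inverseˡ h)) ⟩
    ε ∙ g ∙ ε ⁻¹                       ≈⟨ ∙-cong (identityˡ g) ε⁻¹≈ε ⟩
    g ∙ ε                              ≈⟨ identityʳ g ⟩
    g                                  ∎
    where open import Algebra.Properties.Group G using (ε⁻¹≈ε)

  conj-cong : ∀ {h h′ g g′} → h ≈ h′ → g ≈ g′ → h ∙ g ∙ h ⁻¹ ≈ h′ ∙ g′ ∙ h′ ⁻¹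
  conj-cong e e′ = ∙-cong (∙-cong e e′) (⁻¹-cong e)

  translation : Carrier → Inverse setoid setoid
  translation k = record
    { to = _∙ k ; from = _∙ k ⁻¹
    ; to-cong = ∙-congʳ ; from-cong = ∙-congʳ
    ; inverse = (λ e → trans (∙-congʳ e) (//-rightDividesˡ k _))
              , (λ e → trans (∙-congʳ e) (//-rightDividesʳ k _))
    }
    where open import Algebra.Properties.Group G using (//-rightDividesˡ; //-rightDividesʳ)

-- P = L ⋉ U: the projection π : P → L is split by the inclusion of L, and its
-- kernel is U.
record SemidirectProduct {a₁ a₂ a₃ ℓ₁ ℓ₂ ℓ₃}
  (L : Group a₁ ℓ₁) (U : Group a₂ ℓ₂) (P : Group a₃ ℓ₃) : Set (a₁ ⊔ a₂ ⊔ a₃ ⊔ ℓ₁ ⊔ ℓ₂ ⊔ ℓ₃) where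
  private
    module L = Group L
    module U = Group U
    module P = Group P
  field
    projection : Hom P L
    inclusionᴸ : Hom L P
    inclusionᵁ : Hom U P

  private
    module π = Hom projection
    module s = Hom inclusionᴸ
    module r = Hom inclusionᵁ

  field
    splits    : ∀ g → π.⟦ s.⟦ g ⟧ ⟧ L.≈ g
    injective : ∀ {x y} → r.⟦ x ⟧ P.≈ r.⟦ y ⟧ → x U.≈ y
    π-U       : ∀ x → π.⟦ r.⟦ x ⟧ ⟧ L.≈ L.ε
    kernel    : ∀ g → π.⟦ g ⟧ L.≈ L.ε → ∃ λ x → r.⟦ x ⟧ P.≈ g

  conj : P.Carrier → U.Carrier → U.Carrier
  conj h x = proj₁ (kernel (h P.∙ r.⟦ x ⟧ P.∙ h P.⁻¹) (L.trans (π.conj-homo h r.⟦ x ⟧)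
    (L.trans (L.∙-congʳ (L.∙-congˡ (π-U x))) (conj-ε L π.⟦ h ⟧))))

  r-conj : ∀ h x → r.⟦ conj h x ⟧ P.≈ h P.∙ r.⟦ x ⟧ P.∙ h P.⁻¹
  r-conj h x = proj₂ (kernel (h P.∙ r.⟦ x ⟧ P.∙ h P.⁻¹) _)

  conjugation : P.Carrier → Inverse U.setoid U.setoid
  conjugation h = record
    { to = conj h ; from = conj (h P.⁻¹)
    ; to-cong = conj-cong′ ; from-cong = conj-cong′
    ; inverse = (λ {x} {y} e → injective (P.trans (r-conj h y)
                   (P.trans (conj-cong P P.refl (P.trans (r.⟦⟧-cong e) (r-conj (h P.⁻¹) x)))
                     (conj-cancel⁻¹ h r.⟦ x ⟧))))
              , (λ {x} {y} e → injective (P.trans (r-conj (h P.⁻¹) y)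
                   (P.trans (conj-cong P P.refl (P.trans (r.⟦⟧-cong e) (r-conj h x)))
                     (conj-cancel P h r.⟦ x ⟧))))
    }
    where
      conj-cong′ : ∀ {h x y} → x U.≈ y → conj h x U.≈ conj h y
      conj-cong′ {h} {x} {y} e = injective (P.trans (r-conj h x)
        (P.trans (conj-cong P P.refl (r.⟦⟧-cong e)) (P.sym (r-conj h y))))
      conj-cancel⁻¹ : ∀ h x → h P.∙ (h P.⁻¹ P.∙ x P.∙ h P.⁻¹ P.⁻¹) P.∙ h P.⁻¹ P.≈ x
      conj-cancel⁻¹ h x = P.trans
        (conj-cong P (P.sym (⁻¹-involutive h)) P.refl)
        (conj-cancel P (h P.⁻¹) x)
        where open import Algebra.Properties.Group P using (⁻¹-involutive)

private
  variable
    n : ℕ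

-- cano I is the order-preserving bijection I → [∣ I ∣].
cano : (I : Subset n) (i : Fin n) → i ∈ I → Fin ∣ I ∣
cano (inside  ∷ I) zero    here      = zero
cano (inside  ∷ I) (suc i) (there p) = suc (cano I i p)
cano (outside ∷ I) (suc i) (there p) = cano I i p

cano⁻¹ : (I : Subset n) → Fin ∣ I ∣ → Fin n
cano⁻¹ (inside  ∷ I) zero    = zero
cano⁻¹ (inside  ∷ I) (suc k) = suc (cano⁻¹ I k)
cano⁻¹ (outside ∷ I) k       = suc (cano⁻¹ I k)

cano⁻¹∈ : (I : Subset n) (k : Fin ∣ I ∣) → cano⁻¹ I k ∈ I
cano⁻¹∈ (inside  ∷ I) zero    = here
cano⁻¹∈ (inside  ∷ I) (suc k) = there (cano⁻¹∈ I k)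
cano⁻¹∈ (outside ∷ I) k       = there (cano⁻¹∈ I k)

cano⁻¹-cano : (I : Subset n) (i : Fin n) (p : i ∈ I) → cano⁻¹ I (cano I i p) ≡ i
cano⁻¹-cano (inside  ∷ I) zero    here      = ≡.refl
cano⁻¹-cano (inside  ∷ I) (suc i) (there p) = ≡.cong suc (cano⁻¹-cano I i p)
cano⁻¹-cano (outside ∷ I) (suc i) (there p) = ≡.cong suc (cano⁻¹-cano I i p)

cano⁻¹-injective : (I : Subset n) {k l : Fin ∣ I ∣} → cano⁻¹ I k ≡ cano⁻¹ I l → k ≡ l
cano⁻¹-injective (inside  ∷ I) {zero}  {zero}  e = ≡.refl
cano⁻¹-injective (inside  ∷ I) {suc k} {suc l} e = ≡.cong suc (cano⁻¹-injective I (Finₚ.suc-injective e))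
cano⁻¹-injective (outside ∷ I) e = cano⁻¹-injective I (Finₚ.suc-injective e)

cano-cano⁻¹ : (I : Subset n) (k : Fin ∣ I ∣) (p : cano⁻¹ I k ∈ I) → cano I (cano⁻¹ I k) p ≡ k
cano-cano⁻¹ I k p = cano⁻¹-injective I (cano⁻¹-cano I _ p)

cano⁻¹-cancel-< : (I : Subset n) {k l : Fin ∣ I ∣} → cano⁻¹ I k Fin.< cano⁻¹ I l → k Fin.< l
cano⁻¹-cancel-< (inside  ∷ I) {zero}  {suc l} e = ℕ.s≤s ℕ.z≤n
cano⁻¹-cancel-< (inside  ∷ I) {suc k} {suc l} e = ℕ.s≤s (cano⁻¹-cancel-< I (ℕ.s≤s⁻¹ e))
cano⁻¹-cancel-< (outside ∷ I) e = cano⁻¹-cancel-< I (ℕ.s≤s⁻¹ e)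

cano⁻¹-mono-< : (I : Subset n) {k l : Fin ∣ I ∣} → k Fin.< l → cano⁻¹ I k Fin.< cano⁻¹ I l
cano⁻¹-mono-< (inside  ∷ I) {zero}  {suc l} e = ℕ.s≤s ℕ.z≤n
cano⁻¹-mono-< (inside  ∷ I) {suc k} {suc l} e = ℕ.s≤s (cano⁻¹-mono-< I (ℕ.s≤s⁻¹ e))
cano⁻¹-mono-< (outside ∷ I) e = ℕ.s≤s (cano⁻¹-mono-< I e)

-- (i , j) ∈ I × I ∪ Iᶜ × Iᶜ
SameSide : Subset n → Fin n → Fin n → Set
SameSide I i j = (i ∈ I × j ∈ I) ⊎ (i ∉ I × j ∉ I)

sameSide? : (I : Subset n) (i j : Fin n) → Dec (SameSide I i j)
sameSide? I i j = ((i ∈? I) ×-dec (j ∈? I)) ⊎-dec (¬? (i ∈? I) ×-dec ¬? (j ∈? I))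

SameSide-∁ : (I : Subset n) {i j : Fin n} → SameSide I i j → SameSide (∁ I) i j
SameSide-∁ I (inj₁ (p , q)) = inj₂ (x∈p⇒x∉∁p p , x∈p⇒x∉∁p q)
SameSide-∁ I (inj₂ (p , q)) = inj₁ (x∉p⇒x∈∁p p , x∉p⇒x∈∁p q)

SameSide-trans : (I : Subset n) {i j k : Fin n} → SameSide I i j → SameSide I j k → SameSide I i k
SameSide-trans I (inj₁ (p , _)) (inj₁ (_ , q)) = inj₁ (p , q)
SameSide-trans I (inj₁ (_ , p)) (inj₂ (q , _)) = contradiction p q
SameSide-trans I (inj₂ (_ , p)) (inj₁ (q , _)) = contradiction q p
SameSide-trans I (inj₂ (p , _)) (inj₂ (_ , q)) = inj₂ (p , q)

SameSide-sym : (I : Subset n) {i j : Fin n} → SameSide I i j → SameSide I j i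
SameSide-sym I (inj₁ (p , q)) = inj₁ (q , p)
SameSide-sym I (inj₂ (p , q)) = inj₂ (q , p)

SameSide-refl : (I : Subset n) (i : Fin n) → SameSide I i i
SameSide-refl I i with i ∈? I
... | yes p = inj₁ (p , p)
... | no ¬p = inj₂ (¬p , ¬p)

opposite-cancel-< : {i j : Fin n} → opposite i Fin.< opposite j → j Fin.< i
opposite-cancel-< {n} {i} {j} lt with toℕ i ℕₚ.≤? toℕ j
... | no  i≰j = ℕₚ.≰⇒> i≰j
... | yes i≤j = contradiction lt (ℕₚ.≤⇒≯ (≡.subst₂ ℕ._≤_
  (≡.sym (Finₚ.opposite-prop j)) (≡.sym (Finₚ.opposite-prop i))
  (ℕₚ.∸-monoʳ-≤ n (ℕ.s≤s i≤j))))

-- A transitive set of positions strictly above the diagonal.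
record Pattern (n : ℕ) : Set₁ where
  field
    _◁_     : Fin n → Fin n → Set
    _◁?_    : ∀ i j → Dec (i ◁ j)
    ◁⇒<     : ∀ {i j} → i ◁ j → i Fin.< j
    ◁-trans : ∀ {i j k} → i ◁ j → j ◁ k → i ◁ k

  ◁⇒≢ : ∀ {i j} → i ◁ j → i ≢ j
  ◁⇒≢ lt = Finₚ.<⇒≢ (◁⇒< lt)

upper : ∀ n → Pattern n
upper n = record
  { _◁_ = Fin._<_ ; _◁?_ = Finₚ._<?_ ; ◁⇒< = id ; ◁-trans = Finₚ.<-trans }

-- UL I : (i , j) ∈ I × I ∪ Iᶜ × Iᶜ
-- UR I : (i , j) ∈ I × Iᶜ
-- UP I : (i , j) ∉ Iᶜ × I
ul ur up : Subset n → Pattern n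
ul I = record
  { _◁_     = λ i j → i Fin.< j × SameSide I i j
  ; _◁?_    = λ i j → (i Finₚ.<? j) ×-dec sameSide? I i j
  ; ◁⇒<     = proj₁
  ; ◁-trans = λ (p , s) (q , t) → Finₚ.<-trans p q , SameSide-trans I s t
  }
ur I = record
  { _◁_     = λ i j → i Fin.< j × (i ∈ I × j ∉ I)
  ; _◁?_    = λ i j → (i Finₚ.<? j) ×-dec ((i ∈? I) ×-dec ¬? (j ∈? I))
  ; ◁⇒<     = proj₁
  ; ◁-trans = λ (p , (i∈ , _)) (q , (_ , k∉)) → Finₚ.<-trans p q , (i∈ , k∉)
  }
up I = record
  { _◁_     = λ i j → i Fin.< j × ¬ (i ∉ I × j ∈ I)
  ; _◁?_    = λ i j → (i Finₚ.<? j) ×-dec ¬? (¬? (i ∈? I) ×-dec (j ∈? I))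
  ; ◁⇒<     = proj₁
  ; ◁-trans = λ {i} {j} {k} (p , s) (q , t) → Finₚ.<-trans p q , λ (i∉ , k∈) →
      t ((λ j∈ → s (i∉ , j∈)) , k∈)
  }

subsets : ∀ n → List (Subset n)
subsets zero    = [] ∷ []
subsets (suc n) = List.map (outside ∷_) (subsets n) ++ List.map (inside ∷_) (subsets n)

-- [ i ] = {1, …, i} ⊆ [n]
initial : ∀ n → Fin (suc n) → Subset n
initial n i = Vec.tabulate λ j → toℕ j ℕ.<ᵇ toℕ i

∈-initial⁺ : ∀ i {j : Fin n} → toℕ j ℕ.< toℕ i → j ∈ initial n i
∈-initial⁺ i {j} j<i = Vecₚ.lookup⇒[]= j _ (≡.trans
  (Vecₚ.lookup∘tabulate _ j) (Equivalence.to T-≡ (ℕₚ.<⇒<ᵇ j<i)))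

∈-initial⁻ : ∀ i {j : Fin n} → j ∈ initial n i → toℕ j ℕ.< toℕ i
∈-initial⁻ i {j} j∈ = ℕₚ.<ᵇ⇒< _ _ (Equivalence.from T-≡ (≡.trans
  (≡.sym (Vecₚ.lookup∘tabulate _ j)) (Vecₚ.[]=⇒lookup j∈)))

∣p∣+∣∁p∣≡n : (I : Subset n) → ∣ I ∣ ℕ.+ ∣ ∁ I ∣ ≡ n
∣p∣+∣∁p∣≡n I = ≡.trans (≡.cong (∣ I ∣ ℕ.+_) (∣∁p∣≡n∸∣p∣ I)) (ℕₚ.m+[n∸m]≡n (∣p∣≤n I))

module Unitriangular {q ℓq ℓq′ k ℓk ℓk′}
  (𝔽 : FiniteField q ℓq ℓq′) (𝕂 : CharacteristicZeroField k ℓk ℓk′) where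

  private
    K = CharacteristicZeroField.commutativeRing 𝕂
    module K = CommutativeRing K

  module LinearAlgebra where
    private
      variable
        u v ℓu ℓv ℓp : Level

    VS : ∀ u ℓu → Set (k ⊔ ℓk ⊔ lsuc (u ⊔ ℓu))
    VS u ℓu = LeftModule K.ring u ℓu

    record LinearMap (M : VS u ℓu) (N : VS v ℓv) : Set (k ⊔ u ⊔ ℓu ⊔ v ⊔ ℓv) where
      private
        module M = LeftModule M
        module N = LeftModule N
      open LeftModuleMorphisms M.rawLeftModule N.rawLeftModule using (IsLeftModuleHomomorphism)
      field
        ⟦_⟧                      : M.Carrierᴹ → N.Carrierᴹ
        isLeftModuleHomomorphism : IsLeftModuleHomomorphism ⟦_⟧
      open IsLeftModuleHomomorphism isLeftModuleHomomorphism public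
        using (⟦⟧-cong; +ᴹ-homo; *ₗ-homo; 0ᴹ-homo)

    open LinearMap public using (⟦_⟧)

    module _ {M : VS u ℓu} {N : VS v ℓv} where
      private
        module M = LeftModule M
        module N = LeftModule N

      linearMap : (f : M.Carrierᴹ → N.Carrierᴹ) →
                  (∀ {x y} → x M.≈ᴹ y → f x N.≈ᴹ f y) →
                  (∀ x y → f (x M.+ᴹ y) N.≈ᴹ f x N.+ᴹ f y) →
                  (∀ r x → f (r M.*ₗ x) N.≈ᴹ r N.*ₗ f x) →
                  LinearMap M N
      linearMap f f-cong f-+ f-* = record { ⟦_⟧ = f ; isLeftModuleHomomorphism = isHomomorphism }
        where
          open LeftModuleMorphisms M.rawLeftModule N.rawLeftModule using (IsLeftModuleHomomorphism)
          open import Algebra.Properties.Group N.+ᴹ-group using (inverseˡ-unique)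
          abstract
            f-0 : f M.0ᴹ N.≈ᴹ N.0ᴹ
            f-0 = N.≈ᴹ-trans (f-cong (M.≈ᴹ-sym (M.*ₗ-zeroˡ M.0ᴹ)))
                    (N.≈ᴹ-trans (f-* K.0# M.0ᴹ) (N.*ₗ-zeroˡ _))

            isHomomorphism : IsLeftModuleHomomorphism f
            isHomomorphism = record
              { +ᴹ-isGroupHomomorphism = record
                { isMonoidHomomorphism = record
                  { isMagmaHomomorphism = record
                    { isRelHomomorphism = record { cong = f-cong } ; homo = f-+ }
                  ; ε-homo = f-0 }
                ; ⁻¹-homo = λ x → inverseˡ-unique _ _ (N.≈ᴹ-trans (N.≈ᴹ-sym (f-+ _ _))
                                    (N.≈ᴹ-trans (f-cong (M.-ᴹ‿inverseˡ x)) f-0)) }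
              ; *ₗ-homo = f-*
              }

      0ₗ : LinearMap M N
      0ₗ = linearMap (λ _ → N.0ᴹ) (λ _ → N.≈ᴹ-refl) (λ _ _ → N.≈ᴹ-sym (N.+ᴹ-identityˡ _))
             (λ r _ → N.≈ᴹ-sym (N.*ₗ-zeroʳ r))

      infixl 6 _+ₗ_
      _+ₗ_ : LinearMap M N → LinearMap M N → LinearMap M N
      f +ₗ g = linearMap (λ x → ⟦ f ⟧ x N.+ᴹ ⟦ g ⟧ x)
        (λ e → N.+ᴹ-cong (f.⟦⟧-cong e) (g.⟦⟧-cong e))
        (λ x y → N.≈ᴹ-trans (N.+ᴹ-cong (f.+ᴹ-homo x y) (g.+ᴹ-homo x y)) (interchange _ _ _ _))
        (λ r x → N.≈ᴹ-trans (N.+ᴹ-cong (f.*ₗ-homo r x) (g.*ₗ-homo r x)) (N.≈ᴹ-sym (N.*ₗ-distribˡ r _ _)))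
        where
          module f = LinearMap f
          module g = LinearMap g
          open CommSemigroup (CommutativeMonoid.commutativeSemigroup N.+ᴹ-commutativeMonoid) using (interchange)

      sumₗ : List (LinearMap M N) → LinearMap M N
      sumₗ = List.foldr _+ₗ_ 0ₗ

    infixr 9 _∘ₗ_
    _∘ₗ_ : {M : VS u ℓu} {N : VS v ℓv} {P : VS p ℓp} → LinearMap N P → LinearMap M N → LinearMap M P
    _∘ₗ_ {P = P} f g = linearMap (⟦ f ⟧ ∘ ⟦ g ⟧) (f.⟦⟧-cong ∘ g.⟦⟧-cong)
      (λ x y → P.≈ᴹ-trans (f.⟦⟧-cong (g.+ᴹ-homo x y)) (f.+ᴹ-homo _ _))
      (λ r x → P.≈ᴹ-trans (f.⟦⟧-cong (g.*ₗ-homo r x)) (f.*ₗ-homo r _))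
      where
        module P = LeftModule P
        module f = LinearMap f
        module g = LinearMap g

    infix 4 _≗ₗ_
    _≗ₗ_ : {M : VS u ℓu} {N : VS v ℓv} → LinearMap M N → LinearMap M N → Set (u ⊔ ℓv)
    _≗ₗ_ {M = M} {N} f g = ∀ x → ⟦ f ⟧ x N.≈ᴹ ⟦ g ⟧ x
      where
        module N = LeftModule N

    IsIsomorphism : {M : VS u ℓu} {N : VS v ℓv} → LinearMap M N → Set (k ⊔ u ⊔ ℓu ⊔ v ⊔ ℓv)
    IsIsomorphism {M = M} {N} f = IsLeftModuleIsomorphism ⟦ f ⟧
      where
        open LeftModuleMorphisms (LeftModule.rawLeftModule M) (LeftModule.rawLeftModule N)
          using (IsLeftModuleIsomorphism)

    record Bilinear (M : VS u ℓu) (N : VS v ℓv) (P : VS p ℓp) : Set (k ⊔ u ⊔ ℓu ⊔ v ⊔ ℓv ⊔ p ⊔ ℓp) where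
      private
        module M = LeftModule M
        module N = LeftModule N
        module P = LeftModule P
      field
        ⟪_,_⟫   : M.Carrierᴹ → N.Carrierᴹ → P.Carrierᴹ
        ⟪⟫-cong : ∀ {x x′ y y′} → x M.≈ᴹ x′ → y N.≈ᴹ y′ → ⟪ x , y ⟫ P.≈ᴹ ⟪ x′ , y′ ⟫
        +-homoˡ : ∀ x x′ y → ⟪ x M.+ᴹ x′ , y ⟫ P.≈ᴹ ⟪ x , y ⟫ P.+ᴹ ⟪ x′ , y ⟫
        +-homoʳ : ∀ x y y′ → ⟪ x , y N.+ᴹ y′ ⟫ P.≈ᴹ ⟪ x , y ⟫ P.+ᴹ ⟪ x , y′ ⟫
        *-homoˡ : ∀ r x y → ⟪ r M.*ₗ x , y ⟫ P.≈ᴹ r P.*ₗ ⟪ x , y ⟫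
        *-homoʳ : ∀ r x y → ⟪ x , r N.*ₗ y ⟫ P.≈ᴹ r P.*ₗ ⟪ x , y ⟫

      0-homoˡ : ∀ y → ⟪ M.0ᴹ , y ⟫ P.≈ᴹ P.0ᴹ
      0-homoˡ y = P.≈ᴹ-trans (⟪⟫-cong (M.≈ᴹ-sym (M.*ₗ-zeroˡ M.0ᴹ)) N.≈ᴹ-refl)
        (P.≈ᴹ-trans (*-homoˡ K.0# M.0ᴹ y) (P.*ₗ-zeroˡ _))

      0-homoʳ : ∀ x → ⟪ x , N.0ᴹ ⟫ P.≈ᴹ P.0ᴹ
      0-homoʳ x = P.≈ᴹ-trans (⟪⟫-cong M.≈ᴹ-refl (N.≈ᴹ-sym (N.*ₗ-zeroˡ N.0ᴹ)))
        (P.≈ᴹ-trans (*-homoʳ K.0# x N.0ᴹ) (P.*ₗ-zeroˡ _))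

    open Bilinear public using (⟪_,_⟫)

    -- Formal sums of pure tensors x ⊗ y, represented by lists of pairs (x , y).
    module _ (M : VS u ℓu) (N : VS v ℓv) where
      private
        module M = LeftModule M
        module N = LeftModule N

      FormalSum : Set (u ⊔ v)
      FormalSum = List (M.Carrierᴹ × N.Carrierᴹ)

      infix 4 _≈⊗_
      data _≈⊗_ : FormalSum → FormalSum → Set (k ⊔ u ⊔ ℓu ⊔ v ⊔ ℓv) where
        ≈-refl  : ∀ {t} → t ≈⊗ t
        ≈-sym   : ∀ {t u} → t ≈⊗ u → u ≈⊗ t
        ≈-trans : ∀ {t u v} → t ≈⊗ u → u ≈⊗ v → t ≈⊗ v
        ++-cong : ∀ {t t′ u u′} → t ≈⊗ t′ → u ≈⊗ u′ → t ++ u ≈⊗ t′ ++ u′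
        ++-comm : ∀ t u → t ++ u ≈⊗ u ++ t
        ⊗-cong  : ∀ {x x′ y y′} → x M.≈ᴹ x′ → y N.≈ᴹ y′ → (x , y) ∷ [] ≈⊗ (x′ , y′) ∷ []
        ⊗-+ˡ    : ∀ x x′ y → (x M.+ᴹ x′ , y) ∷ [] ≈⊗ (x , y) ∷ (x′ , y) ∷ []
        ⊗-+ʳ    : ∀ x y y′ → (x , y N.+ᴹ y′) ∷ [] ≈⊗ (x , y) ∷ (x , y′) ∷ []
        ⊗-*     : ∀ r x y → (r M.*ₗ x , y) ∷ [] ≈⊗ (x , r N.*ₗ y) ∷ []
        ⊗-0ˡ    : ∀ y → (M.0ᴹ , y) ∷ [] ≈⊗ []

      formalSums : CommutativeMonoid (u ⊔ v) (k ⊔ u ⊔ ℓu ⊔ v ⊔ ℓv)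
      formalSums = record
        { Carrier = FormalSum
        ; _≈_ = _≈⊗_
        ; _∙_ = _++_
        ; ε   = []
        ; isCommutativeMonoid = record
          { isMonoid = record
            { isSemigroup = record
              { isMagma = record
                { isEquivalence = record { refl = ≈-refl ; sym = ≈-sym ; trans = ≈-trans }
                ; ∙-cong = ++-cong }
              ; assoc = λ t u v → ≡⇒≈ (Listₚ.++-assoc t u v) }
            ; identity = (λ t → ≈-refl) , (λ t → ≡⇒≈ (Listₚ.++-identityʳ t)) }
          ; comm = ++-comm }
        }
        where
          ≡⇒≈ : ∀ {t u} → t ≡ u → t ≈⊗ u
          ≡⇒≈ ≡.refl = ≈-refl

    module _ {M : VS u ℓu} {N : VS v ℓv} {ℓ₁ ℓ₂} (P : CommutativeMonoid ℓ₁ ℓ₂) where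
      private
        module M = LeftModule M
        module N = LeftModule N
        module P = CommutativeMonoid P
        open P using (_∙_; _≈_; ε)

      fold : (M.Carrierᴹ → N.Carrierᴹ → P.Carrier) → FormalSum M N → P.Carrier
      fold f []            = ε
      fold f ((x , y) ∷ t) = f x y ∙ fold f t

      fold-++ : ∀ f t u → fold f (t ++ u) ≈ fold f t ∙ fold f u
      fold-++ f []            u = P.sym (P.identityˡ _)
      fold-++ f ((x , y) ∷ t) u = P.trans (P.∙-congˡ (fold-++ f t u)) (P.sym (P.assoc _ _ _))

      fold-ext : ∀ {f g} → (∀ x y → f x y ≈ g x y) → ∀ t → fold f t ≈ fold g t
      fold-ext e []            = P.refl
      fold-ext e ((x , y) ∷ t) = P.∙-cong (e x y) (fold-ext e t)

      fold-∙ : ∀ f g t → fold (λ x y → f x y ∙ g x y) t ≈ fold f t ∙ fold g t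
      fold-∙ f g []            = P.sym (P.identityˡ _)
      fold-∙ f g ((x , y) ∷ t) = P.trans (P.∙-congˡ (fold-∙ f g t)) (interchange _ _ _ _)
        where open CommSemigroup P.commutativeSemigroup using (interchange)

      fold-ε : ∀ t → fold (λ _ _ → ε) t ≈ ε
      fold-ε []      = P.refl
      fold-ε (_ ∷ t) = P.trans (P.identityˡ _) (fold-ε t)

      record Balanced (f : M.Carrierᴹ → N.Carrierᴹ → P.Carrier) : Set (k ⊔ u ⊔ ℓu ⊔ v ⊔ ℓv ⊔ ℓ₂) where
        field
          b-cong : ∀ {x x′ y y′} → x M.≈ᴹ x′ → y N.≈ᴹ y′ → f x y ≈ f x′ y′
          b-+ˡ   : ∀ x x′ y → f (x M.+ᴹ x′) y ≈ f x y ∙ f x′ y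
          b-+ʳ   : ∀ x y y′ → f x (y N.+ᴹ y′) ≈ f x y ∙ f x y′
          b-*    : ∀ r x y → f (r M.*ₗ x) y ≈ f x (r N.*ₗ y)
          b-0ˡ   : ∀ y → f M.0ᴹ y ≈ ε

        fold-cong : ∀ {t u} → _≈⊗_ M N t u → fold f t ≈ fold f u
        fold-cong ≈-refl = P.refl
        fold-cong (≈-sym e) = P.sym (fold-cong e)
        fold-cong (≈-trans e e′) = P.trans (fold-cong e) (fold-cong e′)
        fold-cong (++-cong {t} {t′} {u} {u′} e e′) = P.trans (fold-++ f t u)
          (P.trans (P.∙-cong (fold-cong e) (fold-cong e′)) (P.sym (fold-++ f t′ u′)))
        fold-cong (++-comm t u) = P.trans (fold-++ f t u) (P.trans (P.comm _ _) (P.sym (fold-++ f u t)))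
        fold-cong (⊗-cong e e′) = P.∙-congʳ (b-cong e e′)
        fold-cong (⊗-+ˡ x x′ y) = P.trans (P.∙-congʳ (b-+ˡ x x′ y)) (P.assoc _ _ _)
        fold-cong (⊗-+ʳ x y y′) = P.trans (P.∙-congʳ (b-+ʳ x y y′)) (P.assoc _ _ _)
        fold-cong (⊗-* r x y) = P.∙-congʳ (b-* r x y)
        fold-cong (⊗-0ˡ y) = P.trans (P.identityʳ _) (b-0ˡ y)

    infixr 7 _⊗_
    _⊗_ : VS u ℓu → VS v ℓv → VS (u ⊔ v) (k ⊔ u ⊔ ℓu ⊔ v ⊔ ℓv)
    M ⊗ N = record
      { Carrierᴹ = FormalSum M N
      ; _≈ᴹ_ = _≈⊗_ M N
      ; _+ᴹ_ = _++_
      ; _*ₗ_ = scale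
      ; 0ᴹ   = []
      ; -ᴹ_  = neg
      ; isLeftModule = isLeftModule
      }
      where
        module M = LeftModule M
        module N = LeftModule N
        T = formalSums M N
        module T = CommutativeMonoid T

        scale : K.Carrier → FormalSum M N → FormalSum M N
        scale r = fold {M = M} {N = N} T λ x y → (r M.*ₗ x , y) ∷ []

        neg : FormalSum M N → FormalSum M N
        neg = fold {M = M} {N = N} T λ x y → (M.-ᴹ x , y) ∷ []

        abstract
          *-comm-* : ∀ r s x → r M.*ₗ (s M.*ₗ x) M.≈ᴹ s M.*ₗ (r M.*ₗ x)
          *-comm-* r s x = M.≈ᴹ-trans (M.≈ᴹ-sym (M.*ₗ-assoc r s x))
            (M.≈ᴹ-trans (M.*ₗ-cong (K.*-comm r s) M.≈ᴹ-refl) (M.*ₗ-assoc s r x))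

          scale-balanced : ∀ r → Balanced {M = M} {N = N} T λ x y → (r M.*ₗ x , y) ∷ []
          scale-balanced r = record
            { b-cong = λ e e′ → ⊗-cong (M.*ₗ-cong K.refl e) e′
            ; b-+ˡ = λ x x′ y → T.trans (⊗-cong (M.*ₗ-distribˡ r x x′) N.≈ᴹ-refl) (⊗-+ˡ _ _ y)
            ; b-+ʳ = λ x y y′ → ⊗-+ʳ _ y y′
            ; b-*  = λ s x y → T.trans (⊗-cong (*-comm-* r s x) N.≈ᴹ-refl) (⊗-* s _ y)
            ; b-0ˡ = λ y → T.trans (⊗-cong (M.*ₗ-zeroʳ r) N.≈ᴹ-refl) (⊗-0ˡ y)
            }

          neg-scale : ∀ x → M.-ᴹ x M.≈ᴹ (K.- K.1#) M.*ₗ x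
          neg-scale x = M.≈ᴹ-sym (inverseˡ-unique _ _ (M.≈ᴹ-trans
            (M.+ᴹ-congˡ (M.≈ᴹ-sym (M.*ₗ-identityˡ x)))
            (M.≈ᴹ-trans (M.≈ᴹ-sym (M.*ₗ-distribʳ x (K.- K.1#) K.1#))
              (M.≈ᴹ-trans (M.*ₗ-cong (K.-‿inverseˡ K.1#) M.≈ᴹ-refl) (M.*ₗ-zeroˡ x)))))
            where open import Algebra.Properties.Group M.+ᴹ-group using (inverseˡ-unique)

          neg-balanced : Balanced {M = M} {N = N} T λ x y → (M.-ᴹ x , y) ∷ []
          neg-balanced = record
            { b-cong = λ e e′ → ⊗-cong (M.-ᴹ‿cong e) e′
            ; b-+ˡ = λ x x′ y → T.trans (via _ _) (T.trans (s.b-+ˡ x x′ y) (T.sym (++-cong (via _ _) (via _ _))))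
            ; b-+ʳ = λ x y y′ → ⊗-+ʳ _ y y′
            ; b-*  = λ s x y → T.trans (via _ _) (T.trans (s.b-* s x y) (T.sym (via _ _)))
            ; b-0ˡ = λ y → T.trans (via _ _) (s.b-0ˡ y)
            }
            where
              module s = Balanced (scale-balanced (K.- K.1#))
              via : ∀ x y → (M.-ᴹ x , y) ∷ [] T.≈ ((K.- K.1#) M.*ₗ x , y) ∷ []
              via x y = ⊗-cong (neg-scale x) N.≈ᴹ-refl

          fold-pure : ∀ t → fold {M = M} {N} T (λ x y → (x , y) ∷ []) t T.≈ t
          fold-pure []            = T.refl
          fold-pure ((x , y) ∷ t) = ++-cong {t = (x , y) ∷ []} T.refl (fold-pure t)

          *-assoc : ∀ r s t → scale (r K.* s) t T.≈ scale r (scale s t)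
          *-assoc r s []            = T.refl
          *-assoc r s ((x , y) ∷ t) = ++-cong (⊗-cong (M.*ₗ-assoc r s x) N.≈ᴹ-refl) (*-assoc r s t)

          neg-inverse : ∀ t → neg t ++ t T.≈ []
          neg-inverse t = T.trans (++-cong (T.refl {neg t}) (T.sym (fold-pure t)))
            (T.trans (T.sym (fold-∙ T _ _ t))
              (T.trans (fold-ext T (λ x y → T.trans (T.sym (⊗-+ˡ _ _ y))
                          (T.trans (⊗-cong (M.-ᴹ‿inverseˡ x) N.≈ᴹ-refl) (⊗-0ˡ y))) t)
                (fold-ε {M = M} {N} T t)))

          isLeftModule : IsLeftModule K.ring (_≈⊗_ M N) _++_ [] neg scale
          isLeftModule = record
            { isLeftSemimodule = record
              { +ᴹ-isCommutativeMonoid = T.isCommutativeMonoid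
              ; isPreleftSemimodule = record
                { *ₗ-cong = λ {r} {s} {t} e e′ → T.trans
                    (fold-ext T (λ x y → ⊗-cong (M.*ₗ-cong e M.≈ᴹ-refl) N.≈ᴹ-refl) t)
                    (Balanced.fold-cong (scale-balanced s) e′)
                ; *ₗ-zeroˡ = λ t → T.trans
                    (fold-ext T (λ x y → T.trans (⊗-cong (M.*ₗ-zeroˡ x) N.≈ᴹ-refl) (⊗-0ˡ y)) t)
                    (fold-ε {M = M} {N} T t)
                ; *ₗ-distribʳ = λ t r s → T.trans
                    (fold-ext T (λ x y → T.trans (⊗-cong (M.*ₗ-distribʳ x r s) N.≈ᴹ-refl) (⊗-+ˡ _ _ y)) t)
                    (fold-∙ T _ _ t)
                ; *ₗ-identityˡ = λ t → T.trans
                    (fold-ext T (λ x y → ⊗-cong (M.*ₗ-identityˡ x) N.≈ᴹ-refl) t)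
                    (fold-pure t)
                ; *ₗ-assoc = *-assoc
                ; *ₗ-zeroʳ = λ r → T.refl
                ; *ₗ-distribˡ = λ r t u → fold-++ T _ t u
                }
              }
            ; -ᴹ‿cong = Balanced.fold-cong neg-balanced
            ; -ᴹ‿inverse = neg-inverse , λ t → T.trans (T.comm t (neg t)) (neg-inverse t)
            }

    module _ {M : VS u ℓu} {N : VS v ℓv} where
      private
        module M = LeftModule M
        module N = LeftModule N
        module M⊗N = LeftModule (M ⊗ N)

      ⊗-bilinear : Bilinear M N (M ⊗ N)
      ⊗-bilinear = record
        { ⟪_,_⟫   = λ x y → (x , y) ∷ []
        ; ⟪⟫-cong = ⊗-cong
        ; +-homoˡ = ⊗-+ˡ
        ; +-homoʳ = ⊗-+ʳ
        ; *-homoˡ = λ r x y → ≈-refl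
        ; *-homoʳ = λ r x y → ≈-sym (⊗-* r x y)
        }

      lift : {P : VS p ℓp} → Bilinear M N P → LinearMap (M ⊗ N) P
      lift {P = P} b = linearMap (fold P.+ᴹ-commutativeMonoid b.⟪_,_⟫)
        (Balanced.fold-cong balanced)
        (fold-++ P.+ᴹ-commutativeMonoid b.⟪_,_⟫)
        homo
        where
          module P = LeftModule P
          module b = Bilinear b
          balanced : Balanced P.+ᴹ-commutativeMonoid b.⟪_,_⟫
          balanced = record
            { b-cong = b.⟪⟫-cong ; b-+ˡ = b.+-homoˡ ; b-+ʳ = b.+-homoʳ
            ; b-* = λ r x y → P.≈ᴹ-trans (b.*-homoˡ r x y) (P.≈ᴹ-sym (b.*-homoʳ r x y))
            ; b-0ˡ = b.0-homoˡ }
          homo : ∀ r t → fold P.+ᴹ-commutativeMonoid b.⟪_,_⟫ (r M⊗N.*ₗ t) P.≈ᴹ r P.*ₗ fold P.+ᴹ-commutativeMonoid b.⟪_,_⟫ t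
          homo r []            = P.≈ᴹ-sym (P.*ₗ-zeroʳ r)
          homo r ((x , y) ∷ t) = P.≈ᴹ-trans (P.+ᴹ-cong (b.*-homoˡ r x y) (homo r t))
                                   (P.≈ᴹ-sym (P.*ₗ-distribˡ r _ _))

    infixr 7 _⊗₁_
    _⊗₁_ : ∀ {u′ v′ ℓu′ ℓv′} {M : VS u ℓu} {N : VS v ℓv} {M′ : VS u′ ℓu′} {N′ : VS v′ ℓv′} →
           LinearMap M M′ → LinearMap N N′ → LinearMap (M ⊗ N) (M′ ⊗ N′)
    _⊗₁_ {M′ = M′} {N′} f g = lift record
      { ⟪_,_⟫   = λ x y → (⟦ f ⟧ x , ⟦ g ⟧ y) ∷ []
      ; ⟪⟫-cong = λ e e′ → ⊗-cong (f.⟦⟧-cong e) (g.⟦⟧-cong e′)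
      ; +-homoˡ = λ x x′ y → ≈-trans (⊗-cong (f.+ᴹ-homo x x′) N′.≈ᴹ-refl) (⊗-+ˡ _ _ _)
      ; +-homoʳ = λ x y y′ → ≈-trans (⊗-cong M′.≈ᴹ-refl (g.+ᴹ-homo y y′)) (⊗-+ʳ _ _ _)
      ; *-homoˡ = λ r x y → ⊗-cong (f.*ₗ-homo r x) N′.≈ᴹ-refl
      ; *-homoʳ = λ r x y → ≈-trans (⊗-cong M′.≈ᴹ-refl (g.*ₗ-homo r y)) (≈-sym (⊗-* r _ _))
      }
      where
        module M′ = LeftModule M′
        module N′ = LeftModule N′
        module f = LinearMap f
        module g = LinearMap g

    swap : {M : VS u ℓu} {N : VS v ℓv} → LinearMap (M ⊗ N) (N ⊗ M)
    swap = lift record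
      { ⟪_,_⟫   = λ x y → (y , x) ∷ []
      ; ⟪⟫-cong = flip ⊗-cong
      ; +-homoˡ = λ x x′ y → ⊗-+ʳ y x x′
      ; +-homoʳ = λ x y y′ → ⊗-+ˡ y y′ x
      ; *-homoˡ = λ r x y → ≈-sym (⊗-* r y x)
      ; *-homoʳ = λ r x y → ≈-refl
      }

    record FinitelySupported (M : ℕ → VS u ℓu) : Set (u ⊔ ℓu) where
      private module M n = LeftModule (M n)
      field
        component : ∀ n → M.Carrierᴹ n
        bound     : ℕ
        vanishes  : ∀ n → bound ℕ.≤ n → M._≈ᴹ_ n (component n) (M.0ᴹ n)

    open FinitelySupported public

    ⨁ : (ℕ → VS u ℓu) → VS (u ⊔ ℓu) ℓu
    ⨁ {u = u} {ℓu} M = record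
      { Carrierᴹ = FinitelySupported M
      ; _≈ᴹ_ = _≈′_
      ; _+ᴹ_ = _+′_
      ; _*ₗ_ = _*′_
      ; 0ᴹ   = 0′
      ; -ᴹ_  = -′_
      ; isLeftModule = isLeftModule
      }
      where
        module M n = LeftModule (M n)

        -0≈0 : ∀ n → M._≈ᴹ_ n (M.-ᴹ_ n (M.0ᴹ n)) (M.0ᴹ n)
        -0≈0 n = ε⁻¹≈ε
          where open import Algebra.Properties.Group (M.+ᴹ-group n) using (ε⁻¹≈ε)

        _≈′_ : FinitelySupported M → FinitelySupported M → Set ℓu
        f ≈′ g = ∀ n → M._≈ᴹ_ n (component f n) (component g n)

        _+′_ : FinitelySupported M → FinitelySupported M → FinitelySupported M
        f +′ g = record
          { component = λ n → M._+ᴹ_ n (component f n) (component g n)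
          ; bound     = bound f ℕ.+ bound g
          ; vanishes  = λ n le → M.≈ᴹ-trans n
              (M.+ᴹ-cong n (vanishes f n (ℕₚ.≤-trans (ℕₚ.m≤m+n _ _) le))
                           (vanishes g n (ℕₚ.≤-trans (ℕₚ.m≤n+m _ _) le)))
              (M.+ᴹ-identityˡ n _)
          }

        _*′_ : K.Carrier → FinitelySupported M → FinitelySupported M
        r *′ f = record
          { component = λ n → M._*ₗ_ n r (component f n)
          ; bound     = bound f
          ; vanishes  = λ n le → M.≈ᴹ-trans n (M.*ₗ-congˡ n (vanishes f n le)) (M.*ₗ-zeroʳ n r)
          }

        0′ : FinitelySupported M
        0′ = record { component = λ n → M.0ᴹ n ; bound = 0 ; vanishes = λ n _ → M.≈ᴹ-refl n }

        -′_ : FinitelySupported M → FinitelySupported M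
        -′ f = record
          { component = λ n → M.-ᴹ_ n (component f n)
          ; bound     = bound f
          ; vanishes  = λ n le → M.≈ᴹ-trans n (M.-ᴹ‿cong n (vanishes f n le)) (-0≈0 n)
          }

        abstract
          isLeftModule : IsLeftModule K.ring _≈′_ _+′_ 0′ -′_ _*′_
          isLeftModule = record
            { isLeftSemimodule = record
              { +ᴹ-isCommutativeMonoid = record
                { isMonoid = record
                  { isSemigroup = record
                    { isMagma = record
                      { isEquivalence = record
                        { refl = λ n → M.≈ᴹ-refl n
                        ; sym = λ e n → M.≈ᴹ-sym n (e n)
                        ; trans = λ e e′ n → M.≈ᴹ-trans n (e n) (e′ n) }
                      ; ∙-cong = λ e e′ n → M.+ᴹ-cong n (e n) (e′ n) }
                    ; assoc = λ _ _ _ n → M.+ᴹ-assoc n _ _ _ }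
                  ; identity = (λ _ n → M.+ᴹ-identityˡ n _) , (λ _ n → M.+ᴹ-identityʳ n _) }
                ; comm = λ _ _ n → M.+ᴹ-comm n _ _ }
              ; isPreleftSemimodule = record
                { *ₗ-cong = λ e e′ n → M.*ₗ-cong n e (e′ n)
                ; *ₗ-zeroˡ = λ _ n → M.*ₗ-zeroˡ n _
                ; *ₗ-distribʳ = λ _ _ _ n → M.*ₗ-distribʳ n _ _ _
                ; *ₗ-identityˡ = λ _ n → M.*ₗ-identityˡ n _
                ; *ₗ-assoc = λ _ _ _ n → M.*ₗ-assoc n _ _ _
                ; *ₗ-zeroʳ = λ _ n → M.*ₗ-zeroʳ n _
                ; *ₗ-distribˡ = λ _ _ _ n → M.*ₗ-distribˡ n _ _ _ } }
            ; -ᴹ‿cong = λ e n → M.-ᴹ‿cong n (e n)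
            ; -ᴹ‿inverse = (λ _ n → M.-ᴹ‿inverseˡ n _) , (λ _ n → M.-ᴹ‿inverseʳ n _)
            }

    ⨁-map : {M : ℕ → VS u ℓu} {N : ℕ → VS v ℓv} → (∀ n → LinearMap (M n) (N n)) → LinearMap (⨁ M) (⨁ N)
    ⨁-map {M = M} {N} h = linearMap
      (λ f → record
        { component = λ n → ⟦ h n ⟧ (component f n)
        ; bound     = bound f
        ; vanishes  = λ n le → N.≈ᴹ-trans n (h.⟦⟧-cong n (vanishes f n le)) (h.0ᴹ-homo n) })
      (λ e n → h.⟦⟧-cong n (e n)) (λ _ _ n → h.+ᴹ-homo n _ _) (λ _ _ n → h.*ₗ-homo n _ _)
      where
        module N n = LeftModule (N n)
        module h n = LinearMap (h n)

    ι : (M : ℕ → VS u ℓu) (n : ℕ) → LinearMap (M n) (⨁ M)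
    ι M n = linearMap
      (λ x → record
        { component = λ i → put x i (n ℕₚ.≟ i)
        ; bound     = suc n
        ; vanishes  = λ i lt → off x i (n ℕₚ.≟ i) lt })
      (λ e i → put-cong e i (n ℕₚ.≟ i)) (λ x y i → put-+ x y i (n ℕₚ.≟ i)) (λ r x i → put-* r x i (n ℕₚ.≟ i))
      where
        module M n = LeftModule (M n)
        put : M.Carrierᴹ n → ∀ i → Dec (n ≡ i) → M.Carrierᴹ i
        put x i (yes ≡.refl) = x
        put x i (no _)       = M.0ᴹ i
        off : ∀ x i d → suc n ℕ.≤ i → M._≈ᴹ_ i (put x i d) (M.0ᴹ i)
        off x i (yes ≡.refl) lt = contradiction ≡.refl (ℕₚ.<⇒≢ lt)
        off x i (no _)       lt = M.≈ᴹ-refl i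
        put-cong : ∀ {x y} → M._≈ᴹ_ n x y → ∀ i d → M._≈ᴹ_ i (put x i d) (put y i d)
        put-cong e i (yes ≡.refl) = e
        put-cong e i (no _)       = M.≈ᴹ-refl i
        put-+ : ∀ x y i d → M._≈ᴹ_ i (put (M._+ᴹ_ n x y) i d) (M._+ᴹ_ i (put x i d) (put y i d))
        put-+ x y i (yes ≡.refl) = M.≈ᴹ-refl i
        put-+ x y i (no _)       = M.≈ᴹ-sym i (M.+ᴹ-identityˡ i _)
        put-* : ∀ r x i d → M._≈ᴹ_ i (put (M._*ₗ_ n r x) i d) (M._*ₗ_ i r (put x i d))
        put-* r x i (yes ≡.refl) = M.≈ᴹ-refl i
        put-* r x i (no _)       = M.≈ᴹ-sym i (M.*ₗ-zeroʳ i r)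

    -- The linear map on ⨁ M restricting to h n on M n; the sum over all degrees
    -- is cut off at the bound on the support.
    ⨁-rec : {M : ℕ → VS u ℓu} {P : VS p ℓp} → (∀ n → LinearMap (M n) P) → LinearMap (⨁ M) P
    ⨁-rec {M = M} {P} h = linearMap
      (λ f → ∑< (bound f) (λ n → ⟦ h n ⟧ (component f n)))
      (λ {f} {g} e → P.≈ᴹ-trans
        (∑<-bound (bound f) (bound g) (λ n le → vanish f n le)
          (λ n le → P.≈ᴹ-trans (h.⟦⟧-cong n (e n)) (vanish g n le)))
        (∑<-cong (bound g) (λ n → h.⟦⟧-cong n (e n))))
      (λ f g → P.≈ᴹ-trans (∑<-cong (bound f ℕ.+ bound g) (λ n → h.+ᴹ-homo n _ _))
        (P.≈ᴹ-trans (∑<-+ (bound f ℕ.+ bound g) _ _)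
          (P.+ᴹ-cong (extend (bound f) (bound g) (λ n le → vanish f n le))
            (P.≈ᴹ-trans (P.≈ᴹ-reflexive (≡.cong (λ b → ∑< b (λ n → ⟦ h n ⟧ (component g n))) (ℕₚ.+-comm (bound f) (bound g))))
                        (extend (bound g) (bound f) (λ n le → vanish g n le))))))
      (λ r f → P.≈ᴹ-trans (∑<-cong (bound f) (λ n → h.*ₗ-homo n r _)) (∑<-* (bound f) r _))
      where
        module M n = LeftModule (M n)
        module P = LeftModule P
        module h n = LinearMap (h n)
        open CommSemigroup (CommutativeMonoid.commutativeSemigroup P.+ᴹ-commutativeMonoid) using (interchange)

        ∑< : ℕ → (ℕ → P.Carrierᴹ) → P.Carrierᴹ
        ∑< zero    g = P.0ᴹ
        ∑< (suc N) g = ∑< N g P.+ᴹ g N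

        ∑<-cong : ∀ N {g g′} → (∀ n → g n P.≈ᴹ g′ n) → ∑< N g P.≈ᴹ ∑< N g′
        ∑<-cong zero    e = P.≈ᴹ-refl
        ∑<-cong (suc N) e = P.+ᴹ-cong (∑<-cong N e) (e N)

        ∑<-+ : ∀ N g g′ → ∑< N (λ n → g n P.+ᴹ g′ n) P.≈ᴹ ∑< N g P.+ᴹ ∑< N g′
        ∑<-+ zero    g g′ = P.≈ᴹ-sym (P.+ᴹ-identityˡ _)
        ∑<-+ (suc N) g g′ = P.≈ᴹ-trans (P.+ᴹ-congʳ (∑<-+ N g g′)) (interchange _ _ _ _)

        ∑<-* : ∀ N r g → ∑< N (λ n → r P.*ₗ g n) P.≈ᴹ r P.*ₗ ∑< N g
        ∑<-* zero    r g = P.≈ᴹ-sym (P.*ₗ-zeroʳ r)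
        ∑<-* (suc N) r g = P.≈ᴹ-trans (P.+ᴹ-congʳ (∑<-* N r g)) (P.≈ᴹ-sym (P.*ₗ-distribˡ r _ _))

        extend : ∀ N N′ {g} → (∀ n → N ℕ.≤ n → g n P.≈ᴹ P.0ᴹ) → ∑< (N ℕ.+ N′) g P.≈ᴹ ∑< N g
        extend N zero     {g} v = P.≈ᴹ-reflexive (≡.cong (λ b → ∑< b g) (ℕₚ.+-identityʳ N))
        extend N (suc N′) {g} v = P.≈ᴹ-trans (P.≈ᴹ-reflexive (≡.cong (λ b → ∑< b g) (ℕₚ.+-suc N N′)))
          (P.≈ᴹ-trans (P.+ᴹ-cong (extend N N′ v) (v (N ℕ.+ N′) (ℕₚ.m≤m+n N N′))) (P.+ᴹ-identityʳ _))

        ∑<-bound : ∀ N N′ {g} → (∀ n → N ℕ.≤ n → g n P.≈ᴹ P.0ᴹ) → (∀ n → N′ ℕ.≤ n → g n P.≈ᴹ P.0ᴹ) →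
                   ∑< N g P.≈ᴹ ∑< N′ g
        ∑<-bound N N′ {g} v v′ = P.≈ᴹ-trans (P.≈ᴹ-sym (extend N N′ v))
          (P.≈ᴹ-trans (P.≈ᴹ-reflexive (≡.cong (λ b → ∑< b g) (ℕₚ.+-comm N N′))) (extend N′ N v′))

        vanish : ∀ f n → bound f ℕ.≤ n → ⟦ h n ⟧ (component f n) P.≈ᴹ P.0ᴹ
        vanish f n le = P.≈ᴹ-trans (h.⟦⟧-cong n (vanishes f n le)) (h.0ᴹ-homo n)

    -- Maps A (left n i) ⊗ A (right n i) → A n for 0 ≤ i ≤ n, summed up to a map
    -- on the direct sums; only the indicated components of the arguments
    -- contribute in degree n.
    module _ (A : ℕ → VS u ℓu) (left right : ∀ n → Fin (suc n) → ℕ)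
      (left+right : ∀ n i → left n i ℕ.+ right n i ≡ n)
      (f : ∀ n i → LinearMap (A (left n i) ⊗ A (right n i)) (A n)) where

      private
        module A n = LeftModule (A n)
        module f n i = LinearMap (f n i)
        module Sum n = FiniteSum (A.+ᴹ-commutativeMonoid n)

        pure : FinitelySupported A → FinitelySupported A → ∀ n i → FormalSum (A (left n i)) (A (right n i))
        pure x y n i = (component x (left n i) , component y (right n i)) ∷ []

        term : FinitelySupported A → FinitelySupported A → ∀ n → Fin (suc n) → A.Carrierᴹ n
        term x y n i = ⟦ f n i ⟧ (pure x y n i)

        scale-sum : ∀ n r k (t : Fin k → A.Carrierᴹ n) →
                    A._≈ᴹ_ n (Sum.sum n (λ i → A._*ₗ_ n r (t i))) (A._*ₗ_ n r (Sum.sum n t))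
        scale-sum n r zero    t = A.≈ᴹ-sym n (A.*ₗ-zeroʳ n r)
        scale-sum n r (suc k) t = A.≈ᴹ-trans n (A.+ᴹ-congˡ n (scale-sum n r k (t ∘ suc)))
                                    (A.≈ᴹ-sym n (A.*ₗ-distribˡ n r _ _))

        term-0 : ∀ x y n i → bound x ℕ.+ bound y ℕ.≤ n → A._≈ᴹ_ n (term x y n i) (A.0ᴹ n)
        term-0 x y n i le with bound x ℕₚ.≤? left n i | bound y ℕₚ.≤? right n i
        ... | yes p | _ = A.≈ᴹ-trans n
          (f.⟦⟧-cong n i (≈-trans (⊗-cong (vanishes x _ p) (A.≈ᴹ-refl _)) (⊗-0ˡ _))) (f.0ᴹ-homo n i)
        ... | no _ | yes q = A.≈ᴹ-trans n
          (f.⟦⟧-cong n i (≈-trans (⊗-cong (A.≈ᴹ-refl _) (vanishes y _ q)) (Bilinear.0-homoʳ ⊗-bilinear _)))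
          (f.0ᴹ-homo n i)
        ... | no ¬p | no ¬q = contradiction
          (ℕₚ.≤-trans le (ℕₚ.≤-reflexive (≡.sym (left+right n i))))
          (ℕₚ.<⇒≱ (ℕₚ.+-mono-< (ℕₚ.≰⇒> ¬p) (ℕₚ.≰⇒> ¬q)))

        sum-≈ : ∀ n {t u : Fin (suc n) → A.Carrierᴹ n} → (∀ i → A._≈ᴹ_ n (t i) (u i)) →
                A._≈ᴹ_ n (Sum.sum n t) (Sum.sum n u)
        sum-≈ n = Sum.sum-cong-≋ n

      gradedProduct : LinearMap (⨁ A ⊗ ⨁ A) (⨁ A)
      gradedProduct = lift record
        { ⟪_,_⟫ = λ x y → record
          { component = λ n → Sum.sum n λ i → ⟦ f n i ⟧ ((component x (left n i) , component y (right n i)) ∷ [])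
          ; bound     = bound x ℕ.+ bound y
          ; vanishes  = λ n le → A.≈ᴹ-trans n
              (sum-≈ n (λ i → term-0 x y n i le)) (Sum.sum-replicate-zero n (suc n))
          }
        ; ⟪⟫-cong = λ e e′ n → sum-≈ n λ i → f.⟦⟧-cong n i (⊗-cong (e _) (e′ _))
        ; +-homoˡ = λ x x′ y n → A.≈ᴹ-trans n
            (sum-≈ n λ i → A.≈ᴹ-trans n
              (f.⟦⟧-cong n i (⊗-+ˡ _ _ _)) (f.+ᴹ-homo n i (pure x y n i) (pure x′ y n i)))
            (Sum.∑-distrib-+ n (term x y n) (term x′ y n))
        ; +-homoʳ = λ x y y′ n → A.≈ᴹ-trans n
            (sum-≈ n λ i → A.≈ᴹ-trans n
              (f.⟦⟧-cong n i (⊗-+ʳ _ _ _)) (f.+ᴹ-homo n i (pure x y n i) (pure x y′ n i)))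
            (Sum.∑-distrib-+ n (term x y n) (term x y′ n))
        ; *-homoˡ = λ r x y n → A.≈ᴹ-trans n
            (sum-≈ n λ i → f.*ₗ-homo n i r (pure x y n i))
            (scale-sum n r (suc n) (term x y n))
        ; *-homoʳ = λ r x y n → A.≈ᴹ-trans n
            (sum-≈ n λ i → A.≈ᴹ-trans n
              (f.⟦⟧-cong n i (≈-sym (⊗-* r _ _))) (f.*ₗ-homo n i r (pure x y n i)))
            (scale-sum n r (suc n) (term x y n))
        }

  open LinearAlgebra public

  module ClassFunctions where
    open CharacteristicZeroField 𝕂 using (recip; recip-inverse)
    open K using (_+_; _*_; 0#; 1#)
    open FiniteSum K.+-commutativeMonoid

    record ClassFunction (G : Group a ℓ) : Set (a ⊔ ℓ ⊔ k ⊔ ℓk) where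
      open Group G
      field
        fun      : Carrier → K.Carrier
        fun-cong : ∀ {g h} → g ≈ h → fun g K.≈ fun h
        fun-conj : ∀ h g → fun (h ∙ g ∙ h ⁻¹) K.≈ fun g

    open ClassFunction public

    cf : Group a ℓ → VS (a ⊔ ℓ ⊔ k ⊔ ℓk) (a ⊔ ℓk)
    cf {a = a} G = record
      { Carrierᴹ = ClassFunction G
      ; _≈ᴹ_ = _≈′_
      ; _+ᴹ_ = _+′_
      ; _*ₗ_ = _*′_
      ; 0ᴹ   = 0′
      ; -ᴹ_  = -′_
      ; isLeftModule = isLeftModule
      }
      where
        _≈′_ : ClassFunction G → ClassFunction G → Set (a ⊔ ℓk)
        φ ≈′ ψ = ∀ g → fun φ g K.≈ fun ψ g

        _+′_ : ClassFunction G → ClassFunction G → ClassFunction G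
        φ +′ ψ = record
          { fun = λ g → fun φ g + fun ψ g
          ; fun-cong = λ e → K.+-cong (fun-cong φ e) (fun-cong ψ e)
          ; fun-conj = λ h g → K.+-cong (fun-conj φ h g) (fun-conj ψ h g) }

        _*′_ : K.Carrier → ClassFunction G → ClassFunction G
        r *′ φ = record
          { fun = λ g → r * fun φ g
          ; fun-cong = λ e → K.*-congˡ (fun-cong φ e)
          ; fun-conj = λ h g → K.*-congˡ (fun-conj φ h g) }

        0′ : ClassFunction G
        0′ = record { fun = λ _ → 0# ; fun-cong = λ _ → K.refl ; fun-conj = λ _ _ → K.refl }

        -′_ : ClassFunction G → ClassFunction G
        -′ φ = record
          { fun = λ g → K.- fun φ g
          ; fun-cong = λ e → K.-‿cong (fun-cong φ e)
          ; fun-conj = λ h g → K.-‿cong (fun-conj φ h g) }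

        abstract
          isLeftModule : IsLeftModule K.ring _≈′_ _+′_ 0′ -′_ _*′_
          isLeftModule = record
            { isLeftSemimodule = record
              { +ᴹ-isCommutativeMonoid = record
                { isMonoid = record
                  { isSemigroup = record
                    { isMagma = record
                      { isEquivalence = record
                        { refl = λ _ → K.refl ; sym = λ e g → K.sym (e g) ; trans = λ e e′ g → K.trans (e g) (e′ g) }
                      ; ∙-cong = λ e e′ g → K.+-cong (e g) (e′ g) }
                    ; assoc = λ _ _ _ _ → K.+-assoc _ _ _ }
                  ; identity = (λ _ _ → K.+-identityˡ _) , (λ _ _ → K.+-identityʳ _) }
                ; comm = λ _ _ _ → K.+-comm _ _ }
              ; isPreleftSemimodule = record
                { *ₗ-cong = λ e e′ g → K.*-cong e (e′ g)
                ; *ₗ-zeroˡ = λ _ _ → K.zeroˡ _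
                ; *ₗ-distribʳ = λ _ _ _ _ → K.distribʳ _ _ _
                ; *ₗ-identityˡ = λ _ _ → K.*-identityˡ _
                ; *ₗ-assoc = λ _ _ _ _ → K.*-assoc _ _ _
                ; *ₗ-zeroʳ = λ _ _ → K.zeroʳ _
                ; *ₗ-distribˡ = λ _ _ _ _ → K.distribˡ _ _ _ } }
            ; -ᴹ‿cong = λ e g → K.-‿cong (e g)
            ; -ᴹ‿inverse = (λ _ _ → K.-‿inverseˡ _) , (λ _ _ → K.-‿inverseʳ _)
            }

    pullback : {G : Group a ℓ} {H : Group b ℓ′} → Hom G H → LinearMap (cf H) (cf G)
    pullback {H = H} f = linearMap
      (λ ψ → record
        { fun      = fun ψ ∘ f.⟦_⟧
        ; fun-cong = fun-cong ψ ∘ f.⟦⟧-cong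
        ; fun-conj = λ h g → K.trans (fun-cong ψ (f.conj-homo h g)) (fun-conj ψ _ _) })
      (λ e g → e (f.⟦ g ⟧)) (λ _ _ _ → K.refl) (λ _ _ _ → K.refl)
      where module f = Hom f

    -- The external product (φ ⊠ ψ) (g , h) = φ g ψ h.
    module _ (G : Group a ℓ) (H : Group b ℓ′) where
      ⊠-bilinear : Bilinear (cf G) (cf H) (cf (DirectProduct.group G H))
      ⊠-bilinear = record
        { ⟪_,_⟫ = λ φ ψ → record
          { fun = λ (g , h) → fun φ g * fun ψ h
          ; fun-cong = λ (e , e′) → K.*-cong (fun-cong φ e) (fun-cong ψ e′)
          ; fun-conj = λ (g , h) (g′ , h′) → K.*-cong (fun-conj φ g g′) (fun-conj ψ h h′) }
        ; ⟪⟫-cong = λ e e′ (g , h) → K.*-cong (e g) (e′ h)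
        ; +-homoˡ = λ _ _ _ _ → K.distribʳ _ _ _
        ; +-homoʳ = λ _ _ _ _ → K.distribˡ _ _ _
        ; *-homoˡ = λ _ _ _ _ → K.*-assoc _ _ _
        ; *-homoʳ = λ _ _ _ _ → x∙yz≈y∙xz _ _ _
        }
        where open CommSemigroup K.*-commutativeSemigroup using (x∙yz≈y∙xz)

      ⊠ : LinearMap (cf G ⊗ cf H) (cf (DirectProduct.group G H))
      ⊠ = lift ⊠-bilinear

    module FiniteGroup (G : Group a ℓ) (finite : Finite (Group.setoid G)) where
      open Group G
      open Finite finite using (_≟_; size; elem)

      private instance
        size≢0 : NonZero size
        size≢0 = Finite.nonEmpty finite ε

      1/∣G∣ : K.Carrier
      1/∣G∣ = recip size

      average : (Carrier → K.Carrier) → K.Carrier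
      average f = 1/∣G∣ * ∑ finite f

      average-cong : ∀ {f f′} → (∀ x → f x K.≈ f′ x) → average f K.≈ average f′
      average-cong e = K.*-congˡ (∑-cong finite e)

      average-const : ∀ c → average (λ _ → c) K.≈ c
      average-const c = begin
        recip size * sum {size} (λ _ → c)     ≈⟨ K.*-congˡ (sum-replicate size) ⟩
        recip size * (size · c)          ≈⟨ K.*-congˡ (×-congʳ size (K.*-identityˡ c)) ⟨
        recip size * (size · (1# * c))   ≈⟨ K.*-congˡ (×-assoc-* size 1# c) ⟨
        recip size * ((size · 1#) * c)   ≈⟨ K.*-assoc _ _ _ ⟨
        recip size * (size · 1#) * c     ≈⟨ K.*-congʳ (recip-inverse size) ⟩
        1# * c                           ≈⟨ K.*-identityˡ c ⟩
        c                                ∎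
        where
          open SetoidReasoning K.setoid
          open import Algebra.Properties.Monoid.Mult K.+-monoid using (×-congʳ)
          open import Algebra.Properties.Semiring.Mult K.semiring using (×-assoc-*)

      δ : Carrier → Carrier → K.Carrier
      δ u g with g ≟ u
      ... | yes _ = 1#
      ... | no _  = 0#

      δ-cong : ∀ u {g g′} → g ≈ g′ → δ u g K.≈ δ u g′
      δ-cong u {g} {g′} e with g ≟ u | g′ ≟ u
      ... | yes _ | yes _ = K.refl
      ... | no _  | no _  = K.refl
      ... | yes p | no ¬q = contradiction (trans (sym e) p) ¬q
      ... | no ¬p | yes q = contradiction (trans e q) ¬p

      -- The class function 1/∣C∣ on the conjugacy class C of u, and 0 elsewhere.
      δᶜ : Carrier → ClassFunction G
      δᶜ u = record
        { fun      = λ g → average λ h → δ u (h ∙ g ∙ h ⁻¹)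
        ; fun-cong = λ e → average-cong λ h → δ-cong u (conj-cong G (refl {h}) e)
        ; fun-conj = λ k g → K.trans
            (average-cong λ h → δ-cong u (conj-∙ G h k g))
            (K.*-congˡ (∑-reindex finite (λ h → δ u (h ∙ g ∙ h ⁻¹))
              (λ e → δ-cong u (conj-cong G e (refl {g}))) (translation G k)))
        }

      ∑-δᶜ : (φ : ClassFunction G) → ∀ g → ∑ finite (λ u → fun φ u * fun (δᶜ u) g) K.≈ fun φ g
      ∑-δᶜ φ g = begin
        (∑ finite λ u → fun φ u * (1/∣G∣ * ∑ finite λ h → δ u (h ∙ g ∙ h ⁻¹)))
          ≈⟨ ∑-cong finite (λ u → x∙yz≈y∙xz (fun φ u) 1/∣G∣ (∑ finite λ h → δ u (h ∙ g ∙ h ⁻¹))) ⟩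
        (∑ finite λ u → 1/∣G∣ * (fun φ u * ∑ finite λ h → δ u (h ∙ g ∙ h ⁻¹)))
          ≈⟨ *-distribˡ-sum {size} 1/∣G∣ _ ⟨
        (1/∣G∣ * ∑ finite λ u → fun φ u * ∑ finite λ h → δ u (h ∙ g ∙ h ⁻¹))
          ≈⟨ K.*-congˡ (∑-cong finite (λ u → *-distribˡ-sum {size} (fun φ u) (λ i → δ u (elem i ∙ g ∙ elem i ⁻¹)))) ⟩
        (1/∣G∣ * ∑ finite λ u → ∑ finite λ h → fun φ u * δ u (h ∙ g ∙ h ⁻¹))
          ≈⟨ K.*-congˡ (∑-comm {size} {size} _) ⟩
        (average λ h → ∑ finite λ u → fun φ u * δ u (h ∙ g ∙ h ⁻¹))
          ≈⟨ average-cong (λ h → sift (h ∙ g ∙ h ⁻¹)) ⟩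
        (average λ h → fun φ (h ∙ g ∙ h ⁻¹))
          ≈⟨ average-cong (λ h → fun-conj φ h g) ⟩
        (average λ h → fun φ g)
          ≈⟨ average-const (fun φ g) ⟩
        fun φ g ∎
        where
          open SetoidReasoning K.setoid
          open CommSemigroup K.*-commutativeSemigroup using (x∙yz≈y∙xz)
          open import Algebra.Properties.Semiring.Sum K.semiring using (*-distribˡ-sum)
          δ-congˡ : ∀ {u u′} g → u ≈ u′ → δ u g K.≈ δ u′ g
          δ-congˡ {u} {u′} g e with g ≟ u | g ≟ u′
          ... | yes _ | yes _ = K.refl
          ... | no _  | no _  = K.refl
          ... | yes p | no ¬q = contradiction (trans p e) ¬q
          ... | no ¬p | yes q = contradiction (trans q (sym e)) ¬p
          δ-refl : ∀ u → δ u u K.≈ 1#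
          δ-refl u with u ≟ u
          ... | yes _ = K.refl
          ... | no ¬p = contradiction refl ¬p
          δ-off : ∀ {u g} → ¬ (u ≈ g) → δ u g K.≈ 0#
          δ-off {u} {g} u≉g with g ≟ u
          ... | yes p = contradiction (sym p) u≉g
          ... | no _  = K.refl
          sift : ∀ x → ∑ finite (λ u → fun φ u * δ u x) K.≈ fun φ x
          sift x = K.trans
            (∑-single finite (λ u → fun φ u * δ u x) (λ e → K.*-cong (fun-cong φ e) (δ-congˡ x e)) x
              (λ u u≉x → K.trans (K.*-congˡ (δ-off u≉x)) (K.zeroʳ _)))
            (K.trans (K.*-congˡ (δ-refl x)) (K.*-identityʳ _))

      module _ (H : Group b ℓ′) where
        private
          module H = Group H
          module T = LeftModule (cf G ⊗ cf H)
          module P = LeftModule (cf (DirectProduct.group G H))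
          module cfG = LeftModule (cf G)
          module cfH = LeftModule (cf H)
          module Σᵀ = FiniteSum T.+ᴹ-commutativeMonoid
          open CommSemigroup K.*-commutativeSemigroup using (x∙yz≈y∙xz)

          ⊗-congʳ : ∀ φ {ψ ψ′} → ψ cfH.≈ᴹ ψ′ → ((φ , ψ) ∷ []) T.≈ᴹ ((φ , ψ′) ∷ [])
          ⊗-congʳ φ {ψ} {ψ′} e = ⊗-cong {x = φ} {φ} {ψ} {ψ′} (λ _ → K.refl) e

          ⊗-congˡ : ∀ {φ φ′} ψ → φ cfG.≈ᴹ φ′ → ((φ , ψ) ∷ []) T.≈ᴹ ((φ′ , ψ) ∷ [])
          ⊗-congˡ {φ} {φ′} ψ e = ⊗-cong {x = φ} {φ′} {ψ} {ψ} e (λ _ → K.refl)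

        slice : ClassFunction (DirectProduct.group G H) → Carrier → ClassFunction H
        slice ψ u = record
          { fun      = λ h → fun ψ (u , h)
          ; fun-cong = λ e → fun-cong ψ (refl , e)
          ; fun-conj = λ k h → K.trans (fun-cong ψ (sym ε-conj , H.refl)) (fun-conj ψ (ε , k) (u , h))
          }
          where
            open import Algebra.Properties.Group G using (ε⁻¹≈ε)
            ε-conj : ε ∙ u ∙ ε ⁻¹ ≈ u
            ε-conj = trans (∙-cong (identityˡ u) ε⁻¹≈ε) (identityʳ u)

        -- The inverse of the isomorphism ⊠; see ⊠-⊠⁻¹ and ⊠⁻¹-⊠.
        ⊠⁻¹ : LinearMap (cf (DirectProduct.group G H)) (cf G ⊗ cf H)
        ⊠⁻¹ = linearMap
          (λ ψ → Σᵀ.∑ finite λ u → (δᶜ u , slice ψ u) ∷ [])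
          (λ {φ} {ψ} e → Σᵀ.∑-cong finite λ u → ⊗-congʳ (δᶜ u) {slice φ u} {slice ψ u} (λ h → e (u , h)))
          (λ φ ψ → T.≈ᴹ-trans
            (Σᵀ.∑-cong finite λ u → ≈-trans
              (⊗-congʳ (δᶜ u) {slice (φ P.+ᴹ ψ) u} {slice φ u cfH.+ᴹ slice ψ u} (λ _ → K.refl))
              (⊗-+ʳ (δᶜ u) (slice φ u) (slice ψ u)))
            (Σᵀ.∑-distrib-+ {size} (λ i → (δᶜ (elem i) , slice φ (elem i)) ∷ [])
                                   (λ i → (δᶜ (elem i) , slice ψ (elem i)) ∷ [])))
          (λ r ψ → T.≈ᴹ-trans
            (Σᵀ.∑-cong finite λ u → ≈-trans
              (⊗-congʳ (δᶜ u) {slice (r P.*ₗ ψ) u} {r cfH.*ₗ slice ψ u} (λ _ → K.refl))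
              (≈-sym (⊗-* r (δᶜ u) (slice ψ u))))
            (T.≈ᴹ-sym (scale-sum r size (λ i → (δᶜ (elem i) , slice ψ (elem i)) ∷ []))))
          where
            scale-sum : ∀ r n (t : Fin n → T.Carrierᴹ) → r T.*ₗ Σᵀ.sum t T.≈ᴹ Σᵀ.sum (λ i → r T.*ₗ t i)
            scale-sum r zero    t = T.*ₗ-zeroʳ r
            scale-sum r (suc n) t = T.≈ᴹ-trans (T.*ₗ-distribˡ r (t zero) _) (T.+ᴹ-congˡ (scale-sum r n (t ∘ suc)))

        ⊠-⊠⁻¹ : ∀ ψ → ⟦ ⊠ G H ⟧ (⟦ ⊠⁻¹ ⟧ ψ) P.≈ᴹ ψ
        ⊠-⊠⁻¹ ψ (g , h) = K.trans (eval size (λ i → (δᶜ (elem i) , slice ψ (elem i)) ∷ []))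
          (K.trans
            (∑-cong finite λ u → K.trans (K.+-identityʳ (fun (δᶜ u) g * fun ψ (u , h)))
                                         (K.*-comm (fun (δᶜ u) g) (fun ψ (u , h))))
            (∑-δᶜ ψ′ g))
          where
            ψ′ : ClassFunction G
            ψ′ = record
              { fun = λ u → fun ψ (u , h)
              ; fun-cong = λ e → fun-cong ψ (e , H.refl)
              ; fun-conj = λ k u → K.trans (fun-cong ψ (refl , H.sym ε-conj)) (fun-conj ψ (k , H.ε) (u , h)) }
              where
                open import Algebra.Properties.Group H using (ε⁻¹≈ε)
                ε-conj : H.ε H.∙ h H.∙ H.ε H.⁻¹ H.≈ h
                ε-conj = H.trans (H.∙-cong (H.identityˡ h) ε⁻¹≈ε) (H.identityʳ h)
            module ⊠ = LinearMap (⊠ G H)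
            eval : ∀ n (t : Fin n → T.Carrierᴹ) →
                   fun (⟦ ⊠ G H ⟧ (Σᵀ.sum t)) (g , h) K.≈ sum (λ i → fun (⟦ ⊠ G H ⟧ (t i)) (g , h))
            eval zero    t = K.refl
            eval (suc n) t = K.trans (⊠.+ᴹ-homo (t zero) (Σᵀ.sum (t ∘ suc)) (g , h)) (K.+-congˡ (eval n (t ∘ suc)))

        ⊠⁻¹-⊠ : ∀ t → ⟦ ⊠⁻¹ ⟧ (⟦ ⊠ G H ⟧ t) T.≈ᴹ t
        ⊠⁻¹-⊠ []            = ⊠⁻¹.0ᴹ-homo
          where module ⊠⁻¹ = LinearMap ⊠⁻¹
        ⊠⁻¹-⊠ ((φ , ψ) ∷ t) = T.≈ᴹ-trans
          (⊠⁻¹.+ᴹ-homo φ⊠ψ (⟦ ⊠ G H ⟧ t))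
          (T.+ᴹ-cong {x = ⟦ ⊠⁻¹ ⟧ φ⊠ψ} {(φ , ψ) ∷ []}
            (T.≈ᴹ-trans
              (Σᵀ.∑-cong finite λ u → ≈-trans
                (⊗-congʳ (δᶜ u) {slice φ⊠ψ u} {fun φ u cfH.*ₗ ψ} (λ _ → K.refl))
                (≈-sym (⊗-* (fun φ u) (δᶜ u) ψ)))
              (T.≈ᴹ-trans (T.≈ᴹ-sym (pull size χ))
                (⊗-congˡ {Σᴳ.sum χ} {φ} ψ (λ g → K.trans (eval size χ g) (∑-δᶜ φ g)))))
            (⊠⁻¹-⊠ t))
          where
            module ⊠⁻¹ = LinearMap ⊠⁻¹
            module Σᴳ = FiniteSum cfG.+ᴹ-commutativeMonoid
            φ⊠ψ : ClassFunction (DirectProduct.group G H)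
            φ⊠ψ = ⟪_,_⟫ (⊠-bilinear G H) φ ψ
            χ : Fin size → ClassFunction G
            χ i = fun φ (elem i) cfG.*ₗ δᶜ (elem i)
            pull : ∀ n (χ : Fin n → ClassFunction G) → (Σᴳ.sum χ , ψ) ∷ [] T.≈ᴹ Σᵀ.sum (λ i → (χ i , ψ) ∷ [])
            pull zero    χ = ⊗-0ˡ ψ
            pull (suc n) χ = T.≈ᴹ-trans (⊗-+ˡ (χ zero) _ ψ) (T.+ᴹ-congˡ {(χ zero , ψ) ∷ []} (pull n (χ ∘ suc)))
            eval : ∀ n (χ : Fin n → ClassFunction G) g → fun (Σᴳ.sum χ) g K.≈ sum (λ i → fun (χ i) g)
            eval zero    χ g = K.refl
            eval (suc n) χ g = K.+-congˡ (eval n (χ ∘ suc) g)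

      -- The isomorphism cf L ≅ cf G ⊗ cf H induced by a group isomorphism L ≅ G × H.
      module _ {H : Group b ℓ′} {L : Group c ℓ″}
        (f : Hom L (DirectProduct.group G H)) (f⁻¹ : Hom (DirectProduct.group G H) L) where

        private
          module G×H = Group (DirectProduct.group G H)
          module L = Group L
          module f = Hom f
          module f⁻¹ = Hom f⁻¹
          module T = LeftModule (cf G ⊗ cf H)

        cf-split : LinearMap (cf L) (cf G ⊗ cf H)
        cf-split = ⊠⁻¹ H ∘ₗ pullback f⁻¹

        cf-join : LinearMap (cf G ⊗ cf H) (cf L)
        cf-join = pullback f ∘ₗ ⊠ G H

        cf-split-join : (∀ x → f.⟦ f⁻¹.⟦ x ⟧ ⟧ G×H.≈ x) → ∀ t → ⟦ cf-split ⟧ (⟦ cf-join ⟧ t) T.≈ᴹ t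
        cf-split-join inv t = T.≈ᴹ-trans
          (LinearMap.⟦⟧-cong (⊠⁻¹ H) {⟦ pullback f⁻¹ ⟧ (⟦ cf-join ⟧ t)} {⟦ ⊠ G H ⟧ t}
            (λ x → fun-cong (⟦ ⊠ G H ⟧ t) (inv x)))
          (⊠⁻¹-⊠ H t)

        cf-join-split : (∀ y → f⁻¹.⟦ f.⟦ y ⟧ ⟧ L.≈ y) → ∀ ψ y → fun (⟦ cf-join ⟧ (⟦ cf-split ⟧ ψ)) y K.≈ fun ψ y
        cf-join-split inv ψ y = K.trans (⊠-⊠⁻¹ H (⟦ pullback f⁻¹ ⟧ ψ) f.⟦ y ⟧) (fun-cong ψ (inv y))

      module _ {p} (H : DecSubgroup G p) where
        open DecSubgroup H using (_∈; _∈?; ∈-resp-≈)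
        private
          module H = DecSubgroup H
          module Hfin = Finite (H.finite finite)
          instance
            size-H≢0 : NonZero Hfin.size
            size-H≢0 = Hfin.nonEmpty (Group.ε H.group)

        extend : ClassFunction H.group → Carrier → K.Carrier
        extend ψ g with g ∈?
        ... | yes p = fun ψ (g , p)
        ... | no _  = 0#

        extend-cong : ∀ ψ {g g′} → g ≈ g′ → extend ψ g K.≈ extend ψ g′
        extend-cong ψ {g} {g′} e with g ∈? | g′ ∈?
        ... | yes p | yes q = fun-cong ψ e
        ... | no _  | no _  = K.refl
        ... | yes p | no ¬q = contradiction (∈-resp-≈ e p) ¬q
        ... | no ¬p | yes q = contradiction (∈-resp-≈ (sym e) q) ¬p

        extend-≈ : ∀ {φ ψ} → LeftModule._≈ᴹ_ (cf H.group) φ ψ → ∀ g → extend φ g K.≈ extend ψ g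
        extend-≈ e g with g ∈?
        ... | yes p = e (g , p)
        ... | no _  = K.refl

        extend-+ : ∀ φ ψ g → extend (LeftModule._+ᴹ_ (cf H.group) φ ψ) g K.≈ extend φ g + extend ψ g
        extend-+ φ ψ g with g ∈?
        ... | yes p = K.refl
        ... | no _  = K.sym (K.+-identityˡ 0#)

        extend-* : ∀ r ψ g → extend (LeftModule._*ₗ_ (cf H.group) r ψ) g K.≈ r * extend ψ g
        extend-* r ψ g with g ∈?
        ... | yes p = K.refl
        ... | no _  = K.sym (K.zeroʳ r)

        -- Ind ψ (g) = 1/∣H∣ ∑ ψ(xgx⁻¹) over the x ∈ G such that xgx⁻¹ ∈ H.
        Ind : LinearMap (cf H.group) (cf G)
        Ind = linearMap
          (λ ψ → record
            { fun      = λ g → recip Hfin.size * ∑ finite λ x → extend ψ (x ∙ g ∙ x ⁻¹)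
            ; fun-cong = λ e → K.*-congˡ (∑-cong finite λ x → extend-cong ψ (conj-cong G (refl {x}) e))
            ; fun-conj = λ k g → K.*-congˡ (K.trans
                (∑-cong finite λ x → extend-cong ψ (conj-∙ G x k g))
                (∑-reindex finite (λ x → extend ψ (x ∙ g ∙ x ⁻¹))
                  (λ e → extend-cong ψ (conj-cong G e (refl {g}))) (translation G k)))
            })
          (λ {φ} {ψ} e g → K.*-congˡ (∑-cong finite λ x → extend-≈ {φ} {ψ} e (x ∙ g ∙ x ⁻¹)))
          (λ φ ψ g → K.trans
            (K.*-congˡ (K.trans (∑-cong finite λ x → extend-+ φ ψ (x ∙ g ∙ x ⁻¹))
              (∑-distrib-+ {size} (λ i → extend φ (elem i ∙ g ∙ elem i ⁻¹)) (λ i → extend ψ (elem i ∙ g ∙ elem i ⁻¹)))))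
            (K.distribˡ _ _ _))
          (λ r ψ g → K.trans
            (K.*-congˡ (K.trans (∑-cong finite λ x → extend-* r ψ (x ∙ g ∙ x ⁻¹))
              (K.sym (*-distribˡ-sum {size} r (λ i → extend ψ (elem i ∙ g ∙ elem i ⁻¹))))))
            (x∙yz≈y∙xz _ _ _))
          where
            open CommSemigroup K.*-commutativeSemigroup using (x∙yz≈y∙xz)
            open import Algebra.Properties.Semiring.Sum K.semiring using (*-distribˡ-sum)

    module _ {a₁ a₂ a₃ l₁ l₂ l₃} {L : Group a₁ l₁} {U : Group a₂ l₂} {P : Group a₃ l₃}
      (L⋉U : SemidirectProduct L U P) where
      open SemidirectProduct L⋉U
      private
        module L = Group L
        module U = Group U
        module P = Group P
        module s = Hom inclusionᴸ
        module r = Hom inclusionᵁ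

      -- Inf ψ (lx) = ψ(l) for l ∈ L and x ∈ U.
      Inf : LinearMap (cf L) (cf P)
      Inf = pullback projection

      Inf-LU : ∀ ψ l x → fun (⟦ Inf ⟧ ψ) (s.⟦ l ⟧ P.∙ r.⟦ x ⟧) K.≈ fun ψ l
      Inf-LU ψ l x = fun-cong ψ (L.trans (π.homo s.⟦ l ⟧ r.⟦ x ⟧)
        (L.trans (L.∙-cong (splits l) (π-U x)) (L.identityʳ l)))
        where module π = Hom projection

      module _ (U-finite : Finite U.setoid) where
        open FiniteGroup U U-finite using (average; average-cong)
        open Finite U-finite using (size; elem)

        private
          F : ClassFunction P → L.Carrier → U.Carrier → K.Carrier
          F ψ g x = fun ψ (s.⟦ g ⟧ P.∙ r.⟦ x ⟧)

        -- Def ψ (g) = 1/∣U∣ ∑ ψ(gx) over x ∈ U.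
        Def : LinearMap (cf P) (cf L)
        Def = linearMap
          (λ ψ → record
            { fun      = λ g → average λ x → fun ψ (s.⟦ g ⟧ P.∙ r.⟦ x ⟧)
            ; fun-cong = λ e → average-cong λ x → fun-cong ψ (P.∙-congʳ {r.⟦ x ⟧} (s.⟦⟧-cong e))
            ; fun-conj = λ h g → K.*-congˡ (K.trans
                (K.sym (∑-reindex U-finite (F ψ (h L.∙ g L.∙ h L.⁻¹))
                  (λ e → fun-cong ψ (P.∙-congˡ (r.⟦⟧-cong e))) (conjugation s.⟦ h ⟧)))
                (∑-cong U-finite λ x → K.trans
                  (fun-cong ψ (P.trans
                    (P.∙-cong (s.conj-homo h g) (r-conj s.⟦ h ⟧ x))
                    (P.sym (conj-homo-∙ P s.⟦ h ⟧ s.⟦ g ⟧ r.⟦ x ⟧))))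
                  (fun-conj ψ s.⟦ h ⟧ (s.⟦ g ⟧ P.∙ r.⟦ x ⟧))))
            })
          (λ e g → average-cong λ x → e (s.⟦ g ⟧ P.∙ r.⟦ x ⟧))
          (λ φ ψ g → K.trans
            (K.*-congˡ (∑-distrib-+ {size} (F φ g ∘ elem) (F ψ g ∘ elem)))
            (K.distribˡ _ _ _))
          (λ r ψ g → K.trans
            (K.*-congˡ (K.sym (*-distribˡ-sum {size} r (F ψ g ∘ elem))))
            (x∙yz≈y∙xz _ _ _))
          where
            open CommSemigroup K.*-commutativeSemigroup using (x∙yz≈y∙xz)
            open import Algebra.Properties.Semiring.Sum K.semiring using (*-distribˡ-sum)

  open ClassFunctions public

  module MatrixGroups where
    open FiniteField 𝔽 using () renaming (finite to 𝔽-finite)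
    open CommutativeRing (FiniteField.commutativeRing 𝔽) hiding (zero)
    open import Algebra.Properties.Semiring.Sum semiring
      using (sum; sum-cong-≋; sum-replicate-zero; ∑-comm; *-distribˡ-sum; *-distribʳ-sum; ∑-permute)
    open FiniteSum +-commutativeMonoid using (∑-single)
    open SetoidReasoning setoid
    open Finite 𝔽-finite using (_≟_)

    Mat : ℕ → Set q
    Mat n = Fin n → Fin n → Carrier

    matrixSetoid : ℕ → Setoid q ℓq
    matrixSetoid n = vectorSetoid (vectorSetoid setoid n) n

    infix 4 _≋_
    _≋_ : Mat n → Mat n → Set ℓq
    A ≋ B = ∀ i j → A i j ≈ B i j

    matrix-finite : ∀ n → Finite (matrixSetoid n)
    matrix-finite n = vector-finite (vector-finite 𝔽-finite n) n

    infixl 7 _⊡_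
    _⊡_ : Mat n → Mat n → Mat n
    (A ⊡ B) i j = sum λ k → A i k * B k j

    𝟙 : Mat n
    𝟙 i j = if does (i Finₚ.≟ j) then 1# else 0#

    𝟙-diag : (i : Fin n) → 𝟙 i i ≈ 1#
    𝟙-diag i with i Finₚ.≟ i
    ... | yes _ = refl
    ... | no ¬p = contradiction ≡.refl ¬p

    𝟙-off : {i j : Fin n} → i ≢ j → 𝟙 i j ≈ 0#
    𝟙-off {i = i} {j} i≢j with i Finₚ.≟ j
    ... | yes p = contradiction p i≢j
    ... | no _  = refl

    private
      Fin-finite : ∀ n → Finite (≡.setoid (Fin n))
      Fin-finite n = record { size = n ; enumeration = record
        { to = id ; from = id ; to-cong = id ; from-cong = id ; inverse = id , id } }

      sum-single : (f : Fin n → Carrier) (i : Fin n) → (∀ j → j ≢ i → f j ≈ 0#) → sum f ≈ f i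
      sum-single {n} f = ∑-single (Fin-finite n) f (λ { ≡.refl → refl })

      zeroˡ′ : ∀ {x y} → x ≈ 0# → x * y ≈ 0#
      zeroˡ′ e = trans (*-congʳ e) (zeroˡ _)

      zeroʳ′ : ∀ {x y} → y ≈ 0# → x * y ≈ 0#
      zeroʳ′ e = trans (*-congˡ e) (zeroʳ _)

    abstract
      ⊡-cong : {A A′ B B′ : Mat n} → A ≋ A′ → B ≋ B′ → A ⊡ B ≋ A′ ⊡ B′
      ⊡-cong {n} e e′ i j = sum-cong-≋ {n} λ k → *-cong (e i k) (e′ k j)

      ⊡-assoc : (A B C : Mat n) → (A ⊡ B) ⊡ C ≋ A ⊡ (B ⊡ C)
      ⊡-assoc {n} A B C i j = begin
        (sum λ k → (sum λ l → A i l * B l k) * C k j)    ≈⟨ sum-cong-≋ {n} (λ k → *-distribʳ-sum {n} (C k j) _) ⟩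
        (sum λ k → sum λ l → (A i l * B l k) * C k j)    ≈⟨ ∑-comm {n} {n} _ ⟩
        (sum λ l → sum λ k → (A i l * B l k) * C k j)    ≈⟨ sum-cong-≋ {n} (λ l → sum-cong-≋ {n} λ k → *-assoc _ _ _) ⟩
        (sum λ l → sum λ k → A i l * (B l k * C k j))    ≈⟨ sum-cong-≋ {n} (λ l → *-distribˡ-sum {n} (A i l) _) ⟨
        (sum λ l → A i l * sum λ k → B l k * C k j)      ∎

      ⊡-identityˡ : (A : Mat n) → 𝟙 ⊡ A ≋ A
      ⊡-identityˡ A i j = trans
        (sum-single _ i λ k k≢i → zeroˡ′ (𝟙-off (k≢i ∘ ≡.sym)))
        (trans (*-congʳ (𝟙-diag i)) (*-identityˡ _))

      ⊡-identityʳ : (A : Mat n) → A ⊡ 𝟙 ≋ A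
      ⊡-identityʳ A i j = trans
        (sum-single _ j λ k k≢j → zeroʳ′ (𝟙-off k≢j))
        (trans (*-congˡ (𝟙-diag j)) (*-identityʳ _))

    matrixMonoid : ℕ → Monoid q ℓq
    matrixMonoid n = record
      { Carrier  = Mat n
      ; _≈_      = _≋_
      ; _∙_      = _⊡_
      ; ε        = 𝟙
      ; isMonoid = record
        { isSemigroup = record
          { isMagma = record
            { isEquivalence = Setoid.isEquivalence (matrixSetoid n)
            ; ∙-cong = ⊡-cong
            }
          ; assoc = ⊡-assoc
          }
        ; identity = ⊡-identityˡ , ⊡-identityʳ
        }
      }

    GL : ℕ → Group (q ⊔ ℓq) ℓq
    GL n = units (matrixMonoid n)

    GL-finite : ∀ n → Finite (Group.setoid (GL n))
    GL-finite n = units-finite (matrixMonoid n) (matrix-finite n)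

    -- (A - 1)ᵢⱼ ≠ 0 only if i ◁ j.
    module _ (J : Pattern n) where
      open Pattern J

      HasPattern : Mat n → Set ℓq
      HasPattern A = ∀ i j → ¬ (i ◁ j) → A i j ≈ 𝟙 i j

      abstract
        ∙-closed : {A B : Mat n} → HasPattern A → HasPattern B → HasPattern (A ⊡ B)
        ∙-closed {A} {B} α β i j i⋪j = trans (sum-cong-≋ {n} term) (⊡-identityˡ 𝟙 i j)
          where
            term : ∀ k → A i k * B k j ≈ 𝟙 i k * 𝟙 k j
            term k with i ◁? k | k ◁? j
            ... | yes p | yes q = contradiction (◁-trans p q) i⋪j
            ... | no ¬p | no ¬q = *-cong (α i k ¬p) (β k j ¬q)
            ... | yes p | no ¬q = trans (zeroʳ′ (trans (β k j ¬q) k≉j)) (sym (zeroʳ′ k≉j))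
              where
                k≉j : 𝟙 k j ≈ 0#
                k≉j = 𝟙-off {i = k} {j} λ { ≡.refl → i⋪j p }
            ... | no ¬p | yes q = trans (zeroˡ′ (trans (α i k ¬p) i≉k)) (sym (zeroˡ′ i≉k))
              where
                i≉k : 𝟙 i k ≈ 0#
                i≉k = 𝟙-off {i = i} {k} λ { ≡.refl → i⋪j q }

        ⁻¹-closed : {A B : Mat n} → A ⊡ B ≋ 𝟙 → HasPattern A → HasPattern B
        ⁻¹-closed {A} {B} AB≋𝟙 α i = go i (FinInd.>-wellFounded i)
          where
            go : ∀ i → Acc Fin._>_ i → ∀ j → ¬ (i ◁ j) → B i j ≈ 𝟙 i j
            go i (acc rec) j i⋪j = begin
              B i j        ≈⟨ ⊡-identityˡ B i j ⟨
              (𝟙 ⊡ B) i j  ≈⟨ sum-cong-≋ {n} term ⟨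
              (A ⊡ B) i j  ≈⟨ AB≋𝟙 i j ⟩
              𝟙 i j        ∎
              where
                term : ∀ k → A i k * B k j ≈ 𝟙 i k * B k j
                term k with i ◁? k
                ... | no ¬p = *-congʳ (α i k ¬p)
                ... | yes p = trans
                  (zeroʳ′ (trans (go k (rec (◁⇒< p)) j (λ q → i⋪j (◁-trans p q)))
                                 (𝟙-off {i = k} {j} λ { ≡.refl → i⋪j p })))
                  (sym (zeroˡ′ (𝟙-off (◁⇒≢ p))))

      patternSubgroup : DecSubgroup (GL n) ℓq
      patternSubgroup = record
        { _∈        = λ x → HasPattern (proj₁ x)
        ; _∈?       = λ x → Finₚ.all? λ i → Finₚ.all? λ j → ¬? (i ◁? j) →-dec (proj₁ x i j ≟ 𝟙 i j)
        ; ∈-resp-≈  = λ e α i j i⋪j → trans (sym (e i j)) (α i j i⋪j)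
        ; ∙-closed  = ∙-closed
        ; ε-closed  = λ i j _ → refl
        ; ⁻¹-closed = λ { {_ , _ , _ , r} → ⁻¹-closed r }
        }

      patternGroup : Group (q ⊔ ℓq) ℓq
      patternGroup = DecSubgroup.group patternSubgroup

      patternGroup-finite : Finite (Group.setoid patternGroup)
      patternGroup-finite = DecSubgroup.finite patternSubgroup (GL-finite n)

    inclusion : (J J′ : Pattern n) → (∀ {i j} → Pattern._◁_ J i j → Pattern._◁_ J′ i j) →
                Hom (patternGroup J) (patternGroup J′)
    inclusion J J′ sub = record
      { ⟦_⟧ = λ (x , α) → x , λ i j i⋪j → α i j (i⋪j ∘ sub)
      ; ⟦⟧-cong = id ; homo = λ _ _ _ _ → refl }

    UT : ℕ → Group (q ⊔ ℓq) ℓq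
    UT n = patternGroup (upper n)

    UT-finite : ∀ n → Finite (Group.setoid (UT n))
    UT-finite n = patternGroup-finite (upper n)

    UL UR UP : Subset n → Group (q ⊔ ℓq) ℓq
    UL I = patternGroup (ul I)
    UR I = patternGroup (ur I)
    UP I = patternGroup (up I)

    UR-finite : (I : Subset n) → Finite (Group.setoid (UR I))
    UR-finite I = patternGroup-finite (ur I)

    UP⊆UT : (I : Subset n) → Hom (UP I) (UT n)
    UP⊆UT I = inclusion (up I) (upper _) proj₁

    UL⊆UP : (I : Subset n) → Hom (UL I) (UP I)
    UL⊆UP I = inclusion (ul I) (up I) λ (i<j , s) → i<j , λ (i∉ , j∈) → [ (λ (i∈ , _) → i∉ i∈) , (λ (_ , j∉) → j∉ j∈) ] s

    UR⊆UP : (I : Subset n) → Hom (UR I) (UP I)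
    UR⊆UP I = inclusion (ur I) (up I) λ (i<j , (i∈ , _)) → i<j , λ (i∉ , _) → i∉ i∈

    infix 8 _†
    _† : Mat n → Mat n
    (A †) r s = A (opposite s) (opposite r)

    abstract
      †-cong : {A B : Mat n} → A ≋ B → A † ≋ B †
      †-cong e r s = e _ _

      †-anti : (A B : Mat n) → (A ⊡ B) † ≋ B † ⊡ A †
      †-anti {n} A B r s = trans
        (∑-permute {n} {n} _ (reverse {n}))
        (sum-cong-≋ {n} λ k → *-comm _ _)

      †-𝟙 : 𝟙 {n} † ≋ 𝟙
      †-𝟙 r s with r Finₚ.≟ s
      ... | yes ≡.refl = 𝟙-diag (opposite r)
      ... | no r≢s = 𝟙-off λ e → r≢s (≡.trans (≡.sym (Finₚ.opposite-involutive r))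
                       (≡.trans (≡.cong opposite (≡.sym e)) (Finₚ.opposite-involutive s)))

    _†-GL : Group.Carrier (GL n) → Group.Carrier (GL n)
    (x , y , l , r) †-GL = x † , y †
      , (λ i j → trans (sym (†-anti x y i j)) (trans (†-cong r i j) (†-𝟙 i j)))
      , (λ i j → trans (sym (†-anti y x i j)) (trans (†-cong l i j) (†-𝟙 i j)))

    _†-UT : Group.Carrier (UT n) → Group.Carrier (UT n)
    (x , α) †-UT = x †-GL , λ r s r≮s → trans
      (α (opposite s) (opposite r) (r≮s ∘ opposite-cancel-<)) (†-𝟙 r s)

    private
      apart : (I : Subset n) {i j : Fin n} → ¬ SameSide I i j → i ≢ j
      apart I ¬s ≡.refl = ¬s (SameSide-refl I _)

      sum-restrict : (I : Subset n) (f : Fin n → Carrier) → (∀ i → i ∉ I → f i ≈ 0#) →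
                     sum f ≈ sum (f ∘ cano⁻¹ I)
      sum-restrict []            f e = refl
      sum-restrict (inside  ∷ I) f e = +-congˡ (sum-restrict I (f ∘ suc) (λ i i∉ → e (suc i) (i∉ ∘ drop-there)))
      sum-restrict (outside ∷ I) f e = trans
        (+-cong (e zero λ ()) (sum-restrict I (f ∘ suc) (λ i i∉ → e (suc i) (i∉ ∘ drop-there))))
        (+-identityˡ _)

    BlockDiagonal : Subset n → Mat n → Set ℓq
    BlockDiagonal I A = ∀ i j → ¬ SameSide I i j → A i j ≈ 0#

    -- The I × I block, relabelled by [∣ I ∣].
    block : (I : Subset n) → Mat n → Mat ∣ I ∣
    block I A a b = A (cano⁻¹ I a) (cano⁻¹ I b)

    abstract
      block-⊡ : (I : Subset n) {A B : Mat n} → BlockDiagonal I A → block I (A ⊡ B) ≋ block I A ⊡ block I B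
      block-⊡ I α a b = sum-restrict I _ λ k k∉I → zeroˡ′ (α (cano⁻¹ I a) k
        [ (λ (_ , k∈I) → k∉I k∈I) , (λ (a∉I , _) → a∉I (cano⁻¹∈ I a)) ])

      block-𝟙 : (I : Subset n) → block I 𝟙 ≋ 𝟙
      block-𝟙 I a b with a Finₚ.≟ b
      ... | yes ≡.refl = 𝟙-diag (cano⁻¹ I a)
      ... | no a≢b     = 𝟙-off (a≢b ∘ cano⁻¹-injective I)

      BlockDiagonal-∁ : (I : Subset n) {A : Mat n} → BlockDiagonal I A → BlockDiagonal (∁ I) A
      BlockDiagonal-∁ I α i j ¬s = α i j (¬s ∘ SameSide-∁ I)

      BlockDiagonal-⊡ : (I : Subset n) {A B : Mat n} → BlockDiagonal I A → BlockDiagonal I B →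
                        BlockDiagonal I (A ⊡ B)
      BlockDiagonal-⊡ {n} I {A} {B} α β i j ¬s = trans (sum-cong-≋ {n} term) (sum-replicate-zero n)
        where
          term : ∀ k → A i k * B k j ≈ 0#
          term k with sameSide? I i k
          ... | no ¬ik = zeroˡ′ (α i k ¬ik)
          ... | yes ik = zeroʳ′ (β k j (¬s ∘ SameSide-trans I ik))

      BlockDiagonal-𝟙 : (I : Subset n) → BlockDiagonal I 𝟙
      BlockDiagonal-𝟙 I i j ¬s = 𝟙-off (apart I ¬s)

      BlockDiagonal-≋ : (I : Subset n) {A B : Mat n} → BlockDiagonal I A → BlockDiagonal I B →
                        block I A ≋ block I B → block (∁ I) A ≋ block (∁ I) B → A ≋ B
      BlockDiagonal-≋ I {A} {B} α β e e∁ i j with sameSide? I i j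
      ... | no ¬s = trans (α i j ¬s) (sym (β i j ¬s))
      ... | yes (inj₁ (p , q)) = ≡.subst₂ (λ i j → A i j ≈ B i j)
              (cano⁻¹-cano I i p) (cano⁻¹-cano I j q) (e _ _)
      ... | yes (inj₂ (p , q)) = ≡.subst₂ (λ i j → A i j ≈ B i j)
              (cano⁻¹-cano (∁ I) i (x∉p⇒x∈∁p p)) (cano⁻¹-cano (∁ I) j (x∉p⇒x∈∁p q)) (e∁ _ _)

      UL-BlockDiagonal : (I : Subset n) {A : Mat n} → HasPattern (ul I) A → BlockDiagonal I A
      UL-BlockDiagonal I α i j ¬s = trans (α i j (¬s ∘ proj₂)) (𝟙-off (apart I ¬s))

    UL→UT : (I : Subset n) → Hom (UL I) (UT ∣ I ∣)
    UL→UT I = record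
      { ⟦_⟧ = λ ((x , y , l , r) , α) →
          let α⁻¹ = DecSubgroup.⁻¹-closed (patternSubgroup (ul I)) {x , y , l , r} α in
          ( block I x , block I y
          , (λ a b → trans (sym (block-⊡ I {y} {x} (UL-BlockDiagonal I α⁻¹) a b)) (trans (l _ _) (block-𝟙 I a b)))
          , (λ a b → trans (sym (block-⊡ I {x} {y} (UL-BlockDiagonal I α) a b)) (trans (r _ _) (block-𝟙 I a b))))
          , λ a b a≮b → trans (α _ _ (a≮b ∘ cano⁻¹-cancel-< I ∘ proj₁)) (block-𝟙 I a b)
      ; ⟦⟧-cong = λ e a b → e _ _
      ; homo = λ ((x , _) , α) ((y , _) , β) → block-⊡ I {x} {y} (UL-BlockDiagonal I α)
      }

    UL→UT-∁ : (I : Subset n) → Hom (UL I) (UT ∣ ∁ I ∣)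
    UL→UT-∁ I = UL→UT (∁ I) ∘ₕ inclusion (ul I) (ul (∁ I)) (λ (p , s) → p , SameSide-∁ I s)

    -- The block diagonal matrix with I × I block A and Iᶜ × Iᶜ block B.
    assemble : (I : Subset n) → Mat ∣ I ∣ → Mat ∣ ∁ I ∣ → Mat n
    assemble I A B i j with sameSide? I i j
    ... | yes (inj₁ (p , q)) = A (cano I i p) (cano I j q)
    ... | yes (inj₂ (p , q)) = B (cano (∁ I) i (x∉p⇒x∈∁p p)) (cano (∁ I) j (x∉p⇒x∈∁p q))
    ... | no _               = 0#

    assemble-BlockDiagonal : (I : Subset n) (A : Mat ∣ I ∣) (B : Mat ∣ ∁ I ∣) → BlockDiagonal I (assemble I A B)
    assemble-BlockDiagonal I A B i j ¬s with sameSide? I i j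
    ... | yes s = contradiction s ¬s
    ... | no _  = refl

    block-assemble : (I : Subset n) (A : Mat ∣ I ∣) (B : Mat ∣ ∁ I ∣) → block I (assemble I A B) ≋ A
    block-assemble I A B a b with sameSide? I (cano⁻¹ I a) (cano⁻¹ I b)
    ... | yes (inj₁ (p , q)) = reflexive (≡.cong₂ A (cano-cano⁻¹ I a p) (cano-cano⁻¹ I b q))
    ... | yes (inj₂ (p , q)) = contradiction (cano⁻¹∈ I a) p
    ... | no ¬s = contradiction (inj₁ (cano⁻¹∈ I a , cano⁻¹∈ I b)) ¬s

    block-∁-assemble : (I : Subset n) (A : Mat ∣ I ∣) (B : Mat ∣ ∁ I ∣) → block (∁ I) (assemble I A B) ≋ B
    block-∁-assemble I A B a b with sameSide? I (cano⁻¹ (∁ I) a) (cano⁻¹ (∁ I) b)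
    ... | yes (inj₁ (p , q)) = contradiction p (x∈∁p⇒x∉p (cano⁻¹∈ (∁ I) a))
    ... | yes (inj₂ (p , q)) = reflexive (≡.cong₂ B (cano-cano⁻¹ (∁ I) a _) (cano-cano⁻¹ (∁ I) b _))
    ... | no ¬s = contradiction (inj₂ (x∈∁p⇒x∉p (cano⁻¹∈ (∁ I) a) , x∈∁p⇒x∉p (cano⁻¹∈ (∁ I) b))) ¬s

    assemble-unique : (I : Subset n) {A : Mat ∣ I ∣} {B : Mat ∣ ∁ I ∣} {X : Mat n} → BlockDiagonal I X →
                      block I X ≋ A → block (∁ I) X ≋ B → X ≋ assemble I A B
    assemble-unique I {A} {B} χ e e∁ = BlockDiagonal-≋ I χ (assemble-BlockDiagonal I A B)
      (λ a b → trans (e a b) (sym (block-assemble I A B a b)))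
      (λ a b → trans (e∁ a b) (sym (block-∁-assemble I A B a b)))

    assemble-⊡ : (I : Subset n) (A A′ : Mat ∣ I ∣) (B B′ : Mat ∣ ∁ I ∣) →
                 assemble I A B ⊡ assemble I A′ B′ ≋ assemble I (A ⊡ A′) (B ⊡ B′)
    assemble-⊡ I A A′ B B′ = assemble-unique I (BlockDiagonal-⊡ I {X} {X′} α α′)
      (λ a b → trans (block-⊡ I {X} {X′} α a b) (⊡-cong (block-assemble I A B) (block-assemble I A′ B′) a b))
      (λ a b → trans (block-⊡ (∁ I) {X} {X′} (BlockDiagonal-∁ I {X} α) a b)
                     (⊡-cong (block-∁-assemble I A B) (block-∁-assemble I A′ B′) a b))
      where
        X  = assemble I A B
        X′ = assemble I A′ B′
        α  = assemble-BlockDiagonal I A B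
        α′ = assemble-BlockDiagonal I A′ B′

    assemble-cong : (I : Subset n) {A A′ : Mat ∣ I ∣} {B B′ : Mat ∣ ∁ I ∣} →
                    A ≋ A′ → B ≋ B′ → assemble I A B ≋ assemble I A′ B′
    assemble-cong I {A} {A′} {B} {B′} e e′ = assemble-unique I (assemble-BlockDiagonal I A B)
      (λ a b → trans (block-assemble I A B a b) (e a b))
      (λ a b → trans (block-∁-assemble I A B a b) (e′ a b))

    assemble-𝟙 : (I : Subset n) → assemble I 𝟙 𝟙 ≋ 𝟙
    assemble-𝟙 I i j = sym (assemble-unique I (BlockDiagonal-𝟙 I) (block-𝟙 I) (block-𝟙 (∁ I)) i j)

    UL→UT×UT : (I : Subset n) → Hom (UL I) (DirectProduct.group (UT ∣ I ∣) (UT ∣ ∁ I ∣))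
    UL→UT×UT I = record
      { ⟦_⟧     = λ g → Hom.⟦ UL→UT I ⟧ g , Hom.⟦ UL→UT-∁ I ⟧ g
      ; ⟦⟧-cong = λ {g} {h} e → Hom.⟦⟧-cong (UL→UT I) {g} {h} e , Hom.⟦⟧-cong (UL→UT-∁ I) {g} {h} e
      ; homo    = λ g h → Hom.homo (UL→UT I) g h , Hom.homo (UL→UT-∁ I) g h
      }

    UT×UT→UL : (I : Subset n) → Hom (DirectProduct.group (UT ∣ I ∣) (UT ∣ ∁ I ∣)) (UL I)
    UT×UT→UL I = record
      { ⟦_⟧ = λ (((u , u′ , l , r) , α) , ((v , v′ , l′ , r′) , β)) →
          ( assemble I u v , assemble I u′ v′
          , (λ i j → trans (assemble-⊡ I u′ u v′ v i j) (trans (assemble-cong I l l′ i j) (assemble-𝟙 I i j)))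
          , (λ i j → trans (assemble-⊡ I u u′ v v′ i j) (trans (assemble-cong I r r′ i j) (assemble-𝟙 I i j))))
          , pattern-closed u v α β
      ; ⟦⟧-cong = λ (e , e′) → assemble-cong I e e′
      ; homo = λ (((u , _) , _) , ((v , _) , _)) (((u′ , _) , _) , ((v′ , _) , _)) i j →
          sym (assemble-⊡ I u u′ v v′ i j)
      }
      where
        pattern-closed : ∀ u v → HasPattern (upper _) u → HasPattern (upper _) v → HasPattern (ul I) (assemble I u v)
        pattern-closed u v α β i j i⋪j with sameSide? I i j
        ... | no ¬s = sym (BlockDiagonal-𝟙 I i j ¬s)
        ... | yes (inj₁ (p , q)) = trans
          (α _ _ λ lt → i⋪j (≡.subst₂ Fin._<_ (cano⁻¹-cano I i p) (cano⁻¹-cano I j q) (cano⁻¹-mono-< I lt) , inj₁ (p , q)))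
          (trans (sym (block-𝟙 I _ _)) (reflexive (≡.cong₂ 𝟙 (cano⁻¹-cano I i p) (cano⁻¹-cano I j q))))
        ... | yes (inj₂ (p , q)) = trans
          (β _ _ λ lt → i⋪j (≡.subst₂ Fin._<_ (cano⁻¹-cano (∁ I) i _) (cano⁻¹-cano (∁ I) j _) (cano⁻¹-mono-< (∁ I) lt) , inj₂ (p , q)))
          (trans (sym (block-𝟙 (∁ I) _ _)) (reflexive (≡.cong₂ 𝟙 (cano⁻¹-cano (∁ I) i _) (cano⁻¹-cano (∁ I) j _))))

    UL→UT×UT→UL : (I : Subset n) (g : Group.Carrier (UL I)) →
                  Group._≈_ (UL I) (Hom.⟦ UT×UT→UL I ⟧ (Hom.⟦ UL→UT×UT I ⟧ g)) g
    UL→UT×UT→UL I ((x , _) , α) i j = sym (assemble-unique I {block I x} {block (∁ I) x} {x}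
      (UL-BlockDiagonal I α) (λ _ _ → refl) (λ _ _ → refl) i j)

    UT×UT→UL→UT×UT : (I : Subset n) (g : Group.Carrier (DirectProduct.group (UT ∣ I ∣) (UT ∣ ∁ I ∣))) →
                     Group._≈_ (DirectProduct.group (UT ∣ I ∣) (UT ∣ ∁ I ∣))
                       (Hom.⟦ UL→UT×UT I ⟧ (Hom.⟦ UT×UT→UL I ⟧ g)) g
    UT×UT→UL→UT×UT I (((u , _) , _) , ((v , _) , _)) = block-assemble I u v , block-∁-assemble I u v

    diagonalPart : Subset n → Mat n → Mat n
    diagonalPart I A i j with sameSide? I i j
    ... | yes _ = A i j
    ... | no _  = 0#

    dp-same : (I : Subset n) (A : Mat n) {i j : Fin n} → SameSide I i j → diagonalPart I A i j ≈ A i j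
    dp-same I A {i} {j} s with sameSide? I i j
    ... | yes _ = refl
    ... | no ¬s = contradiction s ¬s

    dp-BlockDiagonal : (I : Subset n) (A : Mat n) → BlockDiagonal I (diagonalPart I A)
    dp-BlockDiagonal I A i j ¬s with sameSide? I i j
    ... | yes s = contradiction s ¬s
    ... | no _  = refl

    UP-zero : (I : Subset n) {A : Mat n} → HasPattern (up I) A → ∀ {i j} → i ∉ I → j ∈ I → A i j ≈ 0#
    UP-zero I α {i} {j} i∉ j∈ = trans (α i j λ (_ , f) → f (i∉ , j∈)) (𝟙-off {i = i} {j} λ { ≡.refl → i∉ j∈ })

    dp-⊡ : (I : Subset n) {A B : Mat n} → HasPattern (up I) A → HasPattern (up I) B →
           diagonalPart I (A ⊡ B) ≋ diagonalPart I A ⊡ diagonalPart I B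
    dp-⊡ {n} I {A} {B} α β i j = split (sameSide? I i j)
      where
        term : SameSide I i j → ∀ k → A i k * B k j ≈ diagonalPart I A i k * diagonalPart I B k j
        term s k with sameSide? I i k
        ... | yes ik = *-congˡ (sym (dp-same I B (SameSide-trans I (SameSide-sym I ik) s)))
        ... | no ¬ik = trans (vanish s (k ∈? I)) (sym (zeroˡ _))
          where
            vanish : SameSide I i j → Dec (k ∈ I) → A i k * B k j ≈ 0#
            vanish (inj₁ (p , q)) (yes r) = contradiction (inj₁ (p , r)) ¬ik
            vanish (inj₁ (p , q)) (no ¬r) = zeroʳ′ (UP-zero I {B} β ¬r q)
            vanish (inj₂ (p , q)) (yes r) = zeroˡ′ (UP-zero I {A} α p r)
            vanish (inj₂ (p , q)) (no ¬r) = contradiction (inj₂ (p , ¬r)) ¬ik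

        split : Dec (SameSide I i j) → diagonalPart I (A ⊡ B) i j ≈ (diagonalPart I A ⊡ diagonalPart I B) i j
        split (yes s) = trans (dp-same I (A ⊡ B) s) (sum-cong-≋ {n} (term s))
        split (no ¬s) = trans (dp-BlockDiagonal I (A ⊡ B) i j ¬s)
          (sym (BlockDiagonal-⊡ I (dp-BlockDiagonal I A) (dp-BlockDiagonal I B) i j ¬s))

    dp-𝟙 : (I : Subset n) → diagonalPart I 𝟙 ≋ 𝟙
    dp-𝟙 I i j with sameSide? I i j
    ... | yes _ = refl
    ... | no ¬s = sym (BlockDiagonal-𝟙 I i j ¬s)

    dp-cong : (I : Subset n) {A B : Mat n} → A ≋ B → diagonalPart I A ≋ diagonalPart I B
    dp-cong I e i j with sameSide? I i j
    ... | yes _ = e i j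
    ... | no _  = refl

    -- lr ↦ l: right multiplication by UR I only changes the entries in I × Iᶜ.
    UP→UL : (I : Subset n) → Hom (UP I) (UL I)
    UP→UL I = record
      { ⟦_⟧ = λ ((x , y , l , r) , α) →
          let α⁻¹ = DecSubgroup.⁻¹-closed (patternSubgroup (up I)) {x , y , l , r} α in
          ( diagonalPart I x , diagonalPart I y
          , (λ i j → trans (sym (dp-⊡ I {y} {x} α⁻¹ α i j)) (trans (dp-cong I l i j) (dp-𝟙 I i j)))
          , (λ i j → trans (sym (dp-⊡ I {x} {y} α α⁻¹ i j)) (trans (dp-cong I r i j) (dp-𝟙 I i j))))
          , pattern-closed x α
      ; ⟦⟧-cong = dp-cong I
      ; homo = λ ((x , _) , α) ((y , _) , β) → dp-⊡ I {x} {y} α β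
      }
      where
        pattern-closed : ∀ x → HasPattern (up I) x → HasPattern (ul I) (diagonalPart I x)
        pattern-closed x α i j i⋪j with sameSide? I i j
        ... | no ¬s = sym (BlockDiagonal-𝟙 I i j ¬s)
        ... | yes s = α i j (λ (i<j , _) → i⋪j (i<j , s))

    UR⇒kernel : (I : Subset n) (x : Group.Carrier (UP I)) → HasPattern (ur I) (proj₁ (proj₁ x)) →
                Group._≈_ (UL I) (Hom.⟦ UP→UL I ⟧ x) (Group.ε (UL I))
    UR⇒kernel I x α i j with sameSide? I i j
    ... | no ¬s = sym (BlockDiagonal-𝟙 I i j ¬s)
    ... | yes s = α i j λ (_ , (i∈ , j∉)) → [ (λ (_ , j∈) → j∉ j∈) , (λ (i∉ , _) → i∉ i∈) ] s

    kernel⇒UR : (I : Subset n) (x : Group.Carrier (UP I)) →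
                Group._≈_ (UL I) (Hom.⟦ UP→UL I ⟧ x) (Group.ε (UL I)) → HasPattern (ur I) (proj₁ (proj₁ x))
    kernel⇒UR I ((x , _) , α) e i j i⋪j with sameSide? I i j | e i j
    ... | yes s | e′ = e′
    ... | no ¬s | e′ = α i j λ (i<j , f) → i⋪j (i<j , side f)
      where
        side : ¬ (i ∉ I × j ∈ I) → i ∈ I × j ∉ I
        side f with i ∈? I | j ∈? I
        ... | yes p | yes q = contradiction (inj₁ (p , q)) ¬s
        ... | yes p | no ¬q = p , ¬q
        ... | no ¬p | yes q = contradiction (¬p , q) f
        ... | no ¬p | no ¬q = contradiction (inj₂ (¬p , ¬q)) ¬s

    UP→UL-UL⊆UP : (I : Subset n) (g : Group.Carrier (UL I)) →
                  Group._≈_ (UL I) (Hom.⟦ UP→UL I ⟧ (Hom.⟦ UL⊆UP I ⟧ g)) g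
    UP→UL-UL⊆UP I ((x , _) , α) i j with sameSide? I i j
    ... | yes s = refl
    ... | no ¬s = sym (UL-BlockDiagonal I α i j ¬s)

  open MatrixGroups public

  cf-UT : ℕ → VS (q ⊔ ℓq ⊔ k ⊔ ℓk) (q ⊔ ℓq ⊔ ℓk)
  cf-UT n = cf (UT n)

  cf-GL : ℕ → VS (q ⊔ ℓq ⊔ k ⊔ ℓk) (q ⊔ ℓq ⊔ ℓk)
  cf-GL n = cf (GL n)

  cf-UT• : VS (q ⊔ ℓq ⊔ k ⊔ ℓk) (q ⊔ ℓq ⊔ ℓk)
  cf-UT• = ⨁ cf-UT

  cf-GL• : VS (q ⊔ ℓq ⊔ k ⊔ ℓk) (q ⊔ ℓq ⊔ ℓk)
  cf-GL• = ⨁ cf-GL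

  module _ {n : ℕ} (I : Subset n) where
    UP≅UL⋉UR : SemidirectProduct (UL I) (UR I) (UP I)
    UP≅UL⋉UR = record
      { projection = UP→UL I
      ; inclusionᴸ = UL⊆UP I
      ; inclusionᵁ = UR⊆UP I
      ; splits     = UP→UL-UL⊆UP I
      ; injective  = id
      ; π-U        = λ x → UR⇒kernel I (Hom.⟦ UR⊆UP I ⟧ x) (proj₂ x)
      ; kernel     = λ g e → (proj₁ g , kernel⇒UR I g e) , λ _ _ → K𝔽.refl
      }
      where module K𝔽 = CommutativeRing (FiniteField.commutativeRing 𝔽)

    Res-UP : LinearMap (cf (UT n)) (cf (UP I))
    Res-UP = pullback (UP⊆UT I)

    Def-UP : LinearMap (cf (UP I)) (cf (UL I))
    Def-UP = Def UP≅UL⋉UR (UR-finite I)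

    -- Mutually inverse, by cf-split-join, cf-join-split, UL→UT×UT→UL and UT×UT→UL→UT×UT.
    st : LinearMap (cf (UL I)) (cf-UT ∣ I ∣ ⊗ cf-UT ∣ ∁ I ∣)
    st = FiniteGroup.cf-split (UT ∣ I ∣) (UT-finite ∣ I ∣) (UL→UT×UT I) (UT×UT→UL I)

    st⁻¹ : LinearMap (cf-UT ∣ I ∣ ⊗ cf-UT ∣ ∁ I ∣) (cf (UL I))
    st⁻¹ = FiniteGroup.cf-join (UT ∣ I ∣) (UT-finite ∣ I ∣) (UL→UT×UT I) (UT×UT→UL I)

  module _ (n : ℕ) (i : Fin (suc n)) where
    UT⊆UP : Hom (UT n) (UP (initial n i))
    UT⊆UP = inclusion (upper n) (up (initial n i)) λ r<s → r<s , λ (r∉ , s∈) →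
      r∉ (∈-initial⁺ i (ℕₚ.<-trans r<s (∈-initial⁻ i s∈)))

    Inf-UT : LinearMap (cf (UL (initial n i))) (cf (UT n))
    Inf-UT = pullback UT⊆UP ∘ₗ Inf (UP≅UL⋉UR (initial n i))

    μ-component : LinearMap (cf-UT ∣ initial n i ∣ ⊗ cf-UT ∣ ∁ (initial n i) ∣) (cf-UT n)
    μ-component = Inf-UT ∘ₗ st⁻¹ (initial n i)

  μ : LinearMap (cf-UT• ⊗ cf-UT•) cf-UT•
  μ = gradedProduct cf-UT (λ n i → ∣ initial n i ∣) (λ n i → ∣ ∁ (initial n i) ∣)
        (λ n i → ∣p∣+∣∁p∣≡n (initial n i)) μ-component

  Δ-component : ∀ {n} → Subset n → LinearMap (cf-UT n) (cf-UT• ⊗ cf-UT•)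
  Δ-component I = (ι cf-UT ∣ I ∣ ⊗₁ ι cf-UT ∣ ∁ I ∣) ∘ₗ st I ∘ₗ Def-UP I ∘ₗ Res-UP I

  Δ : LinearMap cf-UT• (cf-UT• ⊗ cf-UT•)
  Δ = ⨁-rec λ n → sumₗ (List.map Δ-component (subsets n))

  𝔡ₙ : ∀ n → LinearMap (cf-UT n) (cf-UT n)
  𝔡ₙ n = linearMap
    (λ ψ → record
      { fun      = λ g → fun ψ (g †-UT)
      ; fun-cong = λ {g} {h} e → fun-cong ψ {g †-UT} {h †-UT} (λ r s → e (opposite s) (opposite r))
      ; fun-conj = λ h g → K.trans
          (fun-cong ψ {(h UT.∙ g UT.∙ h UT.⁻¹) †-UT}
                      {(h UT.⁻¹) †-UT UT.∙ g †-UT UT.∙ ((h UT.⁻¹) †-UT) UT.⁻¹} (anti h g))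
          (fun-conj ψ ((h UT.⁻¹) †-UT) (g †-UT))
      })
    (λ e g → e (g †-UT)) (λ _ _ _ → K.refl) (λ _ _ _ → K.refl)
    where
      module UT = Group (UT n)
      module M = Monoid (matrixMonoid n)
      anti : ∀ h g → (h UT.∙ g UT.∙ h UT.⁻¹) †-UT UT.≈ (h UT.⁻¹) †-UT UT.∙ g †-UT UT.∙ ((h UT.⁻¹) †-UT) UT.⁻¹
      anti ((h , h′ , _) , _) ((g , _) , _) = M.trans
        {((h ⊡ g) ⊡ h′) †} {h′ † ⊡ (h ⊡ g) †} {(h′ † ⊡ g †) ⊡ h †}
        (†-anti (h ⊡ g) h′)
        (M.trans {h′ † ⊡ (h ⊡ g) †} {h′ † ⊡ (g † ⊡ h †)} {(h′ † ⊡ g †) ⊡ h †}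
          (M.∙-congˡ {h′ †} {(h ⊡ g) †} {g † ⊡ h †} (†-anti h g))
          (M.sym {(h′ † ⊡ g †) ⊡ h †} {h′ † ⊡ (g † ⊡ h †)} (⊡-assoc (h′ †) (g †) (h †))))

  𝔡 : LinearMap cf-UT• cf-UT•
  𝔡 = ⨁-map 𝔡ₙ

  Ind-UT : ∀ n → LinearMap (cf-UT n) (cf-GL n)
  Ind-UT n = FiniteGroup.Ind (GL n) (GL-finite n) (patternSubgroup (upper n))

  Ind-UT• : LinearMap cf-UT• cf-GL•
  Ind-UT• = ⨁-map Ind-UT

{-# OPTIONS --safe #-}

-- Under †, the subset I corresponds to J = w̃(Iᶜ): † carries UL I and UR I to UL J
-- and UR J, and interchanges the two diagonal blocks.  As ψ(gx) = ψ(xg), summing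
-- over x ∈ UR I for ψ ∘ † is summing over UR J for ψ.  The identity for Δ follows
-- because I ↦ J permutes the subsets of [n], the one for μ because it maps [i] to
-- [n - i].
--
-- For induction, Ind (ψ ∘ †) (g) = Ind ψ (g†), so it suffices that every u ∈ UT n
-- is conjugate to u† in GL n (both sides vanish at elements with no conjugate in
-- UT n).  With n = u - 1 nilpotent this asks for an invertible β with β n = n† β.
-- It is built as an orthogonal sum of symmetric pieces: on a complement fV of the
-- part already treated, take k maximal with g = nᵏ f ≠ 0 and an entry gᵢⱼ ≠ 0; the
-- sums ∑ (n†)ᵃ e nᵇ and ∑ nᵃ e′ (n†)ᵇ over a + b = k, with matrix units e and e′,
-- give forms β and γ on fV and its dual such that row i of g is an eigenvector of
-- γβ with eigenvalue gᵢⱼ².  Hence γβ is not nilpotent, and since the matrix ring is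
-- finite some power of γβ is a nonzero idempotent, which splits off a new piece.

module Submission where

open import Algebra.Apartness.Bundles using (HeytingField)
open import Algebra.Bundles using (CommutativeMonoid; CommutativeRing; Group; Ring)
open import Algebra.Module.Bundles using (LeftModule)
import Algebra.Properties.CommutativeMonoid.Sum as CMSum
import Algebra.Properties.CommutativeSemigroup as CommSemigroup
import Algebra.Properties.Semiring.Exp as Exp
import Algebra.Properties.Semiring.Sum as SemiringSum
open import Data.Bool.Base using (not)
open import Data.Fin.Base as Fin using (Fin; toℕ; opposite; inject₁; fromℕ; cast)
open import Data.Fin.Permutation using (Permutation; ↔⇒≡; reverse)
import Data.Fin.Properties as Finₚ
open import Data.Fin.Subset using (Subset; inside; outside; ∣_∣; ∁; _∈_; _∉_)
open import Data.Fin.Subset.Properties using (_∈?_; x∈∁p⇒x∉p; x∉p⇒x∈∁p)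
open import Data.List.Base as List using (List; []; _∷_; _++_; foldr)
import Data.List.Properties as Listₚ
open import Data.Nat.Base as ℕ using (ℕ; zero; suc; NonZero)
open import Data.Nat.Induction using (<-wellFounded)
import Data.Nat.Properties as ℕₚ
open import Data.Product.Base using (∃; ∃-syntax; ∃₂; _×_; _,_; proj₁; proj₂)
open import Data.Sum.Base using (inj₁; inj₂)
open import Data.Vec.Base as Vec using (Vec; []; _∷_; _∷ʳ_; lookup)
import Data.Vec.Properties as Vecₚ
open import Function.Base using (_∘_; id)
open import Function.Bundles using (Inverse)
import Function.Construct.Composition as Comp
import Function.Construct.Symmetry as Symm
open import Induction.WellFounded using (Acc; acc)
open import Level using (Level; _⊔_)
open import Relation.Binary.Bundles using (Setoid)
open import Relation.Binary.PropositionalEquality as ≡ using (_≡_)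
import Relation.Binary.Reasoning.Setoid as SetoidReasoning
open import Relation.Nullary using (¬_; Dec; yes; no; contradiction)
open import Tactic.MonoidSolver using (solve)
open import Defs

private
  variable
    a b p u v ℓ ℓ′ ℓu ℓv ℓp : Level
    m n : ℕ

-- Cardinalities of finite subsets.

module _ {S : Setoid a ℓ} where
  open Setoid S

  -- The additional index `zero` can be sent to the extra element `x`, which keeps the inclusion of
  -- `P` into `Q` injective. This gives the decreasing measure for the enlargement of self-dual
  -- pairs.
  strictSubset-size : {P Q : Carrier → Set p}
    (P-fin : Finite (subsetSetoid S P)) (Q-fin : Finite (subsetSetoid S Q)) →
    (∀ x → P x → Q x) → (∀ {x y} → x ≈ y → P x → P y) →
    ∀ x → Q x → ¬ P x → Finite.size P-fin ℕ.< Finite.size Q-fin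
  strictSubset-size {P = P} {Q} P-fin Q-fin P⊆Q P-resp x qx ¬px = Finₚ.injective⇒≤ {f = f} f-injective
    where
      module P = Finite P-fin
      module Q = Finite Q-fin

      include : ∃ P → ∃ Q
      include (y , py) = y , P⊆Q y py

      f : Fin (suc P.size) → Fin Q.size
      f Fin.zero    = Q.index (x , qx)
      f (Fin.suc i) = Q.index (include (P.elem i))

      index-injective : ∀ u v → Q.index u ≡ Q.index v → proj₁ u ≈ proj₁ v
      index-injective u v e = trans (sym (Q.elem-index u))
        (trans (reflexive (≡.cong (proj₁ ∘ Q.elem) e)) (Q.elem-index v))

      f-injective : ∀ {i j} → f i ≡ f j → i ≡ j
      f-injective {Fin.zero}  {Fin.zero}  e = ≡.refl
      f-injective {Fin.zero}  {Fin.suc j} e = contradiction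
        (P-resp (sym (index-injective (x , qx) (include (P.elem j)) e)) (proj₂ (P.elem j))) ¬px
      f-injective {Fin.suc i} {Fin.zero}  e = contradiction
        (P-resp (index-injective (include (P.elem i)) (x , qx) e) (proj₂ (P.elem i))) ¬px
      f-injective {Fin.suc i} {Fin.suc j} e = ≡.cong Fin.suc (≡.trans (≡.sym (P.index-elem i))
        (≡.trans (P.index-cong (index-injective (include (P.elem i)) (include (P.elem j)) e)) (P.index-elem j)))

-- Self-duality of nilpotent elements

module _ (R : Ring a ℓ) where
  open Ring R
  open import Algebra.Properties.Semiring.Exp semiring using (_^_; ^-homo-*; ^-congˡ)
  open SetoidReasoning setoid

  module _ (finite : Finite setoid) (x : Carrier) where
    open Finite finite

    private
      period : ∃₂ λ m d → x ^ m ≈ x ^ (suc d ℕ.+ m)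
      period with i , j , i<j , e ← Finₚ.pigeonhole {n = suc size} ℕₚ.≤-refl (λ i → index (x ^ toℕ i))
        with d , e′ ← ℕₚ.m≤n⇒∃[o]m+o≡n i<j
        = toℕ i , d , (begin
          x ^ toℕ i                    ≈⟨ elem-index (x ^ toℕ i) ⟨
          elem (index (x ^ toℕ i))     ≡⟨ ≡.cong elem e ⟩
          elem (index (x ^ toℕ j))     ≈⟨ elem-index (x ^ toℕ j) ⟩
          x ^ toℕ j                    ≡⟨ ≡.cong (x ^_) (≡.trans (≡.sym e′) (≡.cong suc (ℕₚ.+-comm (toℕ i) d))) ⟩
          x ^ (suc d ℕ.+ toℕ i)        ∎)

      shift : ∀ m d → x ^ m ≈ x ^ (d ℕ.+ m) → ∀ k s → x ^ (m ℕ.+ s) ≈ x ^ (k ℕ.* d ℕ.+ (m ℕ.+ s))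
      shift m d e zero    s = refl
      shift m d e (suc k) s = begin
        x ^ (m ℕ.+ s)                          ≈⟨ shift m d e k s ⟩
        x ^ (k ℕ.* d ℕ.+ (m ℕ.+ s))            ≈⟨ ^-homo-* x (k ℕ.* d) (m ℕ.+ s) ⟩
        x ^ (k ℕ.* d) * x ^ (m ℕ.+ s)          ≈⟨ *-congˡ (^-homo-* x m s) ⟩
        x ^ (k ℕ.* d) * (x ^ m * x ^ s)        ≈⟨ *-congˡ (*-congʳ e) ⟩
        x ^ (k ℕ.* d) * (x ^ (d ℕ.+ m) * x ^ s) ≈⟨ *-congˡ (^-homo-* x (d ℕ.+ m) s) ⟨
        x ^ (k ℕ.* d) * x ^ (d ℕ.+ m ℕ.+ s)    ≈⟨ ^-homo-* x (k ℕ.* d) (d ℕ.+ m ℕ.+ s) ⟨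
        x ^ (k ℕ.* d ℕ.+ (d ℕ.+ m ℕ.+ s))      ≡⟨ ≡.cong (x ^_) (rearrange (k ℕ.* d)) ⟩
        x ^ (d ℕ.+ k ℕ.* d ℕ.+ (m ℕ.+ s))      ∎
        where
          rearrange : ∀ e → e ℕ.+ (d ℕ.+ m ℕ.+ s) ≡ d ℕ.+ e ℕ.+ (m ℕ.+ s)
          rearrange e = ≡.trans (≡.cong (e ℕ.+_) (ℕₚ.+-assoc d m s))
            (≡.trans (≡.sym (ℕₚ.+-assoc e d (m ℕ.+ s))) (≡.cong (ℕ._+ (m ℕ.+ s)) (ℕₚ.+-comm e d)))

    -- In a finite ring the powers of `x` are eventually periodic. Multiplying by `x` shows that
    -- `x ^ suc k` is idempotent; the sharper form, that it fixes `x ^ k`, is the one that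
    -- `selfDual-^` applies.
    idempotentPower : ∃[ k ] x ^ (suc k ℕ.+ k) ≈ x ^ k
    idempotentPower with m , d , e ← period
      -- With this `k`, `suc k` equals `suc m * suc d`, a multiple of the period `suc d`, while `k`
      -- is at least the preperiod `m`.
      = m ℕ.+ d ℕ.* suc m , (begin
        x ^ (suc (m ℕ.+ d ℕ.* suc m) ℕ.+ (m ℕ.+ d ℕ.* suc m))
          ≡⟨ ≡.cong (λ k → x ^ (k ℕ.+ (m ℕ.+ d ℕ.* suc m))) (ℕₚ.*-comm (suc d) (suc m)) ⟩
        x ^ (suc m ℕ.* suc d ℕ.+ (m ℕ.+ d ℕ.* suc m))
          ≈⟨ shift m (suc d) e (suc m) (d ℕ.* suc m) ⟨
        x ^ (m ℕ.+ d ℕ.* suc m) ∎)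

  record AntiInvolution (_† : Carrier → Carrier) : Set (a ⊔ ℓ) where
    field
      †-cong       : ∀ {x y} → x ≈ y → x † ≈ y †
      †-+          : ∀ x y → (x + y) † ≈ x † + y †
      †-*          : ∀ x y → (x * y) † ≈ y † * x †
      †-1          : 1# † ≈ 1#
      †-involutive : ∀ x → x † † ≈ x

  module SelfDuality {_† : Carrier → Carrier} (†-anti : AntiInvolution _†) (n : Carrier) where
    open AntiInvolution †-anti
    open import Algebra.Properties.Ring R using (-‿distribˡ-*; -‿distribʳ-*; -0#≈0#)
    open import Algebra.Properties.Group +-group using (identityˡ-unique; x∙y⁻¹≈ε⇒x≈y)
    open import Algebra.Properties.CommutativeSemigroup +-commutativeSemigroup using (xy∙z≈xz∙y)

    -- Think of matrices acting on V, with † identifying V with its dual V*.  A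
    -- form is a symmetric bilinear form on V for which n is self-adjoint, a
    -- coform is one on V*, and a self-dual pair restricts to mutually inverse
    -- isomorphisms between the summands γβV and βγV*.
    record Form (β : Carrier) : Set ℓ where
      field
        symmetric  : β † ≈ β
        intertwine : β * n ≈ n † * β

    record Coform (γ : Carrier) : Set ℓ where
      field
        symmetric  : γ † ≈ γ
        intertwine : n * γ ≈ γ * n †

    record SelfDual (β γ : Carrier) : Set ℓ where
      field
        form   : Form β
        coform : Coform γ
        βγβ    : β * (γ * β) ≈ β
        γβγ    : γ * (β * γ) ≈ γ
      module β = Form form
      module γ = Coform coform

    †-0 : 0# † ≈ 0#
    †-0 = identityˡ-unique (0# †) (0# †) (trans (sym (†-+ 0# 0#)) (†-cong (+-identityˡ 0#)))

    selfDual-0 : SelfDual 0# 0#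
    selfDual-0 = record
      { form   = record { symmetric = †-0 ; intertwine = trans (zeroˡ n) (sym (zeroʳ (n †))) }
      ; coform = record { symmetric = †-0 ; intertwine = trans (zeroʳ n) (sym (zeroˡ (n †))) }
      ; βγβ    = zeroˡ _
      ; γβγ    = zeroˡ _
      }

    annihilate-sym : ∀ {x y} → x † ≈ x → y † ≈ y → x * y ≈ 0# → y * x ≈ 0#
    annihilate-sym {x} {y} x† y† xy≈0 = begin
      y * x        ≈⟨ *-cong y† x† ⟨
      y † * x †    ≈⟨ †-* x y ⟨
      (x * y) †    ≈⟨ †-cong xy≈0 ⟩
      0# †         ≈⟨ †-0 ⟩
      0#           ∎

    zero-left : ∀ {x y} z → x * y ≈ 0# → x * (y * z) ≈ 0#
    zero-left {x} {y} z xy = trans (sym (*-assoc x y z)) (trans (*-congʳ xy) (zeroˡ z))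

    diagonal : ∀ {x x′ y y′} → y * x′ ≈ 0# → y′ * x ≈ 0# → (y + y′) * (x + x′) ≈ y * x + y′ * x′
    diagonal {x} {x′} {y} {y′} yx′ y′x = begin
      (y + y′) * (x + x′)                      ≈⟨ distribʳ _ y y′ ⟩
      y * (x + x′) + y′ * (x + x′)             ≈⟨ +-cong (distribˡ y x x′) (distribˡ y′ x x′) ⟩
      (y * x + y * x′) + (y′ * x + y′ * x′)    ≈⟨ +-cong (+-congˡ yx′) (+-congʳ y′x) ⟩
      (y * x + 0#) + (0# + y′ * x′)            ≈⟨ +-cong (+-identityʳ _) (+-identityˡ _) ⟩
      y * x + y′ * x′                          ∎

    -- An orthogonal sum: applying † to the two assumed cross products makes the other two vanish as
    -- well, so each triple product splits into those of the summands.
    selfDual-+ : ∀ {β γ β′ γ′} → SelfDual β γ → SelfDual β′ γ′ → β * γ′ ≈ 0# → β′ * γ ≈ 0# →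
                 SelfDual (β + β′) (γ + γ′)
    selfDual-+ {β} {γ} {β′} {γ′} S S′ βγ′≈0 β′γ≈0 = record
      { form   = record
        { symmetric  = trans (†-+ β β′) (+-cong S.β.symmetric S′.β.symmetric)
        ; intertwine = trans (distribʳ n β β′)
            (trans (+-cong S.β.intertwine S′.β.intertwine) (sym (distribˡ (n †) β β′))) }
      ; coform = record
        { symmetric  = trans (†-+ γ γ′) (+-cong S.γ.symmetric S′.γ.symmetric)
        ; intertwine = trans (distribˡ n γ γ′)
            (trans (+-cong S.γ.intertwine S′.γ.intertwine) (sym (distribʳ (n †) γ γ′))) }
      ; βγβ = triple γβ′≈0 γ′β≈0 βγ′≈0 β′γ≈0 S.βγβ S′.βγβ
      ; γβγ = triple βγ′≈0 β′γ≈0 γβ′≈0 γ′β≈0 S.γβγ S′.γβγ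
      }
      where
        module S = SelfDual S
        module S′ = SelfDual S′

        γ′β≈0 : γ′ * β ≈ 0#
        γ′β≈0 = annihilate-sym S.β.symmetric S′.γ.symmetric βγ′≈0
        γβ′≈0 : γ * β′ ≈ 0#
        γβ′≈0 = annihilate-sym S′.β.symmetric S.γ.symmetric β′γ≈0

        triple : ∀ {x x′ y y′} → y * x′ ≈ 0# → y′ * x ≈ 0# → x * y′ ≈ 0# → x′ * y ≈ 0# →
                 x * (y * x) ≈ x → x′ * (y′ * x′) ≈ x′ → (x + x′) * ((y + y′) * (x + x′)) ≈ x + x′
        triple {x} {x′} {y} {y′} yx′ y′x xy′ x′y e e′ = begin
          (x + x′) * ((y + y′) * (x + x′))    ≈⟨ *-congˡ (diagonal yx′ y′x) ⟩
          (x + x′) * (y * x + y′ * x′)        ≈⟨ diagonal (zero-left x′ xy′) (zero-left x x′y) ⟩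
          x * (y * x) + x′ * (y′ * x′)        ≈⟨ +-cong e e′ ⟩
          x + x′                              ∎

    ^-slide : ∀ x y k → (x * y) ^ k * x ≈ x * (y * x) ^ k
    ^-slide x y zero    = solve *-monoid
    ^-slide x y (suc k) = begin
      (x * y) * (x * y) ^ k * x      ≈⟨ *-assoc _ _ x ⟩
      (x * y) * ((x * y) ^ k * x)    ≈⟨ *-congˡ (^-slide x y k) ⟩
      (x * y) * (x * (y * x) ^ k)    ≈⟨ solve *-monoid ⟩
      x * ((y * x) * (y * x) ^ k)    ∎

    ^-comm : ∀ x k → x ^ k * x ≈ x * x ^ k
    ^-comm x zero    = solve *-monoid
    ^-comm x (suc k) = trans (*-assoc x _ x) (*-congˡ (^-comm x k))

    †-^ : ∀ x k → (x ^ k) † ≈ (x †) ^ k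
    †-^ x zero    = †-1
    †-^ x (suc k) = begin
      (x * x ^ k) †        ≈⟨ †-* x (x ^ k) ⟩
      (x ^ k) † * x †      ≈⟨ *-congʳ (†-^ x k) ⟩
      (x †) ^ k * x †      ≈⟨ ^-comm (x †) k ⟩
      x † * (x †) ^ k      ∎

    -- With t = γβ, an idempotent power t ^ (k + 1) splits off the self-dual pair
    -- (β t ^ (k + 1) , t ^ k γ).
    module _ {β γ : Carrier} (B : Form β) (C : Coform γ) where
      private
        module B = Form B
        module C = Coform C
        t = γ * β

        t† : t † ≈ β * γ
        t† = trans (†-* γ β) (*-cong B.symmetric C.symmetric)

        n-t : n * t ≈ t * n
        n-t = begin
          n * (γ * β)      ≈⟨ *-assoc n γ β ⟨
          n * γ * β        ≈⟨ *-congʳ C.intertwine ⟩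
          γ * n † * β      ≈⟨ *-assoc γ (n †) β ⟩
          γ * (n † * β)    ≈⟨ *-congˡ B.intertwine ⟨
          γ * (β * n)      ≈⟨ *-assoc γ β n ⟨
          γ * β * n        ∎

        n-t^ : ∀ k → n * t ^ k ≈ t ^ k * n
        n-t^ zero    = solve *-monoid
        n-t^ (suc k) = begin
          n * (t * t ^ k)    ≈⟨ *-assoc n t (t ^ k) ⟨
          n * t * t ^ k      ≈⟨ *-congʳ n-t ⟩
          t * n * t ^ k      ≈⟨ *-assoc t n (t ^ k) ⟩
          t * (n * t ^ k)    ≈⟨ *-congˡ (n-t^ k) ⟩
          t * (t ^ k * n)    ≈⟨ *-assoc t (t ^ k) n ⟨
          t * t ^ k * n      ∎

      -- † turns `t` into `β * γ`, and sliding `β` across the power restores the original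
      -- expression. The two intertwining relations together make `n` commute with `t`.
      form-^ : ∀ k → Form (β * t ^ k)
      form-^ k = record
        { symmetric  = begin
            (β * t ^ k) †        ≈⟨ †-* β (t ^ k) ⟩
            (t ^ k) † * β †      ≈⟨ *-cong (†-^ t k) B.symmetric ⟩
            (t †) ^ k * β        ≈⟨ *-congʳ (^-congˡ k t†) ⟩
            (β * γ) ^ k * β      ≈⟨ ^-slide β γ k ⟩
            β * t ^ k            ∎
        ; intertwine = begin
            β * t ^ k * n        ≈⟨ *-assoc β (t ^ k) n ⟩
            β * (t ^ k * n)      ≈⟨ *-congˡ (n-t^ k) ⟨
            β * (n * t ^ k)      ≈⟨ *-assoc β n (t ^ k) ⟨
            β * n * t ^ k        ≈⟨ *-congʳ B.intertwine ⟩
            n † * β * t ^ k      ≈⟨ *-assoc (n †) β (t ^ k) ⟩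
            n † * (β * t ^ k)    ∎
        }

      coform-^ : ∀ k → Coform (t ^ k * γ)
      coform-^ k = record
        { symmetric  = begin
            (t ^ k * γ) †        ≈⟨ †-* (t ^ k) γ ⟩
            γ † * (t ^ k) †      ≈⟨ *-cong C.symmetric (†-^ t k) ⟩
            γ * (t †) ^ k        ≈⟨ *-congˡ (^-congˡ k t†) ⟩
            γ * (β * γ) ^ k      ≈⟨ ^-slide γ β k ⟨
            t ^ k * γ            ∎
        ; intertwine = begin
            n * (t ^ k * γ)      ≈⟨ *-assoc n (t ^ k) γ ⟨
            n * t ^ k * γ        ≈⟨ *-congʳ (n-t^ k) ⟩
            t ^ k * n * γ        ≈⟨ *-assoc (t ^ k) n γ ⟩
            t ^ k * (n * γ)      ≈⟨ *-congˡ C.intertwine ⟩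
            t ^ k * (γ * n †)    ≈⟨ *-assoc (t ^ k) γ (n †) ⟨
            t ^ k * γ * n †      ∎
        }

      selfDual-^ : ∀ k → t ^ (suc k ℕ.+ k) ≈ t ^ k → SelfDual (β * t ^ suc k) (t ^ k * γ)
      selfDual-^ k e = record
        { form   = form-^ (suc k)
        ; coform = coform-^ k
        ; βγβ    = begin
            (β * (t * t ^ k)) * ((t ^ k * γ) * (β * (t * t ^ k)))    ≈⟨ solve *-monoid ⟩
            β * (((t * t ^ k) * t ^ k) * (t * (t * t ^ k)))          ≈⟨ *-congˡ (*-congʳ e′) ⟩
            β * (t ^ k * (t * (t * t ^ k)))                          ≈⟨ solve *-monoid ⟩
            β * ((t ^ k * t) * (t * t ^ k))                          ≈⟨ *-congˡ (*-congʳ (^-comm t k)) ⟩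
            β * ((t * t ^ k) * (t * t ^ k))                          ≈⟨ solve *-monoid ⟩
            β * (t * ((t ^ k * t) * t ^ k))                          ≈⟨ *-congˡ (*-congˡ (*-congʳ (^-comm t k))) ⟩
            β * (t * ((t * t ^ k) * t ^ k))                          ≈⟨ *-congˡ (*-congˡ e′) ⟩
            β * (t * t ^ k)                                          ∎
        ; γβγ    = begin
            (t ^ k * γ) * ((β * (t * t ^ k)) * (t ^ k * γ))    ≈⟨ solve *-monoid ⟩
            (t ^ k * (γ * β)) * (((t * t ^ k) * t ^ k) * γ)    ≈⟨ *-cong (^-comm t k) (*-congʳ e′) ⟩
            (t * t ^ k) * (t ^ k * γ)                          ≈⟨ *-assoc _ _ γ ⟨
            ((t * t ^ k) * t ^ k) * γ                          ≈⟨ *-congʳ e′ ⟩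
            t ^ k * γ                                          ∎
        }
        where
          -- `t ^ suc k` acts as the identity on `t ^ k`; both triple products reduce by cancelling
          -- it.
          e′ : (t * t ^ k) * t ^ k ≈ t ^ k
          e′ = trans (sym (^-homo-* t (suc k) k)) e

    module Complement {β γ : Carrier} (S : SelfDual β γ) where
      private module S = SelfDual S

      -- The idempotent complementary to `γ * β`; its image is the kernel of `β`, the part of V that
      -- the pair does not yet cover.
      f : Carrier
      f = 1# - γ * β

      x-x≈0 : ∀ {x y} → x ≈ y → x - y ≈ 0#
      x-x≈0 {x} {y} e = trans (+-congʳ e) (-‿inverseʳ y)

      x*f : ∀ x → x * f ≈ x - x * (γ * β)
      x*f x = trans (distribˡ x 1# _) (+-cong (*-identityʳ x) (sym (-‿distribʳ-* x _)))

      f*x : ∀ x → f * x ≈ x - γ * β * x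
      f*x x = trans (distribʳ x 1# _) (+-cong (*-identityˡ x) (sym (-‿distribˡ-* _ x)))

      β*f≈0 : β * f ≈ 0#
      β*f≈0 = trans (x*f β) (x-x≈0 (sym S.βγβ))

      f*γ≈0 : f * γ ≈ 0#
      f*γ≈0 = trans (f*x γ) (x-x≈0 (sym (trans (*-assoc γ β γ) S.γβγ)))

      f-idempotent : f * f ≈ f
      f-idempotent = begin
        f * f                ≈⟨ x*f f ⟩
        f - f * (γ * β)      ≈⟨ +-congˡ (-‿cong (zero-left β f*γ≈0)) ⟩
        f - 0#               ≈⟨ +-congˡ -0#≈0# ⟩
        f + 0#               ≈⟨ +-identityʳ f ⟩
        f                    ∎

      f-n : f * n ≈ n * f
      f-n = begin
        f * n                ≈⟨ f*x n ⟩
        n - γ * β * n        ≈⟨ +-congˡ (-‿cong γβn) ⟩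
        n - n * (γ * β)      ≈⟨ x*f n ⟨
        n * f                ∎
        where
          γβn : γ * β * n ≈ n * (γ * β)
          γβn = begin
            γ * β * n        ≈⟨ *-assoc γ β n ⟩
            γ * (β * n)      ≈⟨ *-congˡ S.β.intertwine ⟩
            γ * (n † * β)    ≈⟨ *-assoc γ (n †) β ⟨
            γ * n † * β      ≈⟨ *-congʳ S.γ.intertwine ⟨
            n * γ * β        ≈⟨ *-assoc n γ β ⟩
            n * (γ * β)      ∎

      f≈0⇒γβ≈1 : f ≈ 0# → γ * β ≈ 1#
      f≈0⇒γβ≈1 e = sym (x∙y⁻¹≈ε⇒x≈y 1# (γ * β) e)

    -- convolution l e r k = ∑ lᵃ e rᵇ over a + b = k
    convolution : Carrier → Carrier → Carrier → ℕ → Carrier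
    convolution l e r zero    = e
    convolution l e r (suc k) = l * convolution l e r k + e * r ^ suc k

    -- The definition separates the term with a = 0; here the term with b = 0 is separated instead.
    -- Comparing the two expansions gives both the symmetry and the intertwining property.
    convolution-suc : ∀ l e r k → convolution l e r (suc k) ≈ convolution l e r k * r + l ^ suc k * e
    convolution-suc l e r zero    = begin
      l * e + e * (r * 1#)    ≈⟨ +-comm _ _ ⟩
      e * (r * 1#) + l * e    ≈⟨ +-cong (*-congˡ (*-identityʳ r)) (*-congʳ (sym (*-identityʳ l))) ⟩
      e * r + l * 1# * e      ∎
    convolution-suc l e r (suc k) = begin
      l * w (suc k) + e * r ^ suc (suc k)                    ≈⟨ +-cong (*-congˡ (convolution-suc l e r k)) (*-congˡ (sym (^-comm r (suc k)))) ⟩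
      l * (w k * r + l ^ suc k * e) + e * (r ^ suc k * r)    ≈⟨ +-cong (distribˡ l _ _) (sym (*-assoc e _ r)) ⟩
      l * (w k * r) + l * (l ^ suc k * e) + e * r ^ suc k * r
        ≈⟨ xy∙z≈xz∙y _ _ _ ⟩
      l * (w k * r) + e * r ^ suc k * r + l * (l ^ suc k * e)
        ≈⟨ +-cong (+-congʳ (*-assoc l _ r)) (*-assoc l _ e) ⟨
      l * w k * r + e * r ^ suc k * r + l ^ suc (suc k) * e  ≈⟨ +-congʳ (distribʳ r _ _) ⟨
      w (suc k) * r + l ^ suc (suc k) * e                    ∎
      where w = convolution l e r

    -- † exchanges the terms for (a , b) and (b , a), hence turns one recursion into the other.
    convolution-† : ∀ {l e r} → l † ≈ r → e † ≈ e → ∀ k → convolution l e r k † ≈ convolution l e r k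
    convolution-† {l} {e} {r} l† e† zero    = e†
    convolution-† {l} {e} {r} l† e† (suc k) = begin
      (l * w k + e * r ^ suc k) †            ≈⟨ †-+ _ _ ⟩
      (l * w k) † + (e * r ^ suc k) †        ≈⟨ +-cong (†-* l (w k)) (†-* e _) ⟩
      w k † * l † + (r ^ suc k) † * e †      ≈⟨ +-cong (*-cong (convolution-† l† e† k) l†) (*-cong r^† e†) ⟩
      w k * r + l ^ suc k * e                ≈⟨ convolution-suc l e r k ⟨
      w (suc k)                              ∎
      where
        w = convolution l e r
        r^† : (r ^ suc k) † ≈ l ^ suc k
        r^† = trans (†-^ r (suc k)) (^-congˡ (suc k) (trans (†-cong (sym l†)) (†-involutive l)))

    -- All terms with a > 0 begin with `l` and are killed by `x`; only a = 0 survives.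
    convolution-absorb : ∀ l e r k {x} → x * l ≈ 0# → x * convolution l e r k ≈ x * e * r ^ k
    convolution-absorb l e r zero    {x} xl = sym (*-identityʳ (x * e))
    convolution-absorb l e r (suc k) {x} xl = begin
      x * (l * w k + e * r ^ suc k)          ≈⟨ distribˡ x _ _ ⟩
      x * (l * w k) + x * (e * r ^ suc k)    ≈⟨ +-cong (zero-left (w k) xl) (sym (*-assoc x e _)) ⟩
      0# + x * e * r ^ suc k                 ≈⟨ +-identityˡ _ ⟩
      x * e * r ^ suc k                      ∎
      where w = convolution l e r

    -- By the two expansions of the convolution at `suc k`, `l * w k` and `w k * r` differ only by
    -- the end terms `e * r ^ suc k` and `l ^ suc k * e`. The first is killed by `y` on the right,
    -- the second by `x` on the left.
    convolution-intertwine : ∀ l e r k {x y} → x * l ≈ l * x → y * r ≈ r * y →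
      x * l ^ suc k ≈ 0# → r ^ suc k * y ≈ 0# →
      x * convolution l e r k * y * r ≈ l * (x * convolution l e r k * y)
    convolution-intertwine l e r k {x} {y} xl yr xl≈0 ry≈0 = begin
      x * w k * y * r                         ≈⟨ *-assoc (x * w k) y r ⟩
      x * w k * (y * r)                       ≈⟨ *-congˡ yr ⟩
      x * w k * (r * y)                       ≈⟨ solve *-monoid ⟩
      x * (w k * r) * y                       ≈⟨ +-identityʳ _ ⟨
      x * (w k * r) * y + 0#                  ≈⟨ +-congˡ (trans (*-congʳ (zero-left e xl≈0)) (zeroˡ y)) ⟨
      x * (w k * r) * y + x * (l ^ suc k * e) * y    ≈⟨ sandwich-+ _ _ ⟨
      x * (w k * r + l ^ suc k * e) * y       ≈⟨ *-congʳ (*-congˡ (convolution-suc l e r k)) ⟨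
      x * (l * w k + e * r ^ suc k) * y       ≈⟨ sandwich-+ _ _ ⟩
      x * (l * w k) * y + x * (e * r ^ suc k) * y    ≈⟨ +-congˡ er≈0 ⟩
      x * (l * w k) * y + 0#                  ≈⟨ +-identityʳ _ ⟩
      x * (l * w k) * y                       ≈⟨ *-congʳ (*-assoc x l (w k)) ⟨
      x * l * w k * y                         ≈⟨ *-congʳ (*-congʳ xl) ⟩
      l * x * w k * y                         ≈⟨ solve *-monoid ⟩
      l * (x * w k * y)                       ∎
      where
        w = convolution l e r
        sandwich-+ : ∀ u v → x * (u + v) * y ≈ x * u * y + x * v * y
        sandwich-+ u v = trans (*-congʳ (distribˡ x u v)) (distribʳ y _ _)
        er≈0 : x * (e * r ^ suc k) * y ≈ 0#
        er≈0 = begin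
          x * (e * r ^ suc k) * y    ≈⟨ *-congʳ (*-assoc x e _) ⟨
          x * e * r ^ suc k * y      ≈⟨ *-assoc _ _ y ⟩
          x * e * (r ^ suc k * y)    ≈⟨ *-congˡ ry≈0 ⟩
          x * e * 0#                 ≈⟨ zeroʳ _ ⟩
          0#                         ∎

    -- On fV, where n ^ (k + 1) vanishes, convolution yields forms of the kind that
    -- identify a cyclic summand K[n]/(n ^ (k + 1)) with its dual.
    module Cyclic {f : Carrier} (ff : f * f ≈ f) (fn : f * n ≈ n * f)
      (k : ℕ) (nf≈0 : n ^ suc k * f ≈ 0#)
      {e e′ : Carrier} (e† : e † ≈ e) (e′† : e′ † ≈ e′) where

      g : Carrier
      g = n ^ k * f

      private
        w  = convolution (n †) e n k
        w′ = convolution n e′ (n †) k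

        f†f† : f † * f † ≈ f †
        f†f† = trans (sym (†-* f f)) (†-cong ff)

        f†n† : f † * n † ≈ n † * f †
        f†n† = trans (sym (†-* n f)) (trans (†-cong (sym fn)) (†-* f n))

        f-n^ : ∀ k → f * n ^ k ≈ n ^ k * f
        f-n^ zero    = solve *-monoid
        f-n^ (suc k) = begin
          f * (n * n ^ k)    ≈⟨ *-assoc f n _ ⟨
          f * n * n ^ k      ≈⟨ *-congʳ fn ⟩
          n * f * n ^ k      ≈⟨ *-assoc n f _ ⟩
          n * (f * n ^ k)    ≈⟨ *-congˡ (f-n^ k) ⟩
          n * (n ^ k * f)    ≈⟨ *-assoc n _ f ⟨
          n ^ suc k * f      ∎

        fn≈0 : f * n ^ suc k ≈ 0#
        fn≈0 = trans (f-n^ (suc k)) nf≈0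

        †-^* : ∀ k → (n ^ k * f) † ≈ f † * (n †) ^ k
        †-^* k = trans (†-* _ f) (*-congˡ (†-^ n k))

        f†n†≈0 : f † * (n †) ^ suc k ≈ 0#
        f†n†≈0 = trans (sym (†-^* (suc k))) (trans (†-cong nf≈0) †-0)

        n†f†≈0 : (n †) ^ suc k * f † ≈ 0#
        n†f†≈0 = trans (*-congʳ (sym (†-^ n (suc k)))) (trans (sym (†-* f _)) (trans (†-cong fn≈0) †-0))

        gf : g * f ≈ g
        gf = trans (*-assoc _ f f) (*-congˡ ff)

        gn≈0 : g * n ≈ 0#
        gn≈0 = begin
          n ^ k * f * n      ≈⟨ *-assoc _ f n ⟩
          n ^ k * (f * n)    ≈⟨ *-congˡ fn ⟩
          n ^ k * (n * f)    ≈⟨ *-assoc _ n f ⟨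
          n ^ k * n * f      ≈⟨ *-congʳ (^-comm n k) ⟩
          n ^ suc k * f      ≈⟨ nf≈0 ⟩
          0#                 ∎

        ng≈0 : n * g ≈ 0#
        ng≈0 = trans (sym (*-assoc n _ f)) nf≈0

        n^†f† : (n †) ^ k * f † ≈ f † * (n †) ^ k
        n^†f† = begin
          (n †) ^ k * f †    ≈⟨ *-congʳ (†-^ n k) ⟨
          (n ^ k) † * f †    ≈⟨ †-* f _ ⟨
          (f * n ^ k) †      ≈⟨ †-cong (f-n^ k) ⟩
          (n ^ k * f) †      ≈⟨ †-^* k ⟩
          f † * (n †) ^ k    ∎

      β γ : Carrier
      β = f † * w * f
      γ = f * w′ * f †

      form : Form β
      form = record
        { symmetric  = begin
            (f † * w * f) †          ≈⟨ †-* _ f ⟩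
            f † * (f † * w) †        ≈⟨ *-congˡ (†-* (f †) w) ⟩
            f † * (w † * f † †)      ≈⟨ *-congˡ (*-cong (convolution-† (†-involutive n) e† k) (†-involutive f)) ⟩
            f † * (w * f)            ≈⟨ *-assoc (f †) w f ⟨
            f † * w * f              ∎
        ; intertwine = convolution-intertwine (n †) e n k f†n† fn f†n†≈0 nf≈0
        }

      coform : Coform γ
      coform = record
        { symmetric  = begin
            (f * w′ * f †) †          ≈⟨ †-* _ (f †) ⟩
            f † † * (f * w′) †        ≈⟨ *-cong (†-involutive f) (†-* f w′) ⟩
            f * (w′ † * f †)          ≈⟨ *-congˡ (*-congʳ (convolution-† refl e′† k)) ⟩
            f * (w′ * f †)            ≈⟨ *-assoc f w′ (f †) ⟨
            f * w′ * f †              ∎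
        ; intertwine = sym (convolution-intertwine n e′ (n †) k fn f†n† fn≈0 n†f†≈0)
        }

      β*f≈β : β * f ≈ β
      β*f≈β = trans (*-assoc _ f f) (*-congˡ ff)

      f*γ≈γ : f * γ ≈ γ
      f*γ≈γ = begin
        f * (f * w′ * f †)    ≈⟨ solve *-monoid ⟩
        (f * f) * w′ * f †    ≈⟨ *-congʳ (*-congʳ ff) ⟩
        f * w′ * f †          ∎

      -- As `g * n` and `g † * n †` vanish, `convolution-absorb` leaves a single term of each
      -- convolution. The powers left over combine with `f †` and `f` to `g †` and `g`.
      gγβ : g * (γ * β) ≈ g * e′ * g † * e * g
      gγβ = begin
        g * (f * w′ * f † * (f † * w * f))          ≈⟨ solve *-monoid ⟩
        (g * f) * w′ * ((f † * f †) * w * f)        ≈⟨ *-cong (*-congʳ gf) (*-congʳ (*-congʳ f†f†)) ⟩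
        g * w′ * (f † * w * f)                      ≈⟨ *-congʳ (convolution-absorb n e′ (n †) k gn≈0) ⟩
        g * e′ * (n †) ^ k * (f † * w * f)          ≈⟨ solve *-monoid ⟩
        g * e′ * ((n †) ^ k * f †) * w * f          ≈⟨ *-congʳ (*-congʳ (*-congˡ n^†f†)) ⟩
        g * e′ * (f † * (n †) ^ k) * w * f          ≈⟨ *-congʳ (*-congʳ (*-congˡ (†-^* k))) ⟨
        g * e′ * g † * w * f                        ≈⟨ *-congʳ (*-assoc _ (g †) w) ⟩
        g * e′ * (g † * w) * f                      ≈⟨ *-congʳ (*-congˡ (convolution-absorb (n †) e n k g†n†≈0)) ⟩
        g * e′ * (g † * e * n ^ k) * f              ≈⟨ solve *-monoid ⟩
        g * e′ * g † * e * (n ^ k * f)              ∎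
        where
          g†n†≈0 : g † * n † ≈ 0#
          g†n†≈0 = trans (sym (†-* n g)) (trans (†-cong ng≈0) †-0)

    -- The conditions `β₀f` and `fγ₀` place the new form and coform on the complement of `S`, which
    -- makes the split-off pair orthogonal to `S`. That no power of `t` vanishes makes this pair
    -- nonzero.
    module Enlarge {β γ β₀ γ₀ : Carrier} (S : SelfDual β γ) (B : Form β₀) (C : Coform γ₀)
      (β₀f : β₀ * Complement.f S ≈ β₀) (fγ₀ : Complement.f S * γ₀ ≈ γ₀)
      (t^≉0 : ∀ k → ¬ ((γ₀ * β₀) ^ k ≈ 0#))
      (k : ℕ) (idem : (γ₀ * β₀) ^ (suc k ℕ.+ k) ≈ (γ₀ * β₀) ^ k) where
      open Complement S
      module S = SelfDual S
      t = γ₀ * β₀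
      β₁ = β₀ * t ^ suc k
      γ₁ = t ^ k * γ₀

      S₁ : SelfDual β₁ γ₁
      S₁ = selfDual-^ B C k idem
      module S₁ = SelfDual S₁

      βγ₁≈0 : β * γ₁ ≈ 0#
      βγ₁≈0 = trans (*-congˡ (^-slide γ₀ β₀ k))
        (zero-left _ (trans (*-congˡ (sym fγ₀)) (zero-left γ₀ β*f≈0)))

      β₁γ≈0 : β₁ * γ ≈ 0#
      β₁γ≈0 = begin
        β₀ * t ^ suc k * γ              ≈⟨ *-congʳ (^-slide β₀ γ₀ (suc k)) ⟨
        (β₀ * γ₀) ^ suc k * β₀ * γ      ≈⟨ *-assoc _ β₀ γ ⟩
        (β₀ * γ₀) ^ suc k * (β₀ * γ)    ≈⟨ *-congˡ (*-congʳ β₀f) ⟨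
        (β₀ * γ₀) ^ suc k * (β₀ * f * γ)  ≈⟨ *-congˡ (*-assoc β₀ f γ) ⟩
        (β₀ * γ₀) ^ suc k * (β₀ * (f * γ))  ≈⟨ *-congˡ (*-congˡ f*γ≈0) ⟩
        (β₀ * γ₀) ^ suc k * (β₀ * 0#)   ≈⟨ *-congˡ (zeroʳ β₀) ⟩
        (β₀ * γ₀) ^ suc k * 0#          ≈⟨ zeroʳ _ ⟩
        0#                              ∎

      γβ₁≈0 : γ * β₁ ≈ 0#
      γβ₁≈0 = annihilate-sym S₁.β.symmetric S.γ.symmetric β₁γ≈0

      -- `γ` annihilates `β₁`, so `β * γ` recovers `β` from `β + β₁`.
      shrinks : ∀ x → (β + β₁) * x ≈ 0# → β * x ≈ 0#
      shrinks x p = begin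
        β * x                              ≈⟨ *-congʳ S.βγβ ⟨
        β * (γ * β) * x                    ≈⟨ solve *-monoid ⟩
        β * (γ * β * x)                    ≈⟨ *-congˡ (*-congʳ (+-identityʳ _)) ⟨
        β * ((γ * β + 0#) * x)             ≈⟨ *-congˡ (*-congʳ (+-congˡ γβ₁≈0)) ⟨
        β * ((γ * β + γ * β₁) * x)         ≈⟨ *-congˡ (*-congʳ (distribˡ γ β β₁)) ⟨
        β * (γ * (β + β₁) * x)             ≈⟨ *-congˡ (*-assoc γ _ x) ⟩
        β * (γ * ((β + β₁) * x))           ≈⟨ *-congˡ (*-congˡ p) ⟩
        β * (γ * 0#)                       ≈⟨ *-congˡ (zeroʳ γ) ⟩
        β * 0#                             ≈⟨ zeroʳ β ⟩
        0#                                 ∎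

      -- `γ₁` witnesses that the annihilator shrinks strictly: `β` kills it, but if `β₁` killed it
      -- too, `γ₁ * (β₁ * γ₁) ≈ γ₁` would force `t ^ suc k` to vanish.
      γ₁-new : ¬ ((β + β₁) * γ₁ ≈ 0#)
      γ₁-new p = t^≉0 (suc k) (begin
        t ^ suc k                   ≈⟨ ^-comm t k ⟨
        t ^ k * t                   ≈⟨ *-assoc _ γ₀ β₀ ⟨
        γ₁ * β₀                     ≈⟨ *-congʳ S₁.γβγ ⟨
        γ₁ * (β₁ * γ₁) * β₀         ≈⟨ *-congʳ (*-congˡ β₁γ₁≈0) ⟩
        γ₁ * 0# * β₀                ≈⟨ *-congʳ (zeroʳ γ₁) ⟩
        0# * β₀                     ≈⟨ zeroˡ β₀ ⟩
        0#                          ∎)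
        where
          β₁γ₁≈0 : β₁ * γ₁ ≈ 0#
          β₁γ₁≈0 = begin
            β₁ * γ₁                 ≈⟨ +-identityˡ _ ⟨
            0# + β₁ * γ₁            ≈⟨ +-congʳ βγ₁≈0 ⟨
            β * γ₁ + β₁ * γ₁        ≈⟨ distribʳ γ₁ β β₁ ⟨
            (β + β₁) * γ₁           ≈⟨ p ⟩
            0#                      ∎


    module _ (finite : Finite setoid)
      (nonNilpotent : ∀ f → f * f ≈ f → f * n ≈ n * f → ¬ (f ≈ 0#) →
        ∃₂ λ β γ → Form β × Coform γ × β * f ≈ β × f * γ ≈ γ × (∀ k → ¬ ((γ * β) ^ k ≈ 0#)))
      where
      private
        module F = Finite finite

        annihilator-finite : ∀ β → Finite (subsetSetoid setoid (λ x → β * x ≈ 0#))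
        annihilator-finite β = subset-finite (λ e p → trans (*-congˡ (sym e)) p) (λ x → β * x F.≟ 0#) finite

        -- Each enlargement adds an orthogonal summand to β, so the annihilator shrinks.
        size : Carrier → ℕ
        size β = Finite.size (annihilator-finite β)

        Enlargement : Carrier → Set _
        Enlargement β = ∃₂ λ β′ γ′ → SelfDual β′ γ′ × size β′ ℕ.< size β

        enlarge : ∀ {β γ} → SelfDual β γ → ¬ (1# - γ * β ≈ 0#) → Enlargement β
        enlarge {β} {γ} S f≉0 = from-data (nonNilpotent _ (Complement.f-idempotent S) (Complement.f-n S) f≉0)
          where
            from-data : (∃₂ λ β₀ γ₀ → Form β₀ × Coform γ₀ × β₀ * Complement.f S ≈ β₀ × Complement.f S * γ₀ ≈ γ₀ ×
                           (∀ k → ¬ ((γ₀ * β₀) ^ k ≈ 0#))) → Enlargement β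
            from-data (β₀ , γ₀ , B , C , β₀f , fγ₀ , t^≉0) = from-power (idempotentPower finite (γ₀ * β₀))
              where
                from-power : (∃[ k ] (γ₀ * β₀) ^ (suc k ℕ.+ k) ≈ (γ₀ * β₀) ^ k) → Enlargement β
                from-power (k , idem) = β + E.β₁ , γ + E.γ₁ , selfDual-+ S E.S₁ E.βγ₁≈0 E.β₁γ≈0
                  , strictSubset-size (annihilator-finite (β + E.β₁)) (annihilator-finite β) E.shrinks
                      (λ e p → trans (*-congˡ (sym e)) p) E.γ₁ E.βγ₁≈0 E.γ₁-new
                  where module E = Enlarge S B C β₀f fγ₀ t^≉0 k idem

        Perfect : Set _
        Perfect = ∃₂ λ β γ → SelfDual β γ × γ * β ≈ 1#

        complete : ∀ β γ → SelfDual β γ → Acc ℕ._<_ (size β) → Perfect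
        continue : ∀ β → Acc ℕ._<_ (size β) → Enlargement β → Perfect
        complete β γ S a = case-dec (1# - γ * β F.≟ 0#)
          where
            case-dec : Dec (1# - γ * β ≈ 0#) → Perfect
            case-dec (yes f≈0) = β , γ , S , Complement.f≈0⇒γβ≈1 S f≈0
            case-dec (no f≉0)  = continue β a (enlarge S f≉0)
        continue β (acc rec) (β′ , γ′ , S′ , lt) = complete β′ γ′ S′ (rec lt)

      -- Starting from the zero pair, enlargement terminates because `size` drops each time, and it
      -- stops only when the complementary idempotent `1# - γ * β` is zero.
      perfectForm : ∃₂ λ β γ → SelfDual β γ × γ * β ≈ 1#
      perfectForm = complete 0# 0# selfDual-0 (<-wellFounded (size 0#))

-- Subsets and their reversed complements

StrictlyMonotone : (Fin m → Fin n) → Set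
StrictlyMonotone f = ∀ {i j} → i Fin.< j → f i Fin.< f j

strictlyMonotone⇒inflationary : (f : Fin m → Fin n) → StrictlyMonotone f → ∀ i → toℕ i ℕ.≤ toℕ (f i)
strictlyMonotone⇒inflationary {suc m} f mono Fin.zero    = ℕ.z≤n
strictlyMonotone⇒inflationary {suc m} {n} f mono (Fin.suc i) = ℕₚ.≤-<-trans
  (strictlyMonotone⇒inflationary (f ∘ inject₁) (mono ∘ inject₁-mono) i)
  (mono (ℕ.s≤s (ℕₚ.≤-reflexive (Finₚ.toℕ-inject₁ i))))
  where
    inject₁-mono : ∀ {i j : Fin m} → i Fin.< j → inject₁ i Fin.< inject₁ j
    inject₁-mono {i} {j} = ≡.subst₂ ℕ._<_ (≡.sym (Finₚ.toℕ-inject₁ i)) (≡.sym (Finₚ.toℕ-inject₁ j))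

opposite-mono-< : {i j : Fin n} → i Fin.< j → opposite j Fin.< opposite i
opposite-mono-< {i = i} {j} i<j = opposite-cancel-<
  (≡.subst₂ Fin._<_ (≡.sym (Finₚ.opposite-involutive i)) (≡.sym (Finₚ.opposite-involutive j)) i<j)

opposite-mono-≤ : {i j : Fin n} → i Fin.≤ j → opposite j Fin.≤ opposite i
opposite-mono-≤ {i = i} {j} i≤j = ℕₚ.≮⇒≥ λ lt → ℕₚ.≤⇒≯ i≤j (opposite-cancel-< lt)

-- A strictly monotone map is inflationary. Its conjugate by `opposite` is strictly monotone too,
-- which gives the reverse inequality.
strictlyMonotone⇒id : (f : Fin n → Fin n) → StrictlyMonotone f → ∀ i → f i ≡ i
strictlyMonotone⇒id f mono i = Finₚ.≤-antisym
  (≡.subst₂ Fin._≤_ (≡.trans (Finₚ.opposite-involutive _) (≡.cong f (Finₚ.opposite-involutive i))) (Finₚ.opposite-involutive i)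
    (opposite-mono-≤ {i = opposite i} (strictlyMonotone⇒inflationary (opposite ∘ f ∘ opposite)
      (opposite-mono-< ∘ mono ∘ opposite-mono-<) (opposite i))))
  (strictlyMonotone⇒inflationary f mono i)

strictlyMonotone⇒cast : (e : m ≡ n) (f : Fin m → Fin n) → StrictlyMonotone f → ∀ i → f i ≡ cast e i
strictlyMonotone⇒cast ≡.refl f mono i = ≡.trans (strictlyMonotone⇒id f mono i) (≡.sym (Finₚ.cast-is-id ≡.refl i))

record Reverses (I J : Subset n) : Set where
  field
    reverse∈ : ∀ {j} → j ∈ I → opposite j ∈ J

  reversal : Fin ∣ I ∣ → Fin ∣ J ∣
  reversal k = cano J (opposite (cano⁻¹ I k)) (reverse∈ (cano⁻¹∈ I k))

  cano⁻¹-reversal : ∀ k → cano⁻¹ J (reversal k) ≡ opposite (cano⁻¹ I k)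
  cano⁻¹-reversal k = cano⁻¹-cano J _ _

  reversal-anti-< : ∀ {k l} → k Fin.< l → reversal l Fin.< reversal k
  reversal-anti-< {k} {l} k<l = cano⁻¹-cancel-< J (≡.subst₂ Fin._<_ (≡.sym (cano⁻¹-reversal l)) (≡.sym (cano⁻¹-reversal k))
    (opposite-mono-< (cano⁻¹-mono-< I k<l)))

  reversal-size : ∣ I ∣ ℕ.≤ ∣ J ∣
  reversal-size = Finₚ.injective⇒≤ {f = reversal} λ {k} {l} e → cano⁻¹-injective I
    (≡.trans (≡.sym (Finₚ.opposite-involutive _)) (≡.trans (≡.cong opposite (≡.trans (≡.sym (cano⁻¹-reversal k))
      (≡.trans (≡.cong (cano⁻¹ J) e) (cano⁻¹-reversal l)))) (Finₚ.opposite-involutive _)))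

  -- `reversal` reverses the order, so composed with `opposite` it is strictly monotone between sets
  -- of equal size and must be the cast. Thus the reversal of [n] becomes, after relabelling, the
  -- reversal of the block's own indices.
  cano⁻¹-cast : (e : ∣ I ∣ ≡ ∣ J ∣) → ∀ k → cano⁻¹ J (cast e (opposite k)) ≡ opposite (cano⁻¹ I k)
  cano⁻¹-cast e k = ≡.trans (≡.cong (cano⁻¹ J) (≡.sym (≡.trans
    (≡.cong reversal (≡.sym (Finₚ.opposite-involutive k)))
    (strictlyMonotone⇒cast e (reversal ∘ opposite) (reversal-anti-< ∘ opposite-mono-<) (opposite k)))))
    (cano⁻¹-reversal k)

-- J = w̃(Iᶜ)
record Dual (I J : Subset n) : Set where
  field
    ∈⇒∉ : ∀ {j} → j ∈ I → opposite j ∉ J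
    ∉⇒∈ : ∀ {j} → j ∉ I → opposite j ∈ J

Dual-sym : {I J : Subset n} → Dual I J → Dual J I
Dual-sym {I = I} {J} d = record
  { ∈⇒∉ = λ {j} j∈J oj∈I → ∈⇒∉ oj∈I (≡.subst (_∈ J) (≡.sym (Finₚ.opposite-involutive j)) j∈J)
  ; ∉⇒∈ = λ {j} j∉J → ∈I j j∉J (opposite j ∈? I)
  }
  where
    open Dual d
    ∈I : ∀ j → j ∉ J → Dec (opposite j ∈ I) → opposite j ∈ I
    ∈I j j∉J (yes p) = p
    ∈I j j∉J (no ¬p) = contradiction (≡.subst (_∈ J) (Finₚ.opposite-involutive j) (∉⇒∈ ¬p)) j∉J

Dual⇒Reverses-∁ˡ : {I J : Subset n} → Dual I J → Reverses (∁ I) J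
Dual⇒Reverses-∁ˡ d = record { reverse∈ = Dual.∉⇒∈ d ∘ x∈∁p⇒x∉p }

Dual⇒Reverses-∁ʳ : {I J : Subset n} → Dual I J → Reverses I (∁ J)
Dual⇒Reverses-∁ʳ d = record { reverse∈ = x∉p⇒x∈∁p ∘ Dual.∈⇒∉ d }

∣∁I∣≡∣J∣ : {I J : Subset n} → Dual I J → ∣ ∁ I ∣ ≡ ∣ J ∣
∣∁I∣≡∣J∣ d = ℕₚ.≤-antisym (Reverses.reversal-size (Dual⇒Reverses-∁ˡ d))
                        (Reverses.reversal-size (Dual⇒Reverses-∁ʳ (Dual-sym d)))

∣I∣≡∣∁J∣ : {I J : Subset n} → Dual I J → ∣ I ∣ ≡ ∣ ∁ J ∣
∣I∣≡∣∁J∣ d = ≡.sym (∣∁I∣≡∣J∣ (Dual-sym d))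

-- The two uses of `opposite` have different ranges: on `Fin (suc n)` it sends i to n - i, on
-- `Fin n` it sends j to n - 1 - j. Hence j < i exactly when n - 1 - j ≥ n - i.
initial-Dual : ∀ n (i : Fin (suc n)) → Dual (initial n i) (initial n (opposite i))
initial-Dual n i = record
  { ∈⇒∉ = λ {j} j∈ oj∈ → ℕₚ.<⇒≱ (∈-initial⁻ (opposite i) oj∈)
      (≡.subst₂ ℕ._≤_ (≡.sym (Finₚ.opposite-prop i)) (≡.sym (Finₚ.opposite-prop j)) (ℕₚ.∸-monoʳ-≤ n (∈-initial⁻ i j∈)))
  ; ∉⇒∈ = λ {j} j∉ → ∈-initial⁺ (opposite i)
      (≡.subst₂ ℕ._<_ (≡.sym (Finₚ.opposite-prop j)) (≡.sym (Finₚ.opposite-prop i))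
        (ℕₚ.∸-monoʳ-< (ℕ.s≤s (ℕₚ.≮⇒≥ (j∉ ∘ ∈-initial⁺ i))) (Finₚ.toℕ<n j)))
  }

dual : Subset n → Subset n
dual []      = []
dual (s ∷ I) = dual I ∷ʳ not s

lookup-∷ʳ-fromℕ : ∀ {A : Set a} (xs : Vec A n) x → lookup (xs ∷ʳ x) (fromℕ n) ≡ x
lookup-∷ʳ-fromℕ []       x = ≡.refl
lookup-∷ʳ-fromℕ (_ ∷ xs) x = lookup-∷ʳ-fromℕ xs x

lookup-∷ʳ-inject₁ : ∀ {A : Set a} (xs : Vec A n) x i → lookup (xs ∷ʳ x) (inject₁ i) ≡ lookup xs i
lookup-∷ʳ-inject₁ (_ ∷ xs) x Fin.zero    = ≡.refl
lookup-∷ʳ-inject₁ (_ ∷ xs) x (Fin.suc i) = lookup-∷ʳ-inject₁ xs x i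

lookup-dual : (I : Subset n) (j : Fin n) → lookup (dual I) (opposite j) ≡ not (lookup I j)
lookup-dual (s ∷ I) Fin.zero    = lookup-∷ʳ-fromℕ (dual I) (not s)
lookup-dual (s ∷ I) (Fin.suc j) = ≡.trans (lookup-∷ʳ-inject₁ (dual I) (not s) (opposite j)) (lookup-dual I j)

dual-Dual : (I : Subset n) → Dual I (dual I)
dual-Dual I = record
  { ∈⇒∉ = λ {j} j∈ oj∈ → contradiction (≡.trans (≡.sym (Vecₚ.[]=⇒lookup oj∈))
      (≡.trans (lookup-dual I j) (≡.cong not (Vecₚ.[]=⇒lookup j∈)))) λ ()
  ; ∉⇒∈ = λ {j} j∉ → Vecₚ.lookup⇒[]= (opposite j) (dual I) (≡.trans (lookup-dual I j)
      (≡.trans (≡.sym (Vecₚ.lookup-map j not I)) (Vecₚ.[]=⇒lookup (x∉p⇒x∈∁p j∉))))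
  }

module SubsetSum (M : CommutativeMonoid a ℓ) where
  open CommutativeMonoid M renaming (refl to ≈-refl; sym to ≈-sym; trans to ≈-trans)
  open CommSemigroup commutativeSemigroup using (interchange)

  sumᴸ : List (Subset n) → (Subset n → Carrier) → Carrier
  sumᴸ Is F = foldr (λ I s → F I ∙ s) ε Is

  ∑⊆ : ∀ n → (Subset n → Carrier) → Carrier
  ∑⊆ n = sumᴸ (subsets n)

  sumᴸ-cong : ∀ (Is : List (Subset n)) {F F′} → (∀ I → F I ≈ F′ I) → sumᴸ Is F ≈ sumᴸ Is F′
  sumᴸ-cong []       e = ≈-refl
  sumᴸ-cong (I ∷ Is) e = ∙-cong (e I) (sumᴸ-cong Is e)

  sumᴸ-++ : ∀ (Is Js : List (Subset n)) F → sumᴸ (Is ++ Js) F ≈ sumᴸ Is F ∙ sumᴸ Js F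
  sumᴸ-++ []       Js F = ≈-sym (identityˡ _)
  sumᴸ-++ (I ∷ Is) Js F = ≈-trans (∙-congˡ (sumᴸ-++ Is Js F)) (≈-sym (assoc _ _ _))

  ∑⊆-cons : ∀ n F → ∑⊆ (suc n) F ≈ ∑⊆ n (F ∘ (outside ∷_)) ∙ ∑⊆ n (F ∘ (inside ∷_))
  ∑⊆-cons n F = ≈-trans (sumᴸ-++ (List.map (outside ∷_) (subsets n)) _ F) (reflexive (≡.cong₂ _∙_
    (Listₚ.foldr-map _ (outside ∷_) ε (subsets n)) (Listₚ.foldr-map _ (inside ∷_) ε (subsets n))))

  -- `subsets` branches on the first element. Branching inductively on the last one gives four sums,
  -- and `interchange` regroups them.
  ∑⊆-snoc : ∀ n F → ∑⊆ (suc n) F ≈ ∑⊆ n (F ∘ (_∷ʳ outside)) ∙ ∑⊆ n (F ∘ (_∷ʳ inside))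
  ∑⊆-snoc zero    F = ∑⊆-cons zero F
  ∑⊆-snoc (suc n) F = ≈-trans (∑⊆-cons (suc n) F)
    (≈-trans (∙-cong (∑⊆-snoc n _) (∑⊆-snoc n _))
      (≈-trans (interchange _ _ _ _) (≈-sym (∙-cong (∑⊆-cons n _) (∑⊆-cons n _)))))

  -- `dual` moves the first bit to the end and negates it, so the split at the first element becomes
  -- the split at the last with its halves exchanged.
  ∑⊆-dual : ∀ n F → ∑⊆ n (F ∘ dual) ≈ ∑⊆ n F
  ∑⊆-dual zero    F = ≈-refl
  ∑⊆-dual (suc n) F = ≈-trans (∑⊆-cons n (F ∘ dual))
    (≈-trans (∙-cong (∑⊆-dual n (F ∘ (_∷ʳ inside))) (∑⊆-dual n (F ∘ (_∷ʳ outside))))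
      (≈-trans (comm _ _) (≈-sym (∑⊆-snoc n F))))

-- Conjugacy of a unipotent matrix with its image under †.

module UnipotentSimilarity {q ℓq ℓq′ k ℓk ℓk′}
  (𝔽 : FiniteField q ℓq ℓq′) (𝕂 : CharacteristicZeroField k ℓk ℓk′) where

  open Unitriangular 𝔽 𝕂
  open FiniteField 𝔽 using (heytingField) renaming (finite to 𝔽-finite)
  open CommutativeRing (FiniteField.commutativeRing 𝔽) hiding (zero)
  open SemiringSum semiring
    using (sum; sum-cong-≋; sum-replicate-zero; ∑-distrib-+; *-distribˡ-sum; *-distribʳ-sum)
  open import Algebra.Properties.Group +-group using (//-rightDividesˡ)
  open SetoidReasoning setoid
  open Finite 𝔽-finite using (_≟_)

  -- Only elements apart from zero come with an inverse. If `x # 0#`, cancelling `x` would give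
  -- `y ≈ 0#`; so `x # 0#` is refuted, and tightness yields `x ≈ 0#`.
  nonzero-* : ∀ {x y} → ¬ (x ≈ 0#) → ¬ (y ≈ 0#) → ¬ (x * y ≈ 0#)
  nonzero-* {x} {y} x≉0 y≉0 xy≈0 = x≉0 (proj₁ (tight x 0#) λ x#0 → y≉0 (cancel x#0))
    where
      open HeytingField heytingField using (_#_; tight; #⇒invertible)
      open import Algebra.Properties.Ring ring using (-0#≈0#)
      cancel : x # 0# → y ≈ 0#
      cancel x#0 with z , zx≈1 , _ ← #⇒invertible x#0 = begin
        y                    ≈⟨ *-identityˡ y ⟨
        1# * y               ≈⟨ *-congʳ zx≈1 ⟨
        z * (x - 0#) * y     ≈⟨ *-assoc z _ y ⟩
        z * ((x - 0#) * y)   ≈⟨ *-congˡ (*-congʳ (trans (+-congˡ -0#≈0#) (+-identityʳ x))) ⟩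
        z * (x * y)          ≈⟨ *-congˡ xy≈0 ⟩
        z * 0#               ≈⟨ zeroʳ z ⟩
        0#                   ∎

  matrixRing : ℕ → Ring q ℓq
  matrixRing n = record
    { Carrier = Mat n
    ; _≈_ = _≋_
    ; _+_ = λ A B i j → A i j + B i j
    ; _*_ = _⊡_
    ; -_  = λ A i j → - A i j
    ; 0#  = λ _ _ → 0#
    ; 1#  = 𝟙
    ; isRing = record
      { +-isAbelianGroup = record
        { isGroup = record
          { isMonoid = record
            { isSemigroup = record
              { isMagma = record
                { isEquivalence = Setoid.isEquivalence (matrixSetoid n)
                ; ∙-cong = λ e e′ i j → +-cong (e i j) (e′ i j) }
              ; assoc = λ _ _ _ _ _ → +-assoc _ _ _ }
            ; identity = (λ _ _ _ → +-identityˡ _) , (λ _ _ _ → +-identityʳ _) }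
          ; inverse = (λ _ _ _ → -‿inverseˡ _) , (λ _ _ _ → -‿inverseʳ _)
          ; ⁻¹-cong = λ e i j → -‿cong (e i j) }
        ; comm = λ _ _ _ _ → +-comm _ _ }
      ; *-cong = ⊡-cong
      ; *-assoc = ⊡-assoc
      ; *-identity = ⊡-identityˡ , ⊡-identityʳ
      ; distrib = (λ A B C i j → trans (sum-cong-≋ {n} λ _ → distribˡ _ _ _) (∑-distrib-+ {n} _ _))
                , (λ A B C i j → trans (sum-cong-≋ {n} λ _ → distribʳ _ _ _) (∑-distrib-+ {n} _ _))
      }
    }

  †-antiInvolution : ∀ n → AntiInvolution (matrixRing n) _†
  †-antiInvolution n = record
    { †-cong       = λ {A} {B} → †-cong {A = A} {B}
    ; †-+          = λ _ _ _ _ → refl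
    ; †-*          = †-anti
    ; †-1          = †-𝟙
    ; †-involutive = λ A i j → reflexive (≡.cong₂ A (Finₚ.opposite-involutive i) (Finₚ.opposite-involutive j))
    }

  matrixUnit : Fin n → Fin n → Mat n
  matrixUnit r s i j = 𝟙 i r * 𝟙 s j

  ⊡-matrixUnit-⊡ : ∀ (A B : Mat n) r s i j → (A ⊡ matrixUnit r s ⊡ B) i j ≈ A i r * B s j
  ⊡-matrixUnit-⊡ {n} A B r s i j = begin
    (sum λ l → (sum λ m → A i m * (𝟙 m r * 𝟙 s l)) * B l j)    ≈⟨ sum-cong-≋ {n} (λ l → *-congʳ (column l)) ⟩
    (sum λ l → A i r * 𝟙 s l * B l j)                          ≈⟨ sum-cong-≋ {n} (λ l → *-assoc _ _ _) ⟩
    (sum λ l → A i r * (𝟙 s l * B l j))                        ≈⟨ *-distribˡ-sum {n} (A i r) _ ⟨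
    A i r * (𝟙 ⊡ B) s j                                        ≈⟨ *-congˡ (⊡-identityˡ B s j) ⟩
    A i r * B s j                                              ∎
    where
      column : ∀ l → (sum λ m → A i m * (𝟙 m r * 𝟙 s l)) ≈ A i r * 𝟙 s l
      column l = begin
        (sum λ m → A i m * (𝟙 m r * 𝟙 s l))    ≈⟨ sum-cong-≋ {n} (λ m → *-assoc _ _ _) ⟨
        (sum λ m → A i m * 𝟙 m r * 𝟙 s l)      ≈⟨ *-distribʳ-sum {n} (𝟙 s l) _ ⟨
        (A ⊡ 𝟙) i r * 𝟙 s l                    ≈⟨ *-congʳ (⊡-identityʳ A i r) ⟩
        A i r * 𝟙 s l                          ∎

  -- In particular the units at antidiagonal positions are fixed by †, as `Cyclic` demands of `e`
  -- and `e′`.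
  matrixUnit-† : ∀ (r s : Fin n) → matrixUnit r s † ≋ matrixUnit (opposite s) (opposite r)
  matrixUnit-† r s i j = begin
    𝟙 (opposite j) r * 𝟙 s (opposite i)    ≈⟨ *-comm _ _ ⟩
    𝟙 s (opposite i) * 𝟙 (opposite j) r
      ≡⟨ ≡.cong₂ (λ s r → 𝟙 s (opposite i) * 𝟙 (opposite j) r) (Finₚ.opposite-involutive s) (Finₚ.opposite-involutive r) ⟨
    (𝟙 †) i (opposite s) * (𝟙 †) (opposite r) j    ≈⟨ *-cong (†-𝟙 i (opposite s)) (†-𝟙 (opposite r) j) ⟩
    𝟙 i (opposite s) * 𝟙 (opposite r) j    ∎

  module _ {n : ℕ} (u : Group.Carrier (UT n)) where
    private
      module R = Ring (matrixRing n)
      open Exp R.semiring using (_^_)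
      module D = SelfDuality (matrixRing n) (†-antiInvolution n)

    nilpotentPart : Mat n
    nilpotentPart i j = proj₁ (proj₁ u) i j - 𝟙 i j

    -- Every factor is strictly upper triangular and so raises the index by at least one. For m = n
    -- the condition holds at every position.
    nilpotentPart-^ : ∀ m i j → toℕ j ℕ.< m ℕ.+ toℕ i → (nilpotentPart ^ m) i j ≈ 0#
    nilpotentPart-^ zero    i j j<i = 𝟙-off {i = i} {j} λ { ≡.refl → ℕₚ.<-irrefl ≡.refl j<i }
    nilpotentPart-^ (suc m) i j j<m+i = trans (sum-cong-≋ {n} term) (sum-replicate-zero n)
      where
        term : ∀ l → nilpotentPart i l * (nilpotentPart ^ m) l j ≈ 0#
        term l with i Finₚ.<? l
        ... | yes i<l = trans (*-congˡ (nilpotentPart-^ m l j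
                (ℕₚ.<-≤-trans j<m+i (ℕₚ.≤-trans (ℕₚ.≤-reflexive (≡.sym (ℕₚ.+-suc m (toℕ i))))
                  (ℕₚ.+-monoʳ-≤ m i<l))))) (zeroʳ _)
        ... | no i≮l = trans (*-congʳ (trans (+-congʳ (proj₂ u i l i≮l)) (-‿inverseʳ _))) (zeroˡ _)

    module _ (f : Mat n) (ff : f ⊡ f ≋ f) (fn : f ⊡ nilpotentPart ≋ nilpotentPart ⊡ f) (f≉0 : ¬ (f ≋ R.0#)) where
      private
        N = nilpotentPart
        open Finite (matrix-finite n) using () renaming (_≟_ to _≟ᴹ_)

        lastNonzero : ∀ m → N ^ m ⊡ f ≋ R.0# → ∃[ k ] N ^ suc k ⊡ f ≋ R.0# × ¬ (N ^ k ⊡ f ≋ R.0#)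
        lastNonzero zero    e = contradiction (R.trans {f} {𝟙 ⊡ f} (R.sym {𝟙 ⊡ f} {f} (⊡-identityˡ f)) e) f≉0
        lastNonzero (suc m) e with N ^ m ⊡ f ≟ᴹ R.0#
        ... | yes e′ = lastNonzero m e′
        ... | no  ≉0 = m , e , ≉0

        nonzero-entry : ∀ (A : Mat n) → ¬ (A ≋ R.0#) → ∃₂ λ i j → ¬ (A i j ≈ 0#)
        nonzero-entry A A≉0 =
          let i , row≉0 = Finₚ.¬∀⟶∃¬ n _ (λ i → Finₚ.all? λ j → A i j ≟ 0#) A≉0
              j , ≉0    = Finₚ.¬∀⟶∃¬ n _ (λ j → A i j ≟ 0#) row≉0
          in i , j , ≉0

        nilpotent : N ^ n ⊡ f ≋ R.0#
        nilpotent = R.trans {N ^ n ⊡ f} {R.0# ⊡ f} {R.0#}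
          (⊡-cong {A = N ^ n} {R.0#} {f} {f} (λ i j → nilpotentPart-^ n i j (ℕₚ.<-≤-trans (Finₚ.toℕ<n j) (ℕₚ.m≤m+n n _)))
                  (λ _ _ → refl))
          (R.zeroˡ f)

        module WithEntry (k : ℕ) (Nf≈0 : N ^ suc k ⊡ f ≋ R.0#) (i j : Fin n) (≉0 : ¬ ((N ^ k ⊡ f) i j ≈ 0#)) where
          e e′ : Mat n
          -- With these antidiagonal units, row `i` of `g e′ g† e g` is `g i j` times the entry of
          -- `g †` at (`opposite j` , `opposite i`), which is again `g i j`, times row `i` of `g`.
          e  = matrixUnit (opposite i) i
          e′ = matrixUnit j (opposite j)

          e† : e † ≋ e
          e† = R.trans {e †} {matrixUnit (opposite i) (opposite (opposite i))} {e} (matrixUnit-† (opposite i) i)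
            (λ r s → reflexive (≡.cong (λ i′ → matrixUnit (opposite i) i′ r s) (Finₚ.opposite-involutive i)))

          e′† : e′ † ≋ e′
          e′† = R.trans {e′ †} {matrixUnit (opposite (opposite j)) (opposite j)} {e′} (matrixUnit-† j (opposite j))
            (λ r s → reflexive (≡.cong (λ j′ → matrixUnit j′ (opposite j) r s) (Finₚ.opposite-involutive j)))

          module C = D.Cyclic N {f} ff fn k Nf≈0 {e} {e′} e† e′†
          open C using (g; β; γ)

          c : Carrier
          c = g i j * g i j

          t : Mat n
          t = γ ⊡ β

          row-eigenvector : ∀ l → (g ⊡ t) i l ≈ c * g i l
          row-eigenvector l = begin
            (g ⊡ t) i l                                        ≈⟨ C.gγβ i l ⟩
            (g ⊡ e′ ⊡ g † ⊡ e ⊡ g) i l                         ≈⟨ ⊡-matrixUnit-⊡ (g ⊡ e′ ⊡ g †) g (opposite i) i i l ⟩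
            (g ⊡ e′ ⊡ g †) i (opposite i) * g i l              ≈⟨ *-congʳ (⊡-matrixUnit-⊡ g (g †) j (opposite j) i (opposite i)) ⟩
            g i j * (g †) (opposite j) (opposite i) * g i l
              ≡⟨ ≡.cong₂ (λ i′ j′ → g i j * g i′ j′ * g i l) (Finₚ.opposite-involutive i) (Finₚ.opposite-involutive j) ⟩
            c * g i l                                          ∎

          row-suc : ∀ m l → (g ⊡ (t ⊡ t ^ m)) i l ≈ c * (g ⊡ t ^ m) i l
          row-suc m l = begin
            (g ⊡ (t ⊡ t ^ m)) i l                    ≈⟨ ⊡-assoc g t (t ^ m) i l ⟨
            (sum λ p → (g ⊡ t) i p * (t ^ m) p l)    ≈⟨ sum-cong-≋ {n} (λ p → *-congʳ (row-eigenvector p)) ⟩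
            (sum λ p → c * g i p * (t ^ m) p l)      ≈⟨ sum-cong-≋ {n} (λ p → *-assoc c (g i p) _) ⟩
            (sum λ p → c * (g i p * (t ^ m) p l))    ≈⟨ *-distribˡ-sum {n} c _ ⟨
            c * (g ⊡ t ^ m) i l                      ∎

          -- Each factor `t` multiplies row `i` by the nonzero eigenvalue `c`, and a field has no
          -- zero divisors.
          row-nonzero : ∀ m → ¬ ((g ⊡ t ^ m) i j ≈ 0#)
          row-nonzero zero    e = ≉0 (trans (sym (⊡-identityʳ g i j)) e)
          row-nonzero (suc m) e = nonzero-* (nonzero-* ≉0 ≉0) (row-nonzero m) (trans (sym (row-suc m j)) e)

          t^≉0 : ∀ m → ¬ (t ^ m ≋ R.0#)
          t^≉0 m e = row-nonzero m (trans (⊡-cong {A = g} {g} {t ^ m} {R.0#} (λ _ _ → refl) e i j) (R.zeroʳ g i j))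

      nonNilpotent : ∃₂ λ β γ → D.Form N β × D.Coform N γ × β ⊡ f ≋ β × f ⊡ γ ≋ γ × (∀ m → ¬ ((γ ⊡ β) ^ m ≋ R.0#))
      nonNilpotent =
        let k , Nf≈0 , g≉0 = lastNonzero n nilpotent
            i , j , ≉0     = nonzero-entry (N ^ k ⊡ f) g≉0
            module W = WithEntry k Nf≈0 i j ≉0
        in W.C.β , W.C.γ , W.C.form , W.C.coform , W.C.β*f≈β , W.C.f*γ≈γ , W.t^≉0

    †-conjugate : ∃[ x ] Group._≈_ (GL n) (Group._∙_ (GL n) (Group._∙_ (GL n) x (proj₁ u)) (Group._⁻¹ (GL n) x)) (proj₁ u †-GL)
    †-conjugate = from-form (D.perfectForm nilpotentPart (matrix-finite n) nonNilpotent)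
      where
        U = proj₁ (proj₁ u)
        N = nilpotentPart

        βU≋U†β : ∀ {β} → β ⊡ N ≋ N † ⊡ β → β ⊡ U ≋ U † ⊡ β
        βU≋U†β {β} βN = M.begin
          β ⊡ U                    M.≈⟨ ⊡-cong {A = β} {β} {U} {N R.+ 𝟙} (λ _ _ → refl) (λ _ _ → restore _ _) ⟩
          β ⊡ (N R.+ 𝟙)            M.≈⟨ R.distribˡ β N 𝟙 ⟩
          β ⊡ N R.+ β ⊡ 𝟙          M.≈⟨ (λ i j → +-cong (βN i j) (trans (⊡-identityʳ β i j) (sym (⊡-identityˡ β i j)))) ⟩
          N † ⊡ β R.+ 𝟙 ⊡ β        M.≈⟨ R.distribʳ β (N †) 𝟙 ⟨
          (N † R.+ 𝟙) ⊡ β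
            M.≈⟨ ⊡-cong {A = N † R.+ 𝟙} {U †} {β} {β} (λ i j → trans (+-congˡ (sym (†-𝟙 i j))) (sym (restore _ _))) (λ _ _ → refl) ⟩
          U † ⊡ β                  M.∎
          where
            module M = SetoidReasoning (matrixSetoid n)
            restore : ∀ x y → x ≈ x - y + y
            restore x y = sym (//-rightDividesˡ y x)

        from-form : (∃₂ λ β γ → D.SelfDual N β γ × γ ⊡ β ≋ 𝟙) → _
        from-form (β , γ , S , γβ≈1) = (β , γ , γβ≈1 , βγ≈1) ,
          R.trans {β ⊡ U ⊡ γ} {U † ⊡ β ⊡ γ} (⊡-cong {A = β ⊡ U} {U † ⊡ β} {γ} {γ} (βU≋U†β S.β.intertwine) (λ _ _ → refl))
            (R.trans {U † ⊡ β ⊡ γ} {U † ⊡ (β ⊡ γ)} (⊡-assoc (U †) β γ)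
              (R.trans {U † ⊡ (β ⊡ γ)} {U † ⊡ 𝟙} (⊡-cong {A = U †} {U †} {β ⊡ γ} {𝟙} (λ _ _ → refl) βγ≈1) (⊡-identityʳ (U †))))
          where
            module S = D.SelfDual N S
            -- Both matrices are symmetric under †, so applying † to `γ ⊡ β ≋ 𝟙` gives the inverse
            -- on the other side.
            βγ≈1 : β ⊡ γ ≋ 𝟙
            βγ≈1 = R.trans {β ⊡ γ} {β † ⊡ γ †} (⊡-cong {A = β} {β †} {γ} {γ †} (R.sym {β †} {β} S.β.symmetric) (R.sym {γ †} {γ} S.γ.symmetric))
              (R.trans {β † ⊡ γ †} {(γ ⊡ β) †} (R.sym {(γ ⊡ β) †} {β † ⊡ γ †} (†-anti γ β))
                (R.trans {(γ ⊡ β) †} {𝟙 †} {𝟙} (†-cong {A = γ ⊡ β} {𝟙} γβ≈1) †-𝟙))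

-- Induction and anti-automorphisms

module _ (G : Group a ℓ) where
  open Group G
  open import Algebra.Properties.Group G using (identityˡ-unique; inverseˡ-unique; ⁻¹-involutive)

  record AntiAutomorphism : Set (a ⊔ ℓ) where
    field
      τ            : Carrier → Carrier
      τ-cong       : ∀ {x y} → x ≈ y → τ x ≈ τ y
      τ-∙          : ∀ x y → τ (x ∙ y) ≈ τ y ∙ τ x
      τ-involutive : ∀ x → τ (τ x) ≈ x

    τ-ε : τ ε ≈ ε
    τ-ε = identityˡ-unique (τ ε) (τ ε) (trans (sym (τ-∙ ε ε)) (τ-cong (identityˡ ε)))

    τ-⁻¹ : ∀ x → τ (x ⁻¹) ≈ τ x ⁻¹
    τ-⁻¹ x = inverseˡ-unique _ _ (trans (sym (τ-∙ x (x ⁻¹))) (trans (τ-cong (inverseʳ x)) τ-ε))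

    τ-conj : ∀ x g → τ (x ∙ g ∙ x ⁻¹) ≈ τ (x ⁻¹) ∙ τ g ∙ τ (x ⁻¹) ⁻¹
    τ-conj x g = trans (τ-∙ (x ∙ g) (x ⁻¹)) (trans (∙-congˡ (τ-∙ x g)) (trans (sym (assoc _ _ _))
      (∙-congˡ (trans (sym (⁻¹-involutive (τ x))) (⁻¹-cong (sym (τ-⁻¹ x)))))))

    τ⁻¹-inverse : Inverse setoid setoid
    τ⁻¹-inverse = record
      { to = λ x → τ (x ⁻¹) ; from = λ x → τ x ⁻¹
      ; to-cong = λ e → τ-cong (⁻¹-cong e) ; from-cong = λ e → ⁻¹-cong (τ-cong e)
      ; inverse = (λ {x} e → trans (τ-cong (⁻¹-cong e)) (trans (τ-cong (⁻¹-involutive (τ x))) (τ-involutive x)))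
                , (λ {x} e → trans (⁻¹-cong (τ-cong e)) (trans (⁻¹-cong (τ-involutive (x ⁻¹))) (⁻¹-involutive x)))
      }

module InducedClassFunctions {q ℓq ℓq′ k ℓk ℓk′}
  (𝔽 : FiniteField q ℓq ℓq′) (𝕂 : CharacteristicZeroField k ℓk ℓk′) where

  open Unitriangular 𝔽 𝕂
  private
    module K = CommutativeRing (CharacteristicZeroField.commutativeRing 𝕂)

  module _ (G : Group a ℓ) (finite : Finite (Group.setoid G)) (H : DecSubgroup G p)
    (anti : AntiAutomorphism G) where
    open Group G
    open DecSubgroup H using (_∈; _∈?; ∈-resp-≈)
    open AntiAutomorphism anti
    private
      module H = DecSubgroup H
      open FiniteGroup G finite using (Ind; extend; extend-cong)
      open FiniteSum K.+-commutativeMonoid using (∑; ∑-cong; ∑-reindex)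

    extend-∉ : ∀ ψ {g} → ¬ (g ∈) → extend H ψ g K.≈ K.0#
    extend-∉ ψ {g} g∉ with g ∈?
    ... | yes g∈ = contradiction g∈ g∉
    ... | no _   = K.refl

    module _ (τ-∈ : ∀ {x} → x ∈ → τ x ∈) (τ-conjugate : ∀ u → u ∈ → ∃[ x ] x ∙ u ∙ x ⁻¹ ≈ τ u)
      (φ ψ : ClassFunction H.group) (φ≈ψτ : ∀ u (u∈ : u ∈) → fun φ (u , u∈) K.≈ fun ψ (τ u , τ-∈ u∈)) where

      extend-τ : ∀ g → extend H φ g K.≈ extend H ψ (τ g)
      extend-τ g with g ∈? | τ g ∈?
      ... | yes g∈ | yes τg∈ = K.trans (φ≈ψτ g g∈) (fun-cong ψ refl)
      ... | yes g∈ | no  τg∉ = contradiction (τ-∈ g∈) τg∉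
      ... | no g∉  | yes τg∈ = contradiction (∈-resp-≈ (τ-involutive g) (τ-∈ τg∈)) g∉
      ... | no _   | no _    = K.refl

      private
        -- τ sends the conjugate of `u` by `x` to the conjugate of `τ u` by `τ (x ⁻¹)`, that is, of
        -- `u` by `τ (x ⁻¹) ∙ z`. This conjugator runs through the group bijectively as `x` does, so
        -- the sum can be reindexed.
        at-subgroup : ∀ u → ∃[ z ] z ∙ u ∙ z ⁻¹ ≈ τ u → fun (⟦ Ind H ⟧ φ) u K.≈ fun (⟦ Ind H ⟧ ψ) u
        at-subgroup u (z , zuz⁻¹≈τu) = K.*-congˡ (K.trans
          (∑-cong finite λ x → K.trans (extend-τ (x ∙ u ∙ x ⁻¹)) (extend-cong H ψ (rewriteᵗ x)))
          (∑-reindex finite (λ x → extend H ψ (x ∙ u ∙ x ⁻¹)) (λ e → extend-cong H ψ (conj-cong G e (refl {u})))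
            (Comp.inverse τ⁻¹-inverse (translation G z))))
          where
            rewriteᵗ : ∀ x → τ (x ∙ u ∙ x ⁻¹) ≈ (τ (x ⁻¹) ∙ z) ∙ u ∙ (τ (x ⁻¹) ∙ z) ⁻¹
            rewriteᵗ x = trans (τ-conj x u) (trans (conj-cong G refl (sym zuz⁻¹≈τu)) (conj-∙ G (τ (x ⁻¹)) z u))

      -- Both sides are class functions, so `g` may be replaced by a conjugate in the subgroup; if
      -- there is none, every summand on either side is zero.
      Ind-τ : ∀ g → fun (⟦ Ind H ⟧ φ) g K.≈ fun (⟦ Ind H ⟧ ψ) g
      Ind-τ g = by-cases (Finite.any? finite (λ e → ∈-resp-≈ (conj-cong G e refl)) (λ x → x ∙ g ∙ x ⁻¹ ∈?))
        where
          by-cases : Dec (∃[ x ] x ∙ g ∙ x ⁻¹ ∈) → fun (⟦ Ind H ⟧ φ) g K.≈ fun (⟦ Ind H ⟧ ψ) g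
          by-cases (yes (x , u∈)) = K.trans (K.sym (fun-conj (⟦ Ind H ⟧ φ) x g))
            (K.trans (at-subgroup (x ∙ g ∙ x ⁻¹) (τ-conjugate _ u∈)) (fun-conj (⟦ Ind H ⟧ ψ) x g))
          by-cases (no ∄x) = K.*-congˡ (∑-cong finite λ x → K.trans
            (extend-∉ φ (λ u∈ → ∄x (x , u∈))) (K.sym (extend-∉ ψ (λ u∈ → ∄x (x , u∈)))))

  †-anti-GL : ∀ n → AntiAutomorphism (GL n)
  †-anti-GL n = record
    { τ            = _†-GL
    ; τ-cong       = λ {x} {y} → †-cong {A = proj₁ x} {proj₁ y}
    ; τ-∙          = λ x y → †-anti (proj₁ x) (proj₁ y)
    ; τ-involutive = λ x → AntiInvolution.†-involutive (UnipotentSimilarity.†-antiInvolution 𝔽 𝕂 n) (proj₁ x)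
    }

  Ind-𝔡 : ∀ n → Ind-UT n ∘ₗ 𝔡ₙ n ≗ₗ Ind-UT n
  Ind-𝔡 n ψ = Ind-τ (GL n) (GL-finite n) (patternSubgroup (upper n)) (†-anti-GL n)
    (λ {x} α → proj₂ ((x , α) †-UT)) (λ u u∈ → UnipotentSimilarity.†-conjugate 𝔽 𝕂 (u , u∈))
    (⟦ 𝔡ₙ n ⟧ ψ) ψ (λ u u∈ → K.refl)

-- Direct sums and tensor products

module LinearAlgebraProperties {q ℓq ℓq′ k ℓk ℓk′}
  (𝔽 : FiniteField q ℓq ℓq′) (𝕂 : CharacteristicZeroField k ℓk ℓk′) where

  open Unitriangular 𝔽 𝕂

  module RangeSum (P : VS p ℓp) where
    open LeftModule P

    ∑< : ℕ → (ℕ → Carrierᴹ) → Carrierᴹ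
    ∑< zero    g = 0ᴹ
    ∑< (suc N) g = ∑< N g +ᴹ g N

    ∑<-cong : ∀ N {g g′} → (∀ n → g n ≈ᴹ g′ n) → ∑< N g ≈ᴹ ∑< N g′
    ∑<-cong zero    e = ≈ᴹ-refl
    ∑<-cong (suc N) e = +ᴹ-cong (∑<-cong N e) (e N)

    ∑<-unique : (S : ℕ → (ℕ → Carrierᴹ) → Carrierᴹ) → (∀ g → S zero g ≈ᴹ 0ᴹ) →
                (∀ N g → S (suc N) g ≈ᴹ S N g +ᴹ g N) → ∀ N g → S N g ≈ᴹ ∑< N g
    ∑<-unique S base step zero    g = base g
    ∑<-unique S base step (suc N) g = ≈ᴹ-trans (step N g) (+ᴹ-congʳ (∑<-unique S base step N g))

  module _ {M : ℕ → VS u ℓu} {P : VS p ℓp} (h : ∀ n → LinearMap (M n) P) where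
    private module P = LeftModule P
    open RangeSum P

    -- The sum in the definition of ⨁-rec is local to it.  Abstracting over the
    -- bound and the summands lets unification recover it as localSum.
    mutual
      private
        localSum : ℕ → (ℕ → P.Carrierᴹ) → P.Carrierᴹ
        localSum = _

      ⨁-rec-∑< : ∀ x → ⟦ ⨁-rec h ⟧ x P.≈ᴹ ∑< (bound x) (λ n → ⟦ h n ⟧ (component x n))
      ⨁-rec-∑< x with bound x | (λ n → ⟦ h n ⟧ (component x n))
      ... | N | g = ∑<-unique localSum (λ _ → P.≈ᴹ-refl) (λ _ _ → P.≈ᴹ-refl) N g

  module _ {P : VS p ℓp} {Q : VS v ℓv} (f : LinearMap P Q) where
    private
      module Q = LeftModule Q
      module f = LinearMap f
      module ∑P = RangeSum P
      module ∑Q = RangeSum Q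

    map-∑< : ∀ N g → ⟦ f ⟧ (∑P.∑< N g) Q.≈ᴹ ∑Q.∑< N (⟦ f ⟧ ∘ g)
    map-∑< zero    g = f.0ᴹ-homo
    map-∑< (suc N) g = Q.≈ᴹ-trans (f.+ᴹ-homo _ _) (Q.+ᴹ-congʳ (map-∑< N g))

    map-sumᴸ : ∀ (Is : List (Subset n)) g → ⟦ f ⟧ (SubsetSum.sumᴸ (LeftModule.+ᴹ-commutativeMonoid P) Is g) Q.≈ᴹ
               SubsetSum.sumᴸ Q.+ᴹ-commutativeMonoid Is (⟦ f ⟧ ∘ g)
    map-sumᴸ []       g = f.0ᴹ-homo
    map-sumᴸ (I ∷ Is) g = Q.≈ᴹ-trans (f.+ᴹ-homo _ _) (Q.+ᴹ-congˡ (map-sumᴸ Is g))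

  sumₗ-apply : {P : VS p ℓp} {Q : VS v ℓv} (h : Subset n → LinearMap P Q) (Is : List (Subset n)) → ∀ x →
               ⟦ sumₗ (List.map h Is) ⟧ x ≡ SubsetSum.sumᴸ (LeftModule.+ᴹ-commutativeMonoid Q) Is (λ I → ⟦ h I ⟧ x)
  sumₗ-apply         h []       x = ≡.refl
  sumₗ-apply {Q = Q} h (I ∷ Is) x = ≡.cong (LeftModule._+ᴹ_ Q (⟦ h I ⟧ x)) (sumₗ-apply h Is x)

  ⊗-ext : {M : VS u ℓu} {N : VS v ℓv} {P : VS p ℓp} (f g : LinearMap (M ⊗ N) P) →
          (∀ x y → LeftModule._≈ᴹ_ P (⟦ f ⟧ ((x , y) ∷ [])) (⟦ g ⟧ ((x , y) ∷ []))) → f ≗ₗ g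
  ⊗-ext {P = P} f g e []            = P.≈ᴹ-trans f.0ᴹ-homo (P.≈ᴹ-sym g.0ᴹ-homo)
    where
      module P = LeftModule P
      module f = LinearMap f
      module g = LinearMap g
  ⊗-ext {P = P} f g e ((x , y) ∷ t) = P.≈ᴹ-trans (f.+ᴹ-homo ((x , y) ∷ []) t)
    (P.≈ᴹ-trans (P.+ᴹ-cong (e x y) (⊗-ext f g e t)) (P.≈ᴹ-sym (g.+ᴹ-homo ((x , y) ∷ []) t)))
    where
      module P = LeftModule P
      module f = LinearMap f
      module g = LinearMap g

  -- The sizes of a block and of its reversed partner agree only propositionally, so class functions
  -- have to be transported between the two degrees.
  castₗ : (A : ℕ → VS u ℓu) → m ≡ n → LinearMap (A m) (A n)
  castₗ {m = m} A ≡.refl = linearMap id id (λ _ _ → ≈ᴹ-refl) (λ _ _ → ≈ᴹ-refl)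
    where open LeftModule (A m)

  castₗ-component : (A : ℕ → VS u ℓu) (e : m ≡ n) (x : FinitelySupported A) →
                    component x n ≡ ⟦ castₗ A e ⟧ (component x m)
  castₗ-component A ≡.refl x = ≡.refl

  ⨁-map-ι : {M : ℕ → VS u ℓu} {N : ℕ → VS v ℓv} (h : ∀ n → LinearMap (M n) (N n)) →
            ∀ n → ⨁-map h ∘ₗ ι M n ≗ₗ ι N n ∘ₗ h n
  ⨁-map-ι {N = N} h n x i with n ℕₚ.≟ i
  ... | yes ≡.refl = LeftModule.≈ᴹ-refl (N n)
  ... | no _       = LinearMap.0ᴹ-homo (h i)

  -- `⨁-map` keeps the bound, so both sides are finite sums of the same length and can be compared
  -- term by term.
  ⨁-rec-natural : {M : ℕ → VS u ℓu} {P : VS p ℓp} {h : ∀ n → LinearMap (M n) P} {d : ∀ n → LinearMap (M n) (M n)}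
                  {f : LinearMap P P} → (∀ n → h n ∘ₗ d n ≗ₗ f ∘ₗ h n) → ⨁-rec h ∘ₗ ⨁-map d ≗ₗ f ∘ₗ ⨁-rec h
  ⨁-rec-natural {P = P} {h} {d} {f} e x = begin
    ⟦ ⨁-rec h ⟧ (⟦ ⨁-map d ⟧ x)                              ≈⟨ ⨁-rec-∑< h (⟦ ⨁-map d ⟧ x) ⟩
    ∑< (bound x) (λ n → ⟦ h n ⟧ (⟦ d n ⟧ (component x n)))    ≈⟨ ∑<-cong (bound x) (λ n → e n (component x n)) ⟩
    ∑< (bound x) (λ n → ⟦ f ⟧ (⟦ h n ⟧ (component x n)))      ≈⟨ map-∑< f (bound x) (λ n → ⟦ h n ⟧ (component x n)) ⟨
    ⟦ f ⟧ (∑< (bound x) (λ n → ⟦ h n ⟧ (component x n)))      ≈⟨ LinearMap.⟦⟧-cong f (⨁-rec-∑< h x) ⟨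
    ⟦ f ⟧ (⟦ ⨁-rec h ⟧ x)                                    ∎
    where
      open SetoidReasoning (LeftModule.≈ᴹ-setoid P)
      open RangeSum P

  sumₗ-dual : {M : VS u ℓu} {P : VS p ℓp} {h : Subset n → LinearMap M P} {d : LinearMap M M} {f : LinearMap P P} →
              (∀ I → h I ∘ₗ d ≗ₗ f ∘ₗ h (dual I)) →
              sumₗ (List.map h (subsets n)) ∘ₗ d ≗ₗ f ∘ₗ sumₗ (List.map h (subsets n))
  sumₗ-dual {n = n} {P = P} {h} {d} {f} e x = begin
    ⟦ sumₗ (List.map h (subsets n)) ⟧ (⟦ d ⟧ x)        ≡⟨ sumₗ-apply h (subsets n) (⟦ d ⟧ x) ⟩
    ∑⊆ n (λ I → ⟦ h I ⟧ (⟦ d ⟧ x))                     ≈⟨ sumᴸ-cong (subsets n) (λ I → e I x) ⟩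
    ∑⊆ n (λ I → ⟦ f ⟧ (⟦ h (dual I) ⟧ x))              ≈⟨ ∑⊆-dual n (λ I → ⟦ f ⟧ (⟦ h I ⟧ x)) ⟩
    ∑⊆ n (λ I → ⟦ f ⟧ (⟦ h I ⟧ x))                     ≈⟨ map-sumᴸ f (subsets n) (λ I → ⟦ h I ⟧ x) ⟨
    ⟦ f ⟧ (∑⊆ n (λ I → ⟦ h I ⟧ x))                     ≡⟨ ≡.cong ⟦ f ⟧ (sumₗ-apply h (subsets n) x) ⟨
    ⟦ f ⟧ (⟦ sumₗ (List.map h (subsets n)) ⟧ x)        ∎
    where
      open SetoidReasoning (LeftModule.≈ᴹ-setoid P)
      open SubsetSum (LeftModule.+ᴹ-commutativeMonoid P)

-- The antiautomorphism 𝔡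

module Duality {q ℓq ℓq′ k ℓk ℓk′}
  (𝔽 : FiniteField q ℓq ℓq′) (𝕂 : CharacteristicZeroField k ℓk ℓk′) where

  open Unitriangular 𝔽 𝕂
  open LinearAlgebraProperties 𝔽 𝕂
  private
    module K = CommutativeRing (CharacteristicZeroField.commutativeRing 𝕂)
    module 𝔽 = CommutativeRing (FiniteField.commutativeRing 𝔽)
  open CharacteristicZeroField 𝕂 using (recip)

  module _ {G : Group a ℓ} where
    open Group G
    open import Algebra.Properties.Group G using (//-rightDividesʳ)

    -- `x ∙ y` is the conjugate of `y ∙ x` by `x`.
    fun-comm : (ψ : ClassFunction G) → ∀ x y → fun ψ (x ∙ y) K.≈ fun ψ (y ∙ x)
    fun-comm ψ x y = K.trans
      (fun-cong ψ (sym (trans (∙-congʳ (sym (assoc x y x))) (//-rightDividesʳ x (x ∙ y)))))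
      (fun-conj ψ x (y ∙ x))

  fun-sum : {G : Group a ℓ} → ∀ {N} (φ : Fin N → ClassFunction G) g →
            fun (CMSum.sum (LeftModule.+ᴹ-commutativeMonoid (cf G)) φ) g K.≈ CMSum.sum K.+-commutativeMonoid (λ i → fun (φ i) g)
  fun-sum         {N = zero}  φ g = K.refl
  fun-sum {G = G} {N = suc N} φ g = K.+-congˡ (fun-sum {G = G} (φ ∘ Fin.suc) g)

  -- The bijection gives a permutation between the two enumerations, which matches the sums and
  -- forces equal sizes, hence equal normalising factors.
  average-transport : {G : Group a ℓ} {H : Group b ℓ′}
    (G-finite : Finite (Group.setoid G)) (H-finite : Finite (Group.setoid H)) (φ : Inverse (Group.setoid G) (Group.setoid H))
    (f : Group.Carrier H → K.Carrier) → (∀ {x y} → Group._≈_ H x y → f x K.≈ f y) →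
    FiniteGroup.average G G-finite (f ∘ Inverse.to φ) K.≈ FiniteGroup.average H H-finite f
  average-transport {G = G} {H} G-finite H-finite φ f f-cong = K.*-cong
    (recip-cong (↔⇒≡ π))
    (K.sym (K.trans (sum-permute (f ∘ H.elem) π)
      (sum-cong-≋ {G.size} (λ i → f-cong (H.elem-index (Inverse.to φ (G.elem i)))))))
    where
      open CMSum K.+-commutativeMonoid using (sum-permute; sum-cong-≋)
      module G = Finite G-finite
      module H = Finite H-finite
      instance
        G-size≢0 : NonZero G.size
        G-size≢0 = G.nonEmpty (Group.ε G)
        H-size≢0 : NonZero H.size
        H-size≢0 = H.nonEmpty (Group.ε H)
      π : Permutation G.size H.size
      π = Comp.inverse (Symm.inverse G.enumeration) (Comp.inverse φ H.enumeration)
      recip-cong : ∀ {m n} .{{_ : NonZero m}} .{{_ : NonZero n}} → m ≡ n → recip m K.≈ recip n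
      recip-cong ≡.refl = K.refl

  opposite-cast : (e : m ≡ n) (i : Fin m) → opposite (cast e i) ≡ cast e (opposite i)
  opposite-cast ≡.refl i = ≡.trans (≡.cong opposite (Finₚ.cast-is-id ≡.refl i)) (≡.sym (Finₚ.cast-is-id ≡.refl (opposite i)))

  fun-castₗ : (e : m ≡ n) (φ : ClassFunction (UT m)) (g : Group.Carrier (UT n)) (h : Group.Carrier (UT m)) →
              (∀ i j → proj₁ (proj₁ g) (cast e i) (cast e j) 𝔽.≈ proj₁ (proj₁ h) i j) →
              fun (⟦ castₗ cf-UT e ⟧ φ) g K.≈ fun φ h
  fun-castₗ ≡.refl φ g h g≈h = fun-cong φ {g} {h} λ i j → 𝔽.trans
    (𝔽.reflexive (≡.sym (≡.cong₂ (proj₁ (proj₁ g)) (Finₚ.cast-is-id ≡.refl i) (Finₚ.cast-is-id ≡.refl j)))) (g≈h i j)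

  -- By `cano⁻¹-cast`, taking blocks is compatible with †: up to the cast, † of the `J` block of `A`
  -- is the `I` block of `A †`. The product and the coproduct both reduce to this.
  fun-𝔡-castₗ : {I J : Subset n} → Reverses I J → (e : ∣ I ∣ ≡ ∣ J ∣) (φ : ClassFunction (UT ∣ I ∣)) →
                ∀ (g : Group.Carrier (UT ∣ J ∣)) (h : Group.Carrier (UT ∣ I ∣)) {A : Mat n} →
                proj₁ (proj₁ g) ≋ block J A → proj₁ (proj₁ h) ≋ block I (A †) →
                fun (⟦ 𝔡ₙ ∣ J ∣ ⟧ (⟦ castₗ cf-UT e ⟧ φ)) g K.≈ fun φ h
  fun-𝔡-castₗ {I = I} {J} r e φ g h {A} g≋ h≋ = fun-castₗ e φ (g †-UT) h λ i j → 𝔽.trans (g≋ _ _)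
    (𝔽.trans (𝔽.reflexive (≡.cong₂ A (position j) (position i))) (𝔽.sym (h≋ i j)))
    where
      position : ∀ i → cano⁻¹ J (opposite (cast e i)) ≡ opposite (cano⁻¹ I i)
      position i = ≡.trans (≡.cong (cano⁻¹ J) (opposite-cast e i)) (Reverses.cano⁻¹-cast r e i)

  block-diagonalPart : (I : Subset n) (A : Mat n) → block I (diagonalPart I A) ≋ block I A
  block-diagonalPart I A a b = dp-same I A (inj₁ (cano⁻¹∈ I a , cano⁻¹∈ I b))

  block-∁-diagonalPart : (I : Subset n) (A : Mat n) → block (∁ I) (diagonalPart I A) ≋ block (∁ I) A
  block-∁-diagonalPart I A a b = dp-same I A (inj₂ (x∈∁p⇒x∉p (cano⁻¹∈ (∁ I) a) , x∈∁p⇒x∉p (cano⁻¹∈ (∁ I) b)))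

  -- Compatibility with the product.

  module _ (x y : FinitelySupported cf-UT) (n : ℕ) where
    private
      term : FinitelySupported cf-UT → FinitelySupported cf-UT → Fin (suc n) → ClassFunction (UT n)
      term x y i = ⟦ μ-component n i ⟧ ((component x ∣ initial n i ∣ , component y ∣ ∁ (initial n i) ∣) ∷ [])

      -- † carries the blocks of `g` on `I` and `∁ I` to the blocks of its image on `∁ J` and `J`.
      -- The two factors thus trade places, as multiplication of values permits.
      term-𝔡 : ∀ i g → fun (term (⟦ 𝔡 ⟧ x) (⟦ 𝔡 ⟧ y) i) g K.≈ fun (term y x (opposite i)) (g †-UT)
      term-𝔡 i g = K.+-congʳ (K.trans (K.*-comm _ _) (K.*-cong
        (factor y (Dual⇒Reverses-∁ʳ (Dual-sym d)) (≡.sym (∣∁I∣≡∣J∣ d))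
          (Hom.⟦ UL→UT-∁ I ⟧ l) (Hom.⟦ UL→UT J ⟧ l†) (block-∁-diagonalPart I A) (block-diagonalPart J (A †)))
        (factor x (Dual⇒Reverses-∁ˡ (Dual-sym d)) (≡.sym (∣I∣≡∣∁J∣ d))
          (Hom.⟦ UL→UT I ⟧ l) (Hom.⟦ UL→UT-∁ J ⟧ l†) (block-diagonalPart I A) (block-∁-diagonalPart J (A †)))))
        where
          I = initial n i
          J = initial n (opposite i)
          d = initial-Dual n i
          A = proj₁ (proj₁ g)
          l  = Hom.⟦ UP→UL I ⟧ (Hom.⟦ UT⊆UP n i ⟧ g)
          l† = Hom.⟦ UP→UL J ⟧ (Hom.⟦ UT⊆UP n (opposite i) ⟧ (g †-UT))

          factor : ∀ (x : FinitelySupported cf-UT) {P Q : Subset n} → Reverses P Q → ∣ P ∣ ≡ ∣ Q ∣ →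
                   ∀ (g : Group.Carrier (UT ∣ Q ∣)) (h : Group.Carrier (UT ∣ P ∣)) →
                   proj₁ (proj₁ g) ≋ block Q A → proj₁ (proj₁ h) ≋ block P (A †) →
                   fun (⟦ 𝔡ₙ ∣ Q ∣ ⟧ (component x ∣ Q ∣)) g K.≈ fun (component x ∣ P ∣) h
          factor x {P} {Q} r e g h g≋ h≋ = K.trans
            (K.reflexive (≡.cong (λ φ → fun (⟦ 𝔡ₙ ∣ Q ∣ ⟧ φ) g) (castₗ-component cf-UT e x)))
            (fun-𝔡-castₗ r e (component x ∣ P ∣) g h {A} g≋ h≋)

    μ-𝔡-pure : ∀ g → fun (component (⟦ μ ⟧ ((⟦ 𝔡 ⟧ x , ⟦ 𝔡 ⟧ y) ∷ [])) n) g K.≈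
                     fun (component (⟦ μ ⟧ ((y , x) ∷ [])) n) (g †-UT)
    -- `lift` adds a zero after the single pure tensor, on both sides; the congruence strips it.
    μ-𝔡-pure g = K.+-congʳ (begin
      fun (Σ.sum (term (⟦ 𝔡 ⟧ x) (⟦ 𝔡 ⟧ y))) g                   ≈⟨ fun-sum {G = UT n} (term (⟦ 𝔡 ⟧ x) (⟦ 𝔡 ⟧ y)) g ⟩
      ΣK.sum (λ i → fun (term (⟦ 𝔡 ⟧ x) (⟦ 𝔡 ⟧ y) i) g)          ≈⟨ ΣK.sum-cong-≋ {suc n} (λ i → term-𝔡 i g) ⟩
      ΣK.sum (λ i → fun (term y x (opposite i)) (g †-UT))        ≈⟨ ΣK.sum-permute (λ i → fun (term y x i) (g †-UT)) (reverse {suc n}) ⟨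
      ΣK.sum (λ i → fun (term y x i) (g †-UT))                   ≈⟨ fun-sum {G = UT n} (term y x) (g †-UT) ⟨
      fun (Σ.sum (term y x)) (g †-UT)                            ∎)
      where
        open SetoidReasoning K.setoid
        module Σ  = CMSum (LeftModule.+ᴹ-commutativeMonoid (cf-UT n))
        module ΣK = CMSum K.+-commutativeMonoid

  μ-𝔡 : μ ∘ₗ (𝔡 ⊗₁ 𝔡) ≗ₗ 𝔡 ∘ₗ μ ∘ₗ swap
  μ-𝔡 = ⊗-ext (μ ∘ₗ (𝔡 ⊗₁ 𝔡)) (𝔡 ∘ₗ μ ∘ₗ swap) μ-𝔡-pure

  -- Compatibility with the coproduct.

  †-pattern : (P Q : Pattern n) → (∀ {i j} → Pattern._◁_ P (opposite j) (opposite i) → Pattern._◁_ Q i j) →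
              {A : Mat n} → HasPattern P A → HasPattern Q (A †)
  †-pattern P Q P⇒Q {A} α i j i⋪j = 𝔽.trans (α (opposite j) (opposite i) (i⋪j ∘ P⇒Q)) (†-𝟙 i j)

  module _ {n : ℕ} {I J : Subset n} (d : Dual I J) where
    private
      open Dual d
      ∈⇒∉′ : ∀ {j} → opposite j ∈ I → j ∉ J
      ∈⇒∉′ {j} p = ≡.subst (_∉ J) (Finₚ.opposite-involutive j) (∈⇒∉ p)
      ∉⇒∈′ : ∀ {j} → opposite j ∉ I → j ∈ J
      ∉⇒∈′ {j} p = ≡.subst (_∈ J) (Finₚ.opposite-involutive j) (∉⇒∈ p)

    _†-UL : Group.Carrier (UL I) → Group.Carrier (UL J)
    (x , α) †-UL = x †-GL , †-pattern (ul I) (ul J) (λ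
      { (lt , inj₁ (p , q)) → opposite-cancel-< lt , inj₂ (∈⇒∉′ q , ∈⇒∉′ p)
      ; (lt , inj₂ (p , q)) → opposite-cancel-< lt , inj₁ (∉⇒∈′ q , ∉⇒∈′ p) }) {proj₁ x} α

    _†-UR : Group.Carrier (UR I) → Group.Carrier (UR J)
    (x , α) †-UR = x †-GL , †-pattern (ur I) (ur J)
      (λ (lt , p , q) → opposite-cancel-< lt , ∉⇒∈′ q , ∈⇒∉′ p) {proj₁ x} α

  †-≋ : {A B : Mat n} → A ≋ B † → A † ≋ B
  †-≋ {B = B} e i j = 𝔽.trans (e _ _) (𝔽.reflexive (≡.cong₂ B (Finₚ.opposite-involutive i) (Finₚ.opposite-involutive j)))

  UR-inverse : {I J : Subset n} → Dual I J → Inverse (Group.setoid (UR I)) (Group.setoid (UR J))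
  UR-inverse d = record
    { to = _†-UR d ; from = _†-UR (Dual-sym d)
    ; to-cong = λ {x} {y} → †-cong {A = proj₁ (proj₁ x)} {proj₁ (proj₁ y)}
    ; from-cong = λ {x} {y} → †-cong {A = proj₁ (proj₁ x)} {proj₁ (proj₁ y)}
    ; inverse = (λ {x} {y} → †-≋ {A = proj₁ (proj₁ y)} {proj₁ (proj₁ x)})
              , (λ {x} {y} → †-≋ {A = proj₁ (proj₁ y)} {proj₁ (proj₁ x)})
    }

  module _ {n : ℕ} {I J : Subset n} (d : Dual I J) (ψ : ClassFunction (UT n)) where
    private
      module UTₙ = Group (UT n)

      toUT : ∀ K → Group.Carrier (UL K) → Group.Carrier (UR K) → UTₙ.Carrier
      toUT K y x = Hom.⟦ UP⊆UT K ⟧ (Group._∙_ (UP K) (Hom.⟦ UL⊆UP K ⟧ y) (Hom.⟦ UR⊆UP K ⟧ x))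

      summand : ∀ y x → fun (⟦ 𝔡ₙ n ⟧ ψ) (toUT I y x) K.≈ fun ψ (toUT J (_†-UL d y) (_†-UR d x))
      summand y x = K.trans
        (fun-cong ψ {toUT I y x †-UT} {x′ UTₙ.∙ y′} (†-anti (proj₁ (proj₁ y)) (proj₁ (proj₁ x))))
        -- † has put the `UR` factor in front of the `UL` factor; a class function allows swapping
        -- them back into the order used by `Def`.
        (K.trans (fun-comm ψ x′ y′) (fun-cong ψ {y′ UTₙ.∙ x′} {toUT J (_†-UL d y) (_†-UR d x)} (λ _ _ → 𝔽.refl)))
        where
          x′ y′ : UTₙ.Carrier
          x′ = Hom.⟦ UP⊆UT J ⟧ (Hom.⟦ UR⊆UP J ⟧ (_†-UR d x))
          y′ = Hom.⟦ UP⊆UT J ⟧ (Hom.⟦ UL⊆UP J ⟧ (_†-UL d y))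

    Def-Res-𝔡 : ∀ y → fun (⟦ Def-UP I ∘ₗ Res-UP I ∘ₗ 𝔡ₙ n ⟧ ψ) y K.≈ fun (⟦ Def-UP J ∘ₗ Res-UP J ⟧ ψ) (_†-UL d y)
    Def-Res-𝔡 y = K.trans
      (FiniteGroup.average-cong (UR I) (UR-finite I) {λ x → fun (⟦ 𝔡ₙ n ⟧ ψ) (toUT I y x)} (summand y))
      (average-transport {G = UR I} {UR J} (UR-finite I) (UR-finite J) (UR-inverse d)
        (λ x → fun ψ (toUT J (_†-UL d y) x))
        (λ {x} {x′} e → fun-cong ψ {toUT J (_†-UL d y) x} {toUT J (_†-UL d y) x′}
          (⊡-cong {A = proj₁ (proj₁ y) †} {proj₁ (proj₁ y) †} {proj₁ (proj₁ x)} {proj₁ (proj₁ x′)} (λ _ _ → 𝔽.refl) e)))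

  ι-𝔡-castₗ : (e : m ≡ n) → ι cf-UT n ∘ₗ 𝔡ₙ n ∘ₗ castₗ cf-UT e ≗ₗ 𝔡 ∘ₗ ι cf-UT m
  ι-𝔡-castₗ {m} ≡.refl φ i g = K.sym (⨁-map-ι 𝔡ₙ m φ i g)

  module _ {n : ℕ} {I J : Subset n} (d : Dual I J) where
    private
      e  = ≡.sym (∣∁I∣≡∣J∣ d)
      e∁ = ≡.sym (∣I∣≡∣∁J∣ d)

    𝔡-castₗ : LinearMap (cf-UT ∣ J ∣) (cf-UT ∣ ∁ I ∣)
    𝔡-castₗ = 𝔡ₙ ∣ ∁ I ∣ ∘ₗ castₗ cf-UT e

    𝔡-castₗ-∁ : LinearMap (cf-UT ∣ ∁ J ∣) (cf-UT ∣ I ∣)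
    𝔡-castₗ-∁ = 𝔡ₙ ∣ I ∣ ∘ₗ castₗ cf-UT e∁

    -- The part of `swap ∘ₗ (𝔡 ⊗₁ 𝔡)` in a single bidegree, corrected by the casts between block
    -- sizes.
    swap-𝔡 : LinearMap (cf-UT ∣ J ∣ ⊗ cf-UT ∣ ∁ J ∣) (cf-UT ∣ I ∣ ⊗ cf-UT ∣ ∁ I ∣)
    swap-𝔡 = swap ∘ₗ (𝔡-castₗ ⊗₁ 𝔡-castₗ-∁)

    st⁻¹-swap : ∀ t y → fun (⟦ st⁻¹ I ⟧ (⟦ swap-𝔡 ⟧ t)) y K.≈ fun (⟦ st⁻¹ J ⟧ t) (_†-UL d y)
    st⁻¹-swap []              y = K.refl
    st⁻¹-swap ((φ , φ′) ∷ t) y = K.+-cong (K.trans (K.*-comm _ _) (K.*-cong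
      (fun-𝔡-castₗ (Dual⇒Reverses-∁ʳ (Dual-sym d)) e φ (Hom.⟦ UL→UT-∁ I ⟧ y) (Hom.⟦ UL→UT J ⟧ (_†-UL d y))
        {proj₁ (proj₁ y)} (λ _ _ → 𝔽.refl) (λ _ _ → 𝔽.refl))
      (fun-𝔡-castₗ (Dual⇒Reverses-∁ˡ (Dual-sym d)) e∁ φ′ (Hom.⟦ UL→UT I ⟧ y) (Hom.⟦ UL→UT-∁ J ⟧ (_†-UL d y))
        {proj₁ (proj₁ y)} (λ _ _ → 𝔽.refl) (λ _ _ → 𝔽.refl))))
      (st⁻¹-swap t y)

    -- `st` involves a sum over a whole group, whereas `st⁻¹` of a pure tensor is a product of two
    -- values. So the comparison is made after `st⁻¹`, and the inverse laws on `I` and `J` carry it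
    -- back.
    st-† : (φ : ClassFunction (UL I)) (ψ : ClassFunction (UL J)) → (∀ y → fun φ y K.≈ fun ψ (_†-UL d y)) →
           LeftModule._≈ᴹ_ (cf-UT ∣ I ∣ ⊗ cf-UT ∣ ∁ I ∣) (⟦ st I ⟧ φ) (⟦ swap-𝔡 ⟧ (⟦ st J ⟧ ψ))
    st-† φ ψ φ≈ψ† = ≈-trans {t = ⟦ st I ⟧ φ} {⟦ st I ⟧ (⟦ st⁻¹ I ⟧ t)} {t}
      (LinearMap.⟦⟧-cong (st I) {φ} {⟦ st⁻¹ I ⟧ t} φ≈st⁻¹t)
      (FiniteGroup.cf-split-join (UT ∣ I ∣) (UT-finite ∣ I ∣) {H = UT ∣ ∁ I ∣} {L = UL I} (UL→UT×UT I) (UT×UT→UL I) (UT×UT→UL→UT×UT I) t)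
      where
        t : FormalSum (cf-UT ∣ I ∣) (cf-UT ∣ ∁ I ∣)
        t = ⟦ swap-𝔡 ⟧ (⟦ st J ⟧ ψ)

        φ≈st⁻¹t : ∀ y → fun φ y K.≈ fun (⟦ st⁻¹ I ⟧ t) y
        φ≈st⁻¹t y = K.trans (φ≈ψ† y) (K.sym (K.trans (st⁻¹-swap (⟦ st J ⟧ ψ) y)
          (FiniteGroup.cf-join-split (UT ∣ J ∣) (UT-finite ∣ J ∣) {H = UT ∣ ∁ J ∣} {L = UL J} (UL→UT×UT J) (UT×UT→UL J)
            (UL→UT×UT→UL J) ψ (_†-UL d y))))

    st-𝔡 : ∀ ψ → LeftModule._≈ᴹ_ (cf-UT ∣ I ∣ ⊗ cf-UT ∣ ∁ I ∣)
      (⟦ st I ⟧ (⟦ Def-UP I ∘ₗ Res-UP I ∘ₗ 𝔡ₙ n ⟧ ψ)) (⟦ swap-𝔡 ⟧ (⟦ st J ⟧ (⟦ Def-UP J ∘ₗ Res-UP J ⟧ ψ)))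
    st-𝔡 ψ = st-† (⟦ Def-UP I ∘ₗ Res-UP I ∘ₗ 𝔡ₙ n ⟧ ψ) (⟦ Def-UP J ∘ₗ Res-UP J ⟧ ψ) (Def-Res-𝔡 d ψ)

    ι-swap : (ι cf-UT ∣ I ∣ ⊗₁ ι cf-UT ∣ ∁ I ∣) ∘ₗ swap-𝔡 ≗ₗ
             swap ∘ₗ (𝔡 ⊗₁ 𝔡) ∘ₗ (ι cf-UT ∣ J ∣ ⊗₁ ι cf-UT ∣ ∁ J ∣)
    ι-swap = ⊗-ext ((ι cf-UT ∣ I ∣ ⊗₁ ι cf-UT ∣ ∁ I ∣) ∘ₗ swap-𝔡)
      (swap ∘ₗ (𝔡 ⊗₁ 𝔡) ∘ₗ (ι cf-UT ∣ J ∣ ⊗₁ ι cf-UT ∣ ∁ J ∣))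
      λ φ φ′ → ⊗-cong (ι-𝔡-castₗ e∁ φ′) (ι-𝔡-castₗ e φ)

    Δ-component-𝔡 : Δ-component I ∘ₗ 𝔡ₙ n ≗ₗ swap ∘ₗ (𝔡 ⊗₁ 𝔡) ∘ₗ Δ-component J
    Δ-component-𝔡 ψ = ≈-trans
      (LinearMap.⟦⟧-cong (ι cf-UT ∣ I ∣ ⊗₁ ι cf-UT ∣ ∁ I ∣) (st-𝔡 ψ))
      (ι-swap (⟦ st J ∘ₗ Def-UP J ∘ₗ Res-UP J ⟧ ψ))

  Δ-𝔡 : Δ ∘ₗ 𝔡 ≗ₗ swap ∘ₗ (𝔡 ⊗₁ 𝔡) ∘ₗ Δ
  Δ-𝔡 = ⨁-rec-natural {P = cf-UT• ⊗ cf-UT•} {λ n → sumₗ (List.map Δ-component (subsets n))} {𝔡ₙ} {swap ∘ₗ (𝔡 ⊗₁ 𝔡)}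
    λ n → sumₗ-dual {P = cf-UT• ⊗ cf-UT•} {Δ-component} {𝔡ₙ n} {swap ∘ₗ (𝔡 ⊗₁ 𝔡)}
      λ I → Δ-component-𝔡 (dual-Dual I)

  -- Bijectivity.

  𝔡ₙ-involutive : ∀ n ψ → LeftModule._≈ᴹ_ (cf-UT n) (⟦ 𝔡ₙ n ⟧ (⟦ 𝔡ₙ n ⟧ ψ)) ψ
  𝔡ₙ-involutive n ψ g = fun-cong ψ {(g †-UT) †-UT} {g}
    (†-≋ {A = proj₁ (proj₁ g) †} {proj₁ (proj₁ g)} λ _ _ → 𝔽.refl)

  𝔡-isIsomorphism : IsIsomorphism 𝔡
  𝔡-isIsomorphism = record
    { isLeftModuleMonomorphism = record
      { isLeftModuleHomomorphism = LinearMap.isLeftModuleHomomorphism 𝔡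
      ; injective = λ {x} {y} e n g → K.trans (K.sym (𝔡ₙ-involutive n (component x n) g))
          (K.trans (e n (g †-UT)) (𝔡ₙ-involutive n (component y n) g))
      }
    ; surjective = λ y → ⟦ 𝔡 ⟧ y , λ e n g → K.trans (e n (g †-UT)) (𝔡ₙ-involutive n (component y n) g)
    }

theorem6p2 : ∀ {c ℓ₁ ℓ₂ k ℓ₃ ℓ₄ : Level}
    (𝔽 : FiniteField c ℓ₁ ℓ₂) (𝕂 : CharacteristicZeroField k ℓ₃ ℓ₄) →
    let open Unitriangular 𝔽 𝕂 in
    IsIsomorphism 𝔡
    × (μ ∘ₗ (𝔡 ⊗₁ 𝔡) ≗ₗ 𝔡 ∘ₗ μ ∘ₗ swap)
    × (Δ ∘ₗ 𝔡 ≗ₗ swap ∘ₗ (𝔡 ⊗₁ 𝔡) ∘ₗ Δ)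
    × (Ind-UT• ∘ₗ 𝔡 ≗ₗ Ind-UT•)
theorem6p2 𝔽 𝕂 = 𝔡-isIsomorphism , μ-𝔡 , Δ-𝔡 , λ x n → Ind-𝔡 n (component x n)
  where
    open Unitriangular 𝔽 𝕂 using (component)
    open InducedClassFunctions 𝔽 𝕂
    open Duality 𝔽 𝕂
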